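{- If $p\colon \mathbb{N} \to (1,\infty)$ is a fast-growing order function such that $\sum_{n=0}^\infty p(n)^{ -1}$ is a recursive real, then there exists a convex sub-identical order function $g\colon\mathbb{N}\to[0,\infty)$ such that $\mathrm{LUA}(p) \leq_{\mathrm{s}} \mathrm{COMPLEX}(g)$ and $\mathrm{COMPLEX}(g) \neq \mathrm{MLR}$.
   Context: An order function is a computable (i.e. its values are uniformly computable reals), nondecreasing, unbounded function $\mathbb{N}\to\mathbb{R}$. A function $g\colon\mathbb{N}\to[0,\infty)$ is sub-identical if $\lim_{n\to\infty}(n-g(n))=\infty$; a nondecreasing $g$ is convex if $g(n+1)-g(n)\leq 1$ for all $n$. An order function $p\colon\mathbb{N}\to(1,\infty)$ is fast-growing if $\sum_{n=0}^\infty p(n)^{ -1}<\infty$. A real is recursive if it is computable. Prefix-free complexity: a prefix-free machine is a partial recursive $M$ from $\{0,1\}^*$ to $\{0,1\}^*$ with prefix-free domain; $U$ is universal if for each prefix-free machine $M$ there is $\rho$ with $U(\rho^\frown\tau)\simeq M(\tau)$ for all $\tau$. Fix a universal $U$ and let $K(\sigma)=\min\{|\tau| : U(\tau)=\sigma\}$. For $f\colon\mathbb{N}\to\mathbb{R}$, $\mathrm{COMPLEX}(f)$ is the set of $X\in\{0,1\}^{\mathbb{N}}$ for which there is $c\in\mathbb{N}$ with $K(X\upharpoonright n)\geq f(n)-c$ for all $n$. $\mathrm{MLR}$ is the set of Martin-Löf random $X\in\{0,1\}^{\mathbb{N}}$, i.e. $\mathrm{MLR}=\mathrm{COMPLEX}(\lambda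 n.\,n)$. A partial recursive $\psi\colon\subseteq\mathbb{N}\to\mathbb{N}$ is linearly universal if for every partial recursive $\theta\colon\subseteq\mathbb{N}\to\mathbb{N}$ there are $a,b\in\mathbb{N}$ with $\psi(ax+b)\simeq\theta(x)$ for all $x$. For $p\colon\mathbb{N}\to(1,\infty)$, $\mathrm{LUA}(p)$ is the set of $X\in\mathbb{N}^{\mathbb{N}}$ such that $X(n)<p(n)$ for all $n$ and, for some linearly universal partial recursive $\psi$, there is no $n\in\operatorname{dom}\psi$ with $X(n)=\psi(n)$. For $P,Q\subseteq\mathbb{N}^{\mathbb{N}}$, $P\leq_{\mathrm{s}}Q$ means there is a partial recursive functional defined on all of $Q$ that maps $Q$ into $P$. -}

module Defs where

open import Data.Bool using (Bool; true; false; if_then_else_)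
open import Data.Empty using (⊥)
open import Data.Fin using (Fin)
open import Data.Integer as ℤ using (_⊖_; +_)
open import Data.List using (List; []; _∷_; _++_; length; applyUpTo)
open import Data.List.Relation.Binary.Prefix.Heterogeneous using (Prefix)
open import Data.Nat as ℕ using (ℕ; zero; suc)
open import Data.Product using (_×_; _,_; ∃; ∃-syntax)
open import Data.Rational as ℚ using (ℚ; ½; 0ℚ; 1ℚ)
open import Data.Rational.Properties as ℚₚ using (module ≤-Reasoning)
open import Data.Rational.Solver using (module +-*-Solver)
open import Data.Sum using (inj₁; inj₂)
open import Data.Unit using (⊤)
open import Data.Vec as Vec using (Vec; []; _∷_; lookup)
open import Function using (_⇔_)
open import Level using (0ℓ)
open import Relation.Binary.PropositionalEquality
  using (_≡_; refl; sym; trans; cong; subst; subst₂)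
open import Relation.Nullary using (¬_)
open import Relation.Unary using (Pred; _∈_)

------------------------------------------------------------------------
-- Rational arithmetic

½^_ : ℕ → ℚ
½^ zero  = 1ℚ
½^ suc n = ½ ℚ.* ½^ n

dist : ℚ → ℚ → ℚ
dist p q = ℚ.∣ p ℚ.- q ∣

private
  ½+½ : ∀ x → ½ ℚ.* x ℚ.+ ½ ℚ.* x ≡ x
  ½+½ = solve 1 (λ x → con ½ :* x :+ con ½ :* x := x) refl
    where open +-*-Solver

  p≤∣p∣ : ∀ p → p ℚ.≤ ℚ.∣ p ∣
  p≤∣p∣ p with ℚₚ.≤-total 0ℚ p
  ... | inj₁ 0≤p = ℚₚ.≤-reflexive (sym (ℚₚ.0≤p⇒∣p∣≡p 0≤p))
  ... | inj₂ p≤0 = ℚₚ.≤-trans p≤0 (ℚₚ.0≤∣p∣ p)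

  ∣p∣≤ : ∀ {p q} → p ℚ.≤ q → ℚ.- p ℚ.≤ q → ℚ.∣ p ∣ ℚ.≤ q
  ∣p∣≤ {p} p≤q -p≤q with ℚₚ.∣p∣≡p∨∣p∣≡-p p
  ... | inj₁ eq = subst (ℚ._≤ _) (sym eq) p≤q
  ... | inj₂ eq = subst (ℚ._≤ _) (sym eq) -p≤q

  neg-sub : ∀ p q → ℚ.- (p ℚ.- q) ≡ q ℚ.- p
  neg-sub = solve 2 (λ p q → :- (p :- q) := q :- p) refl
    where open +-*-Solver

  dist-comm : ∀ p q → dist p q ≡ dist q p
  dist-comm p q = trans (cong ℚ.∣_∣ (sym (neg-sub q p))) (ℚₚ.∣-p∣≡∣p∣ (q ℚ.- p))

  ≤+dist : ∀ p q → p ℚ.≤ q ℚ.+ dist p q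
  ≤+dist p q = subst (ℚ._≤ q ℚ.+ dist p q) (lemma p q) (ℚₚ.+-monoʳ-≤ q (p≤∣p∣ (p ℚ.- q)))
    where
    open +-*-Solver
    lemma : ∀ p q → q ℚ.+ (p ℚ.- q) ≡ p
    lemma = solve 2 (λ p q → q :+ (p :- q) := p) refl

  ≤+⇒-≤ : ∀ {p q d} → p ℚ.≤ q ℚ.+ d → p ℚ.- q ℚ.≤ d
  ≤+⇒-≤ {p} {q} {d} h = subst (p ℚ.- q ℚ.≤_) (lemma q d) (ℚₚ.+-monoˡ-≤ (ℚ.- q) h)
    where
    open +-*-Solver
    lemma : ∀ q d → q ℚ.+ d ℚ.- q ≡ d
    lemma = solve 2 (λ q d → q :+ d :- q := d) refl

  dist≤ : ∀ {p q d} → p ℚ.≤ q ℚ.+ d → q ℚ.≤ p ℚ.+ d → dist p q ℚ.≤ d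
  dist≤ {p} {q} {d} h₁ h₂ =
    ∣p∣≤ (≤+⇒-≤ h₁) (subst (ℚ._≤ d) (sym (neg-sub p q)) (≤+⇒-≤ h₂))

  abs-≤ : ∀ p q → ℚ.∣ p ∣ ℚ.≤ ℚ.∣ q ∣ ℚ.+ dist p q
  abs-≤ p q = subst (λ r → ℚ.∣ r ∣ ℚ.≤ ℚ.∣ q ∣ ℚ.+ dist p q) (lemma p q)
                    (ℚₚ.∣p+q∣≤∣p∣+∣q∣ q (p ℚ.- q))
    where
    open +-*-Solver
    lemma : ∀ p q → q ℚ.+ (p ℚ.- q) ≡ p
    lemma = solve 2 (λ p q → q :+ (p :- q) := p) refl

  dist-abs : ∀ p q → dist ℚ.∣ p ∣ ℚ.∣ q ∣ ℚ.≤ dist p q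
  dist-abs p q = dist≤ (abs-≤ p q)
    (subst (λ d → ℚ.∣ q ∣ ℚ.≤ ℚ.∣ p ∣ ℚ.+ d) (dist-comm q p) (abs-≤ q p))

  ⊔1-≤ : ∀ p q → p ℚ.⊔ 1ℚ ℚ.≤ q ℚ.⊔ 1ℚ ℚ.+ dist p q
  ⊔1-≤ p q = ℚₚ.⊔-lub
    (ℚₚ.≤-trans (≤+dist p q) (ℚₚ.+-monoˡ-≤ (dist p q) (ℚₚ.p≤p⊔q q 1ℚ)))
    (ℚₚ.≤-trans (ℚₚ.p≤q⊔p q 1ℚ)
      (ℚₚ.≤-trans (ℚₚ.≤-reflexive (sym (ℚₚ.+-identityʳ _)))
        (ℚₚ.+-monoʳ-≤ (q ℚ.⊔ 1ℚ) (ℚₚ.0≤∣p∣ (p ℚ.- q)))))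

  dist-⊔1 : ∀ p q → dist (p ℚ.⊔ 1ℚ) (q ℚ.⊔ 1ℚ) ℚ.≤ dist p q
  dist-⊔1 p q = dist≤ (⊔1-≤ p q)
    (subst (λ d → q ℚ.⊔ 1ℚ ℚ.≤ p ℚ.⊔ 1ℚ ℚ.+ d) (dist-comm q p) (⊔1-≤ q p))

  1≤⇒pos : ∀ {p} → 1ℚ ℚ.≤ p → ℚ.Positive p
  1≤⇒pos h = ℚ.positive (ℚₚ.<-≤-trans (ℚₚ.positive⁻¹ 1ℚ) h)

  ⊔1-pos : ∀ p → ℚ.Positive (p ℚ.⊔ 1ℚ)
  ⊔1-pos p = 1≤⇒pos (ℚₚ.p≤q⊔p p 1ℚ)

recip≥1 : ℚ → ℚ
recip≥1 p = (ℚ.1/ (p ℚ.⊔ 1ℚ)) {{ℚₚ.pos⇒nonZero (p ℚ.⊔ 1ℚ) {{⊔1-pos p}}}}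

private
  recip-pos : ∀ p → ℚ.Positive (recip≥1 p)
  recip-pos p = ℚₚ.1/pos⇒pos (p ℚ.⊔ 1ℚ) {{⊔1-pos p}}

  recip-inv : ∀ p → (p ℚ.⊔ 1ℚ) ℚ.* recip≥1 p ≡ 1ℚ
  recip-inv p = ℚₚ.*-inverseʳ (p ℚ.⊔ 1ℚ) {{ℚₚ.pos⇒nonZero (p ℚ.⊔ 1ℚ) {{⊔1-pos p}}}}

  recip≤1 : ∀ p → recip≥1 p ℚ.≤ 1ℚ
  recip≤1 p = subst₂ ℚ._≤_ (ℚₚ.*-identityˡ _) (recip-inv p)
    (ℚₚ.*-monoʳ-≤-nonNeg (recip≥1 p) {{ℚₚ.pos⇒nonNeg (recip≥1 p) {{recip-pos p}}}}
      (ℚₚ.p≤q⊔p p 1ℚ))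

  ∣recip∣≤1 : ∀ p → ℚ.∣ recip≥1 p ∣ ℚ.≤ 1ℚ
  ∣recip∣≤1 p = subst (ℚ._≤ 1ℚ)
    (sym (ℚₚ.0≤p⇒∣p∣≡p (ℚₚ.<⇒≤ (ℚₚ.positive⁻¹ (recip≥1 p) {{recip-pos p}})))) (recip≤1 p)

  dist-recip : ∀ p q → dist (recip≥1 p) (recip≥1 q) ℚ.≤ dist p q
  dist-recip p q = begin
    ℚ.∣ r ℚ.- s ∣                          ≡⟨ cong ℚ.∣_∣ expand ⟩
    ℚ.∣ (Q ℚ.- P) ℚ.* r ℚ.* s ∣            ≡⟨ ℚₚ.∣p*q∣≡∣p∣*∣q∣ ((Q ℚ.- P) ℚ.* r) s ⟩
    ℚ.∣ (Q ℚ.- P) ℚ.* r ∣ ℚ.* ℚ.∣ s ∣      ≤⟨ *∣recip∣≤ ((Q ℚ.- P) ℚ.* r) q ⟩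
    ℚ.∣ (Q ℚ.- P) ℚ.* r ∣                  ≡⟨ ℚₚ.∣p*q∣≡∣p∣*∣q∣ (Q ℚ.- P) r ⟩
    ℚ.∣ Q ℚ.- P ∣ ℚ.* ℚ.∣ r ∣              ≤⟨ *∣recip∣≤ (Q ℚ.- P) p ⟩
    dist Q P                               ≤⟨ dist-⊔1 q p ⟩
    dist q p                               ≡⟨ dist-comm q p ⟩
    dist p q                               ∎
    where
    open ≤-Reasoning
    P = p ℚ.⊔ 1ℚ
    Q = q ℚ.⊔ 1ℚ
    r = recip≥1 p
    s = recip≥1 q

    *∣recip∣≤ : ∀ x p → ℚ.∣ x ∣ ℚ.* ℚ.∣ recip≥1 p ∣ ℚ.≤ ℚ.∣ x ∣
    *∣recip∣≤ x p = subst (ℚ.∣ x ∣ ℚ.* ℚ.∣ recip≥1 p ∣ ℚ.≤_) (ℚₚ.*-identityʳ _)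
      (ℚₚ.*-monoˡ-≤-nonNeg ℚ.∣ x ∣ {{ℚₚ.∣-∣-nonNeg x}} (∣recip∣≤1 p))

    rearrange : ∀ P Q r s →
      (Q ℚ.* s) ℚ.* r ℚ.- (P ℚ.* r) ℚ.* s ≡ (Q ℚ.- P) ℚ.* r ℚ.* s
    rearrange = solve 4 (λ P Q r s →
      (Q :* s) :* r :- (P :* r) :* s := (Q :- P) :* r :* s) refl
      where open +-*-Solver

    expand : r ℚ.- s ≡ (Q ℚ.- P) ℚ.* r ℚ.* s
    expand = trans
      (sym (subst₂ (λ u v → u ℚ.* r ℚ.- v ℚ.* s ≡ r ℚ.- s)
        (sym (recip-inv q)) (sym (recip-inv p))
        (solve 2 (λ r s → con 1ℚ :* r :- con 1ℚ :* s := r :- s) refl r s)))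
      (rearrange P Q r s)
      where open +-*-Solver

------------------------------------------------------------------------
-- Cauchy reals.  `approx x n` lies within 2⁻ⁿ of the real number x.

record ℝ : Set where
  field
    approx  : ℕ → ℚ
    regular : ∀ m n → dist (approx m) (approx n) ℚ.≤ ½^ m ℚ.+ ½^ n

open ℝ public

infix 4 _<_ _≤_
infixl 6 _+_ _-_

_<_ : ℝ → ℝ → Set
x < y = ∃[ n ] approx x n ℚ.+ (½^ n ℚ.+ ½^ n) ℚ.< approx y n

_≤_ : ℝ → ℝ → Set
x ≤ y = ∀ n → approx x n ℚ.≤ approx y n ℚ.+ (½^ n ℚ.+ ½^ n)

private
  0≤½^ : ∀ n → 0ℚ ℚ.≤ ½^ n
  0≤½^ zero    = ℚₚ.nonNegative⁻¹ 1ℚ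
  0≤½^ (suc n) = subst (ℚ._≤ ½ ℚ.* ½^ n) (ℚₚ.*-zeroʳ ½) (ℚₚ.*-monoˡ-≤-nonNeg ½ (0≤½^ n))

fromℚ : ℚ → ℝ
fromℚ q .approx _ = q
fromℚ q .regular m n = subst (ℚ._≤ ½^ m ℚ.+ ½^ n)
  (sym (cong ℚ.∣_∣ (ℚₚ.+-inverseʳ q))) (ℚₚ.+-mono-≤ (0≤½^ m) (0≤½^ n))

fromℕ : ℕ → ℝ
fromℕ n = fromℚ (+ n ℚ./ 1)

0ℝ 1ℝ : ℝ
0ℝ = fromℕ 0
1ℝ = fromℕ 1

-_ : ℝ → ℝ
(- x) .approx n = ℚ.- approx x n
(- x) .regular m n = subst (ℚ._≤ ½^ m ℚ.+ ½^ n)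
  (trans (dist-comm (approx x m) (approx x n)) (cong ℚ.∣_∣ (lemma (approx x m) (approx x n))))
  (regular x m n)
  where
  open +-*-Solver
  lemma : ∀ p q → q ℚ.- p ≡ ℚ.- p ℚ.- (ℚ.- q)
  lemma = solve 2 (λ p q → q :- p := :- p :- (:- q)) refl

_+_ : ℝ → ℝ → ℝ
(x + y) .approx n = approx x (suc n) ℚ.+ approx y (suc n)
(x + y) .regular m n = begin
  ℚ.∣ (a ℚ.+ b) ℚ.- (c ℚ.+ d) ∣    ≡⟨ cong ℚ.∣_∣ (regroup a b c d) ⟩
  ℚ.∣ (a ℚ.- c) ℚ.+ (b ℚ.- d) ∣    ≤⟨ ℚₚ.∣p+q∣≤∣p∣+∣q∣ (a ℚ.- c) (b ℚ.- d) ⟩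
  dist a c ℚ.+ dist b d            ≤⟨ ℚₚ.+-mono-≤ (regular x (suc m) (suc n)) (regular y (suc m) (suc n)) ⟩
  (½ ℚ.* ½^ m ℚ.+ ½ ℚ.* ½^ n) ℚ.+ (½ ℚ.* ½^ m ℚ.+ ½ ℚ.* ½^ n)
                                   ≡⟨ halves (½^ m) (½^ n) ⟩
  ½^ m ℚ.+ ½^ n                    ∎
  where
  open ≤-Reasoning
  a = approx x (suc m)
  b = approx y (suc m)
  c = approx x (suc n)
  d = approx y (suc n)

  regroup : ∀ a b c d → (a ℚ.+ b) ℚ.- (c ℚ.+ d) ≡ (a ℚ.- c) ℚ.+ (b ℚ.- d)
  regroup = solve 4 (λ a b c d → (a :+ b) :- (c :+ d) := (a :- c) :+ (b :- d)) refl
    where open +-*-Solver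

  halves : ∀ u v → (½ ℚ.* u ℚ.+ ½ ℚ.* v) ℚ.+ (½ ℚ.* u ℚ.+ ½ ℚ.* v) ≡ u ℚ.+ v
  halves u v = trans
    (solve 2 (λ u v → (u :+ v) :+ (u :+ v) := (u :+ u) :+ (v :+ v)) refl (½ ℚ.* u) (½ ℚ.* v))
    (trans (cong (ℚ._+ _) (½+½ u)) (cong (u ℚ.+_) (½+½ v)))
    where open +-*-Solver

_-_ : ℝ → ℝ → ℝ
x - y = x + (- y)

∣_∣ : ℝ → ℝ
∣ x ∣ .approx n = ℚ.∣ approx x n ∣
∣ x ∣ .regular m n =
  ℚₚ.≤-trans (dist-abs (approx x m) (approx x n)) (regular x m n)

-- A rational approximation of a real x > 1 may itself be less than 1, so it is
-- replaced by its maximum with 1 before being inverted; the limit is still x⁻¹.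
recip : (x : ℝ) → .(1ℝ < x) → ℝ
recip x _ .approx n = recip≥1 (approx x n)
recip x _ .regular m n =
  ℚₚ.≤-trans (dist-recip (approx x m) (approx x n)) (regular x m n)

_⟶_ : (ℕ → ℝ) → ℝ → Set
a ⟶ l = ∀ k → ∃[ N ] ∀ n → N ℕ.≤ n → ∣ a n - l ∣ ≤ fromℚ (½^ k)

_⟶∞ : (ℕ → ℝ) → Set
a ⟶∞ = ∀ b → ∃[ N ] ∀ n → N ℕ.≤ n → b ≤ a n

partialSum : (ℕ → ℝ) → ℕ → ℝ
partialSum a zero    = 0ℝ
partialSum a (suc n) = partialSum a n + a n

------------------------------------------------------------------------
-- Partial recursive functions and functionals

-- Kleene's μ-recursive function schemes, with one unary oracle for each
-- element of O.
data Code (O : Set) : ℕ → Set where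
  zero   : Code O 0
  succ   : Code O 1
  proj   : ∀ {n} → Fin n → Code O n
  oracle : O → Code O 1
  comp   : ∀ {m n} → Code O m → Vec (Code O n) m → Code O n
  prec   : ∀ {n} → Code O n → Code O (2 ℕ.+ n) → Code O (1 ℕ.+ n)
  mu     : ∀ {n} → Code O (1 ℕ.+ n) → Code O n

-- `⟦ e ⟧ X xs y`: the computation e with oracle X on input xs halts with
-- output y.
mutual
  ⟦_⟧ : ∀ {O n} → Code O n → (O → ℕ → ℕ) → Vec ℕ n → ℕ → Set
  ⟦ zero ⟧      X []           y = y ≡ 0
  ⟦ succ ⟧      X (x ∷ [])     y = y ≡ suc x
  ⟦ proj i ⟧    X xs           y = y ≡ lookup xs i
  ⟦ oracle o ⟧  X (x ∷ [])     y = y ≡ X o x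
  ⟦ comp f gs ⟧ X xs           y = ∃[ zs ] ⟦ gs ⟧* X xs zs × ⟦ f ⟧ X zs y
  ⟦ prec f g ⟧  X (zero ∷ xs)  y = ⟦ f ⟧ X xs y
  ⟦ prec f g ⟧  X (suc k ∷ xs) y =
    ∃[ r ] ⟦ prec f g ⟧ X (k ∷ xs) r × ⟦ g ⟧ X (k ∷ r ∷ xs) y
  ⟦ mu f ⟧      X xs           y =
    ⟦ f ⟧ X (y ∷ xs) 0 × (∀ i → i ℕ.< y → ∃[ r ] ⟦ f ⟧ X (i ∷ xs) (suc r))

  ⟦_⟧* : ∀ {O m n} → Vec (Code O n) m → (O → ℕ → ℕ) → Vec ℕ n → Vec ℕ m → Set
  ⟦ [] ⟧*     X xs []       = ⊤
  ⟦ g ∷ gs ⟧* X xs (z ∷ zs) = ⟦ g ⟧ X xs z × ⟦ gs ⟧* X xs zs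

PartialRecursive : ℕ → Set
PartialRecursive n = Code ⊥ n

_·_↦_ : ∀ {n} → PartialRecursive n → Vec ℕ n → ℕ → Set
e · xs ↦ y = ⟦ e ⟧ (λ ()) xs y

Recursive₂ : (ℕ → ℕ → ℕ) → Set
Recursive₂ f = ∃[ e ] ∀ m n → e · (m ∷ n ∷ []) ↦ f m n

Functional : Set
Functional = Code ⊤ 1

_⟨_⟩≡_ : Functional → (ℕ → ℕ) → (ℕ → ℕ) → Set
Φ ⟨ X ⟩≡ Y = ∀ n → ⟦ Φ ⟧ (λ _ → X) (n ∷ []) (Y n)

_≤ₛ_ : Pred (ℕ → ℕ) 0ℓ → Pred (ℕ → ℕ) 0ℓ → Set
P ≤ₛ Q = ∃[ Φ ] ∀ X → X ∈ Q → ∃[ Y ] Φ ⟨ X ⟩≡ Y × Y ∈ P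

------------------------------------------------------------------------
-- Computable reals and order functions

record UniformlyComputable (f : ℕ → ℝ) : Set where
  field
    num⁺ num⁻ den-1 : ℕ → ℕ → ℕ
    num⁺-recursive  : Recursive₂ num⁺
    num⁻-recursive  : Recursive₂ num⁻
    den-1-recursive : Recursive₂ den-1
    approximates    : ∀ n k →
      ∣ f n - fromℚ ((num⁺ n k ⊖ num⁻ n k) ℚ./ suc (den-1 n k)) ∣ ≤ fromℚ (½^ k)

Computable : ℝ → Set
Computable x = UniformlyComputable (λ _ → x)

record OrderFunction (f : ℕ → ℝ) : Set where
  field
    computable    : UniformlyComputable f
    nondecreasing : ∀ m n → m ℕ.≤ n → f m ≤ f n
    unbounded     : ∀ b → ∃[ n ] b < f n

SubIdentical : (ℕ → ℝ) → Set
SubIdentical g = (λ n → fromℕ n - g n) ⟶∞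

Convex : (ℕ → ℝ) → Set
Convex g = ∀ n → g (suc n) - g n ≤ 1ℝ

record FastGrowing (p : ℕ → ℝ) (p>1 : ∀ n → 1ℝ < p n) : Set where
  field
    orderFunction : OrderFunction p
    sum           : ℝ
    sum-converges : partialSum (λ n → recip (p n) (p>1 n)) ⟶ sum

------------------------------------------------------------------------
-- Prefix-free machines and complexity

-- A bijection between {0,1}* and ℕ (bijective base-2 numeration).
code : List Bool → ℕ
code []          = 0
code (false ∷ σ) = 1 ℕ.+ 2 ℕ.* code σ
code (true ∷ σ)  = 2 ℕ.+ 2 ℕ.* code σ

Machine : Set
Machine = PartialRecursive 1

_[_]=_ : Machine → List Bool → List Bool → Set
M [ τ ]= σ = M · (code τ ∷ []) ↦ code σ

PrefixFree : Machine → Set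
PrefixFree M = ∀ τ τ′ σ σ′ → M [ τ ]= σ → M [ τ′ ]= σ′ → Prefix _≡_ τ τ′ → τ ≡ τ′

record Universal (U : Machine) : Set where
  field
    prefixFree : PrefixFree U
    universal  : ∀ M → PrefixFree M →
      ∃[ ρ ] ∀ τ σ → (U [ ρ ++ τ ]= σ) ⇔ (M [ τ ]= σ)

-- `K U σ k`: the prefix-free complexity of σ relative to U is k.
record K (U : Machine) (σ : List Bool) (k : ℕ) : Set where
  field
    attained : ∃[ τ ] length τ ≡ k × U [ τ ]= σ
    minimal  : ∀ τ → U [ τ ]= σ → k ℕ.≤ length τ

_↾_ : (ℕ → Bool) → ℕ → List Bool
X ↾ n = applyUpTo X n

COMPLEX : Machine → (ℕ → ℝ) → Pred (ℕ → Bool) 0ℓ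
COMPLEX U f X = ∃[ c ] ∀ n → ∃[ k ] K U (X ↾ n) k × f n - fromℕ c ≤ fromℕ k

MLR : Machine → Pred (ℕ → Bool) 0ℓ
MLR U = COMPLEX U fromℕ

-- A subset of {0,1}^ℕ regarded as a subset of ℕ^ℕ.
asBaire : Pred (ℕ → Bool) 0ℓ → Pred (ℕ → ℕ) 0ℓ
asBaire P Y = ∃[ X ] X ∈ P × (∀ n → Y n ≡ (if X n then 1 else 0))

------------------------------------------------------------------------
-- Linearly universal avoidance

LinearlyUniversal : PartialRecursive 1 → Set
LinearlyUniversal ψ = ∀ (θ : PartialRecursive 1) →
  ∃[ a ] ∃[ b ] ∀ x y → (ψ · (a ℕ.* x ℕ.+ b ∷ []) ↦ y) ⇔ (θ · (x ∷ []) ↦ y)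

LUA : (ℕ → ℝ) → Pred (ℕ → ℕ) 0ℓ
LUA p X = (∀ n → fromℕ (X n) < p n)
        × ∃[ ψ ] LinearlyUniversal ψ × (∀ n → ¬ (ψ · (n ∷ []) ↦ X n))

{-# OPTIONS --safe #-}

-- Choose block lengths l(n) ≈ log₂ p(n) and let Y(n) be the number whose binary digits are the
-- n-th block of X, so that Y(n) < p(n).  If Y(n) = ψ(n), then the beginning of X up to the end of
-- that block is determined by the bits before the block together with n.  As the sum of 1/p(n) is
-- a recursive real, there is a recursive N with Σ_{n ≥ N(k)} 2^(-l(n)) ≤ 2^(-3k); hence (Kraft)
-- the numbers n ≥ N(k) have a recursive prefix code with words of length l(n) - 3k, and the
-- description saves about 2k bits.  So if g(m) = m - z(m), where z grows so slowly that z(m) = k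
-- forces m to lie beyond the blocks preceding N(k), then Y(n) = ψ(n) happens only finitely often
-- for X in COMPLEX(g), and the finitely many exceptions are removed from ψ without destroying
-- its linear universality.
--
-- To separate COMPLEX(g) from MLR, consider the tree of sequences that are 0 wherever z
-- increases.  Its strings of length m number 2^g(m), so by Kraft's inequality it has a path X
-- with K(X↾m) ≥ g(m) for all m; but deleting the forced zeros compresses the initial segments
-- of X by arbitrarily many bits.
module Submission where

-- The exponent 3k is a budget: naming k in unary costs k + 1 bits, the code of n saves 3k, and
-- membership in COMPLEX(g) tolerates a loss of z(m) = k at the end m of the block. The k bits left
-- over outgrow every constant. Since k is part of the description, one machine, hence one constant,
-- serves all k. The lengths l(n) are made nondecreasing, so that the sum of 2^(-l) over the numbers
-- from N(k) up to n is an integer in the current unit. The codeword of n consists of the binary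
-- digits of this sum times 2^(3k). Only approximations of p(n) are available, so l(n) is right up
-- to an additive constant; 2^(-l(n)) ≤ 8/p(n) is what transfers tail bounds. The tail of Σ 1/p(n)
-- is bounded by an approximation of the whole sum minus a lower approximation of a finite partial
-- sum, and this is where recursiveness of the sum enters. Machines are not written as decoders:
-- they search for parameters whose encoding is the input, so only encodings must be recursive.
-- Excluded middle supplies the path through the tree and shortest programs.

-- Closure properties of recursive functions relative to an oracle.

module RecursiveFunctions where

  open import Data.Empty using (⊥)
  open import Data.Fin using (Fin; zero; suc)
  open import Data.Nat
  open import Data.Nat.Properties
  open import Data.Product using (_×_; _,_; proj₁; proj₂; ∃-syntax)
  open import Data.Unit using (⊤; tt)
  open import Data.Vec using (Vec; []; _∷_; lookup)
  open import Relation.Binary.Definitions using (tri<; tri≈; tri>)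
  open import Relation.Binary.PropositionalEquality
  open import Relation.Nullary using (contradiction)
  open import Defs using (Code; zero; succ; proj; oracle; comp; prec; mu; ⟦_⟧; ⟦_⟧*)

  mutual
    deterministic : ∀ {O n} (e : Code O n) X xs {y y′} →
      ⟦ e ⟧ X xs y → ⟦ e ⟧ X xs y′ → y ≡ y′
    deterministic zero        X []       refl refl = refl
    deterministic succ        X (x ∷ []) refl refl = refl
    deterministic (proj i)    X xs       refl refl = refl
    deterministic (oracle o)  X (x ∷ []) refl refl = refl
    deterministic (comp f gs) X xs (zs , g , h) (zs′ , g′ , h′)
      with refl ← deterministic* gs X xs g g′ = deterministic f X zs h h′
    deterministic (prec f g)  X (zero ∷ xs)  h h′ = deterministic f X xs h h′
    deterministic (prec f g)  X (suc k ∷ xs) (r , p , h) (r′ , p′ , h′)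
      with refl ← deterministic (prec f g) X (k ∷ xs) p p′ = deterministic g X (k ∷ r ∷ xs) h h′
    deterministic (mu f)      X xs {y} {y′} (h , below) (h′ , below′) with <-cmp y y′
    ... | tri≈ _ y≡y′ _ = y≡y′
    -- At the smaller candidate the body would return both 0 and a successor.
    ... | tri< y<y′ _ _ = contradiction (deterministic f X _ h (proj₂ (below′ y y<y′))) λ ()
    ... | tri> _ _ y′<y = contradiction (deterministic f X _ h′ (proj₂ (below y′ y′<y))) λ ()

    deterministic* : ∀ {O m n} (es : Vec (Code O n) m) X xs {ys ys′} →
      ⟦ es ⟧* X xs ys → ⟦ es ⟧* X xs ys′ → ys ≡ ys′
    deterministic* []       X xs {[]}    {[]}    _ _ = refl
    deterministic* (e ∷ es) X xs {_ ∷ _} {_ ∷ _} (h , hs) (h′ , hs′) =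
      cong₂ _∷_ (deterministic e X xs h h′) (deterministic* es X xs hs hs′)

  mutual
    -- Recursive functions are given by oracle-free programs, whereas the functional of the
    -- reduction queries an oracle; this carries the former into the latter.
    lift : ∀ {O n} → Code ⊥ n → Code O n
    lift zero        = zero
    lift succ        = succ
    lift (proj i)    = proj i
    lift (comp f gs) = comp (lift f) (lift* gs)
    lift (prec f g)  = prec (lift f) (lift g)
    lift (mu f)      = mu (lift f)

    lift* : ∀ {O m n} → Vec (Code ⊥ n) m → Vec (Code O n) m
    lift* []       = []
    lift* (e ∷ es) = lift e ∷ lift* es

  mutual
    lift-runs : ∀ {O n} (e : Code ⊥ n) {X₀} (X : O → ℕ → ℕ) xs {y} →
      ⟦ e ⟧ X₀ xs y → ⟦ lift e ⟧ X xs y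
    lift-runs zero        X []       h = h
    lift-runs succ        X (x ∷ []) h = h
    lift-runs (proj i)    X xs       h = h
    lift-runs (comp f gs) X xs (zs , g , h) = zs , lift-runs* gs X xs g , lift-runs f X zs h
    lift-runs (prec f g)  X (zero ∷ xs)  h = lift-runs f X xs h
    lift-runs (prec f g)  X (suc k ∷ xs) (r , p , h) =
      r , lift-runs (prec f g) X (k ∷ xs) p , lift-runs g X (k ∷ r ∷ xs) h
    lift-runs (mu f)      X xs (h , below) =
      lift-runs f X _ h , λ i i<y → let r , b = below i i<y in r , lift-runs f X _ b

    lift-runs* : ∀ {O m n} (es : Vec (Code ⊥ n) m) {X₀} (X : O → ℕ → ℕ) xs {ys} →
      ⟦ es ⟧* X₀ xs ys → ⟦ lift* es ⟧* X xs ys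
    lift-runs* []       X xs {[]}    _        = tt
    lift-runs* (e ∷ es) X xs {_ ∷ _} (h , hs) = lift-runs e X xs h , lift-runs* es X xs hs

  -- Argument tuples with definitional η, so that open terms in the arguments can be
  -- matched against the combinators below.
  Env : ℕ → Set
  Env zero    = ⊤
  Env (suc n) = ℕ × Env n

  toVec : ∀ {n} → Env n → Vec ℕ n
  toVec {zero}  _       = []
  toVec {suc n} (x , ρ) = x ∷ toVec ρ

  look : ∀ {n} → Fin n → Env n → ℕ
  look zero    ρ = proj₁ ρ
  look (suc i) ρ = look i (proj₂ ρ)

  lookup-toVec : ∀ {n} (i : Fin n) ρ → look i ρ ≡ lookup (toVec ρ) i
  lookup-toVec zero    ρ = refl
  lookup-toVec (suc i) ρ = lookup-toVec i (proj₂ ρ)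

  -- The index `f` is what proofs reason about, while the program is assembled by combinators that
  -- follow the expression for `f`.
  record Rec {O : Set} (X : O → ℕ → ℕ) {n} (f : Env n → ℕ) : Set where
    constructor rec
    field
      program : Code O n
      runs    : ∀ ρ → ⟦ program ⟧ X (toVec ρ) (f ρ)

  record Rec* {O : Set} (X : O → ℕ → ℕ) {m n} (f : Env n → Env m) : Set where
    constructor rec*
    field
      programs : Vec (Code O n) m
      runs*    : ∀ ρ → ⟦ programs ⟧* X (toVec ρ) (toVec (f ρ))

  open Rec
  open Rec*

  primrec : ∀ {n} → (Env n → ℕ) → (Env (2 + n) → ℕ) → ℕ → Env n → ℕ
  primrec f g zero    ρ = f ρ
  primrec f g (suc k) ρ = g (k , primrec f g k ρ , ρ)

  ∑< : ℕ → (ℕ → ℕ) → ℕ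
  ∑< zero    f = 0
  ∑< (suc n) f = ∑< n f + f n

  module _ {O : Set} {X : O → ℕ → ℕ} where

    private
      R : ∀ {n} → (Env n → ℕ) → Set
      R = Rec X

    runs-cong : ∀ {n} (e : Code O n) xs {y y′} → y ≡ y′ → ⟦ e ⟧ X xs y → ⟦ e ⟧ X xs y′
    runs-cong e xs refl h = h

    rec-ext : ∀ {n} {f g : Env n → ℕ} → R f → (∀ ρ → f ρ ≡ g ρ) → R g
    rec-ext (rec e h) eq = rec e λ ρ → runs-cong e _ (eq ρ) (h ρ)

    rec-code : ∀ {n} {f : Env n → ℕ} {X₀} (e : Code ⊥ n) →
      (∀ ρ → ⟦ e ⟧ X₀ (toVec ρ) (f ρ)) → R f
    rec-code e h = rec (lift e) λ ρ → lift-runs e X _ (h ρ)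

    []ᵣ : ∀ {n} → Rec* X {n = n} (λ _ → tt)
    []ᵣ = rec* [] λ _ → tt

    infixr 5 _∷ᵣ_
    _∷ᵣ_ : ∀ {m n} {f : Env n → ℕ} {h : Env n → Env m} →
      R f → Rec* X h → Rec* X (λ ρ → f ρ , h ρ)
    rec e p ∷ᵣ rec* es ps = rec* (e ∷ es) λ ρ → p ρ , ps ρ

    rec-comp : ∀ {m n} {f : Env m → ℕ} {h : Env n → Env m} → R f → Rec* X h → R (λ ρ → f (h ρ))
    rec-comp {h = h} (rec e p) (rec* es ps) = rec (comp e es) λ ρ → toVec (h ρ) , ps ρ , p (h ρ)

    var : ∀ {n} (i : Fin n) → R (look i)
    var i = rec (proj i) (lookup-toVec i)

    select : ∀ {m n} → (Fin m → Fin n) → Env n → Env m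
    select {zero}  π ρ = tt
    select {suc m} π ρ = look (π zero) ρ , select (λ i → π (suc i)) ρ

    -- For a variable arity, selecting all components yields the tuple itself only up to a proof,
    -- which this supplies.
    select≡ : ∀ {m n} (π : Fin m → Fin n) ρ σ → (∀ i → look (π i) ρ ≡ look i σ) → select π ρ ≡ σ
    select≡ {zero}  π ρ σ eq = refl
    select≡ {suc m} π ρ σ eq =
      cong₂ _,_ (eq zero) (select≡ (λ i → π (suc i)) ρ (proj₂ σ) λ i → eq (suc i))

    selectᵣ : ∀ {m n} (π : Fin m → Fin n) → Rec* X (select π)
    selectᵣ {zero}  π = []ᵣ
    selectᵣ {suc m} π = var (π zero) ∷ᵣ selectᵣ (λ i → π (suc i))

    rec-prim : ∀ {n} {f : Env n → ℕ} {g : Env (2 + n) → ℕ} →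
      R f → R g → R {suc n} (λ ρ → primrec f g (proj₁ ρ) (proj₂ ρ))
    rec-prim {f = f} {g} (rec d p) (rec e q) = rec (prec d e) λ ρ → go (proj₁ ρ) (proj₂ ρ)
      where
      go : ∀ k ρ → ⟦ prec d e ⟧ X (k ∷ toVec ρ) (primrec f g k ρ)
      go zero    ρ = p ρ
      go (suc k) ρ = primrec f g k ρ , go k ρ , q (k , primrec f g k ρ , ρ)

    -- Turns a specification into a program. Halves and quotients are shown recursive this way, and
    -- so are square roots, logarithms and the modulus `N` through `rec-leastZero`.
    rec-least : ∀ {n} {f : Env (suc n) → ℕ} {g : Env n → ℕ} → R f →
      (∀ ρ → f (g ρ , ρ) ≡ 0) → (∀ ρ i → i < g ρ → f (i , ρ) ≢ 0) → R g
    rec-least {f = f} {g} (rec e p) isZero minimal = rec (mu e) λ ρ →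
      runs-cong e _ (isZero ρ) (p (g ρ , ρ)) , λ i i<g →
        pred (f (i , ρ)) ,
        runs-cong e _ (sym (suc-pred (f (i , ρ)) {{≢-nonZero (minimal ρ i i<g)}})) (p (i , ρ))

    ap₁ : ∀ {n} {f : Env 1 → ℕ} {g : Env n → ℕ} → R f → R g → R (λ ρ → f (g ρ , tt))
    ap₁ r s = rec-comp r (s ∷ᵣ []ᵣ)

    ap₂ : ∀ {n} {f : Env 2 → ℕ} {g h : Env n → ℕ} → R f → R g → R h →
      R (λ ρ → f (g ρ , h ρ , tt))
    ap₂ r s t = rec-comp r (s ∷ᵣ t ∷ᵣ []ᵣ)

    sucᵣ : ∀ {n} {f : Env n → ℕ} → R f → R (λ ρ → suc (f ρ))
    sucᵣ = ap₁ (rec succ λ _ → refl)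

    lit : ∀ {n} k → R {n} (λ _ → k)
    lit zero    = rec-comp (rec zero λ _ → refl) []ᵣ
    lit (suc k) = sucᵣ (lit k)

    private
      v0 : ∀ {n} → R {suc n} proj₁
      v0 = var zero

      v1 : ∀ {n} → R {suc (suc n)} (λ ρ → proj₁ (proj₂ ρ))
      v1 = var (suc zero)

    infixl 6 _+ᵣ_ _∸ᵣ_
    infixl 7 _*ᵣ_
    infixr 8 _^ᵣ_

    abstract
      _+ᵣ_ : ∀ {n} {f g : Env n → ℕ} → R f → R g → R (λ ρ → f ρ + g ρ)
      r +ᵣ s = ap₂ (rec-ext (rec-prim v0 (sucᵣ v1)) λ ρ → go (proj₁ ρ) (proj₂ ρ)) r s
        where
        go : ∀ k ρ → primrec {1} proj₁ (λ σ → suc (proj₁ (proj₂ σ))) k ρ ≡ k + proj₁ ρ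
        go zero    ρ = refl
        go (suc k) ρ = cong suc (go k ρ)

      _*ᵣ_ : ∀ {n} {f g : Env n → ℕ} → R f → R g → R (λ ρ → f ρ * g ρ)
      r *ᵣ s = ap₂ (rec-ext (rec-prim (lit 0) (var (suc (suc zero)) +ᵣ v1)) λ ρ → go (proj₁ ρ) (proj₂ ρ)) r s
        where
        go : ∀ k ρ → primrec {1} (λ _ → 0) (λ σ → look (suc (suc zero)) σ + proj₁ (proj₂ σ)) k ρ ≡ k * proj₁ ρ
        go zero    ρ = refl
        go (suc k) ρ = cong (proj₁ ρ +_) (go k ρ)

      predᵣ : ∀ {n} {f : Env n → ℕ} → R f → R (λ ρ → pred (f ρ))
      predᵣ = ap₁ (rec-ext (rec-prim (lit 0) v0) λ ρ → go (proj₁ ρ) (proj₂ ρ))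
        where
        go : ∀ k ρ → primrec {0} (λ _ → 0) proj₁ k ρ ≡ pred k
        go zero    ρ = refl
        go (suc k) ρ = refl

      _∸ᵣ_ : ∀ {n} {f g : Env n → ℕ} → R f → R g → R (λ ρ → f ρ ∸ g ρ)
      r ∸ᵣ s = ap₂ (rec-ext (rec-prim v0 (predᵣ v1)) λ ρ → go (proj₁ ρ) (proj₂ ρ)) s r
        where
        go : ∀ k ρ → primrec {1} proj₁ (λ σ → pred (proj₁ (proj₂ σ))) k ρ ≡ proj₁ ρ ∸ k
        go zero    ρ = refl
        go (suc k) ρ = trans (cong pred (go k ρ)) (pred[m∸n]≡m∸[1+n] (proj₁ ρ) k)

      _^ᵣ_ : ∀ {n} {f g : Env n → ℕ} → R f → R g → R (λ ρ → f ρ ^ g ρ)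
      r ^ᵣ s = ap₂ (rec-ext (rec-prim (lit 1) (var (suc (suc zero)) *ᵣ v1)) λ ρ → go (proj₁ ρ) (proj₂ ρ)) s r
        where
        go : ∀ k ρ → primrec {1} (λ _ → 1) (λ σ → look (suc (suc zero)) σ * proj₁ (proj₂ σ)) k ρ ≡ proj₁ ρ ^ k
        go zero    ρ = refl
        go (suc k) ρ = cong (proj₁ ρ *_) (go k ρ)

      ∑ᵣ : ∀ {n} {b : Env n → ℕ} {f : ℕ → Env n → ℕ} → R b →
        R {suc n} (λ ρ → f (proj₁ ρ) (proj₂ ρ)) → R (λ ρ → ∑< (b ρ) (λ i → f i ρ))
      ∑ᵣ {b = b} {f} r s = rec-ext
        (rec-comp
          (rec-prim (lit 0) (v1 +ᵣ rec-comp s (v0 ∷ᵣ selectᵣ λ i → suc (suc i))))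
          (r ∷ᵣ selectᵣ λ i → i))
        λ ρ → go (b ρ) (select≡ (λ i → i) ρ ρ λ _ → refl)
        where
        go : ∀ k {ρ σ} → σ ≡ ρ →
          primrec (λ _ → 0) (λ τ → proj₁ (proj₂ τ) + f (proj₁ τ) (select (λ i → suc (suc i)) τ)) k σ
          ≡ ∑< k (λ i → f i ρ)
        go zero    eq = refl
        go (suc k) {ρ} {σ} eq = cong₂ _+_ (go k eq)
          (cong (f k) (trans (select≡ (λ i → suc (suc i)) (k , _ , σ) σ λ _ → refl) eq))

open RecursiveFunctions

-- Unbounded search, tuples coded by numbers, and binary strings.

module Strings where

  open import Data.Bool using (Bool; true; false; not; if_then_else_)
  open import Data.Empty using (⊥)
  open import Data.Fin using (zero; suc)
  open import Data.List using (List; []; _∷_; _++_; length; [_])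
  open import Data.List.Properties using (applyUpTo-∷ʳ; length-applyUpTo)
  open import Data.List.Relation.Binary.Prefix.Heterogeneous using (Prefix; []; _∷_)
  open import Data.Nat
  open import Data.Nat.Properties
  open import Data.Nat.Tactic.RingSolver using (solve-∀)
  open import Data.Product using (_×_; _,_; proj₁; proj₂; ∃-syntax)
  open import Data.Unit using (tt)
  open import Data.Vec using ([]; _∷_)
  open import Relation.Binary.Definitions using (tri<; tri≈; tri>)
  open import Relation.Binary.PropositionalEquality hiding ([_])
  open import Relation.Nullary using (contradiction; yes; no)
  open import Function using (_∘_)
  open import Defs using (comp; mu; PartialRecursive; _·_↦_; code; _↾_)
  open Rec
  open Rec*

  leastZero : (f : ℕ → ℕ) → ∃[ n ] f n ≡ 0 → ∃[ q ] f q ≡ 0 × (∀ i → i < q → f i ≢ 0)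
  leastZero f (n , z) = go n f z
    where
    go : ∀ n (f : ℕ → ℕ) → f n ≡ 0 → ∃[ q ] f q ≡ 0 × (∀ i → i < q → f i ≢ 0)
    go n f z with f 0 ≟ 0
    go n       f z | yes f0 = 0 , f0 , λ _ ()
    go zero    f z | no ¬f0 = contradiction z ¬f0
    go (suc n) f z | no ¬f0 with go n (f ∘ suc) z
    ... | q , fq , below = suc q , fq , λ { zero _ → ¬f0 ; (suc i) (s≤s i<q) → below i i<q }

  leastZero-unique : (f : ℕ → ℕ) (e : ∃[ n ] f n ≡ 0) {q : ℕ} →
    f q ≡ 0 → (∀ i → i < q → f i ≢ 0) → proj₁ (leastZero f e) ≡ q
  leastZero-unique f e {q} fq below with leastZero f e
  ... | r , fr , below′ with <-cmp r q
  ... | tri< r<q _ _ = contradiction fr (below r r<q)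
  ... | tri≈ _ r≡q _ = r≡q
  ... | tri> _ _ q<r = contradiction fq (below′ q q<r)

  module _ {O : Set} {X : O → ℕ → ℕ} where

    rec-leastZero : ∀ {n} {f : Env (suc n) → ℕ} → Rec X f → (e : ∀ ρ → ∃[ q ] f (q , ρ) ≡ 0) →
      Rec X (λ ρ → proj₁ (leastZero (λ q → f (q , ρ)) (e ρ)))
    rec-leastZero r e = rec-least r
      (λ ρ → proj₁ (proj₂ (leastZero _ (e ρ)))) (λ ρ → proj₂ (proj₂ (leastZero _ (e ρ))))

  private
    root-exists : ∀ w → ∃[ q ] suc w ∸ suc q * suc q ≡ 0
    root-exists w = w , m≤n⇒m∸n≡0 (m≤m*n (suc w) (suc w))

  -- The integer square root. It recovers a + b from (a + b)² + a, because a ≤ 2(a + b) keeps this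
  -- number below the next square.
  root : ℕ → ℕ
  root w = proj₁ (leastZero (λ q → suc w ∸ suc q * suc q) (root-exists w))

  first second : ℕ → ℕ
  first  w = w ∸ root w * root w
  second w = root w ∸ first w

  pair : ℕ → ℕ → ℕ
  pair a b = (a + b) * (a + b) + a

  root-pair : ∀ a b → root (pair a b) ≡ a + b
  root-pair a b = leastZero-unique _ (root-exists (pair a b))
    (m≤n⇒m∸n≡0 (s≤s above))
    λ i i<q → m>n⇒m∸n≢0 (s≤s (≤-trans (*-mono-≤ i<q i<q) (m≤m+n _ a)))
    where
    above : pair a b ≤ a + b + (a + b) * suc (a + b)
    above = begin
      (a + b) * (a + b) + a           ≤⟨ +-mono-≤ (*-monoʳ-≤ (a + b) (n≤1+n (a + b))) (m≤m+n a b) ⟩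
      (a + b) * suc (a + b) + (a + b) ≡⟨ +-comm _ (a + b) ⟩
      a + b + (a + b) * suc (a + b)   ∎
      where open ≤-Reasoning

  first-pair : ∀ a b → first (pair a b) ≡ a
  first-pair a b = trans (cong (λ r → pair a b ∸ r * r) (root-pair a b))
    (m+n∸m≡n ((a + b) * (a + b)) a)

  second-pair : ∀ a b → second (pair a b) ≡ b
  second-pair a b = trans (cong₂ _∸_ (root-pair a b) (first-pair a b)) (m+n∸m≡n a b)

  tuple : ∀ n → ℕ → Env n
  tuple zero    w = tt
  tuple (suc n) w = first w , tuple n (second w)

  -- Surjectivity is all that a search over `w` needs; one tuple may have several codes.
  tuple-surjective : ∀ {n} (ρ : Env n) → ∃[ w ] tuple n w ≡ ρ
  tuple-surjective {zero}  ρ = 0 , refl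
  tuple-surjective {suc n} (a , ρ) with tuple-surjective ρ
  ... | b , eq = pair a b ,
    cong₂ _,_ (first-pair a b) (trans (cong (tuple n) (second-pair a b)) eq)

  module _ {O : Set} {X : O → ℕ → ℕ} where

    private
      rootᵣ : ∀ {n} {f : Env n → ℕ} → Rec X f → Rec X (λ ρ → root (f ρ))
      rootᵣ = ap₁ (rec-leastZero
        (sucᵣ (var (suc zero)) ∸ᵣ sucᵣ (var zero) *ᵣ sucᵣ (var zero)) λ ρ → root-exists (proj₁ ρ))

      firstᵣ : ∀ {n} {f : Env n → ℕ} → Rec X f → Rec X (λ ρ → first (f ρ))
      firstᵣ r = r ∸ᵣ rootᵣ r *ᵣ rootᵣ r

      secondᵣ : ∀ {n} {f : Env n → ℕ} → Rec X f → Rec X (λ ρ → second (f ρ))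
      secondᵣ r = rootᵣ r ∸ᵣ firstᵣ r

    tupleᵣ : ∀ {m n} {f : Env n → ℕ} → Rec X f → Rec* X (λ ρ → tuple m (f ρ))
    tupleᵣ {zero}  r = []ᵣ
    tupleᵣ {suc m} r = firstᵣ r ∷ᵣ tupleᵣ (secondᵣ r)

  none : ⊥ → ℕ → ℕ
  none = λ ()

  -- Decoding by search: only the relation P between inputs and parameters has to be recursive.
  abstract
    search-then : ∀ {n} {P : Env (suc n) → ℕ} → Rec none P → (F : PartialRecursive n) →
      (∀ x ρ σ y → P (x , ρ) ≡ 0 → P (x , σ) ≡ 0 → F · toVec ρ ↦ y → F · toVec σ ↦ y) →
      ∃[ M ] ((∀ x ρ y → P (x , ρ) ≡ 0 → F · toVec ρ ↦ y → M · (x ∷ []) ↦ y)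
            × (∀ x y → M · (x ∷ []) ↦ y → ∃[ ρ ] P (x , ρ) ≡ 0 × F · toVec ρ ↦ y))
    search-then {n} {P} p F functional = M , to , from
      where
      ts : Rec* none {n} {1} (λ ρ → tuple n (proj₁ ρ))
      ts = tupleᵣ (var zero)

      e : Rec none {2} (λ ρ → P (look (suc zero) ρ , tuple n (proj₁ ρ)))
      e = rec-comp p (var (suc zero) ∷ᵣ tupleᵣ (var zero))

      M : PartialRecursive 1
      M = comp (comp F (programs ts)) (mu (program e) ∷ [])

      to : ∀ x ρ y → P (x , ρ) ≡ 0 → F · toVec ρ ↦ y → M · (x ∷ []) ↦ y
      -- The search may stop at a tuple other than `ρ`; `functional` says that this does not change
      -- the output.
      to x ρ y Pρ Fρ =
        let w₀ , eq = tuple-surjective ρ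
            w , Pw , below = leastZero (λ w → P (x , tuple n w))
                               (w₀ , trans (cong (λ σ → P (x , σ)) eq) Pρ)
        in w ∷ []
           , ((runs-cong (program e) _ Pw (runs e (w , x , tt)) , λ i i<w →
                 _ , runs-cong (program e) _ (sym (suc-pred _ {{≢-nonZero (below i i<w)}}))
                       (runs e (i , x , tt))) , tt)
           , (toVec (tuple n w) , runs* ts (w , tt) , functional x ρ (tuple n w) y Pρ Pw Fρ)

      from : ∀ x y → M · (x ∷ []) ↦ y → ∃[ ρ ] P (x , ρ) ≡ 0 × F · toVec ρ ↦ y
      from x y (w ∷ [] , ((ew , _) , _) , (zs , tw , Fz)) =
        tuple n w , deterministic (program e) none _ (runs e (w , x , tt)) ew ,
        subst (λ v → F · v ↦ y) (deterministic* (programs ts) none _ tw (runs* ts (w , tt))) Fz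

  digit : Bool → ℕ
  digit b = if b then 1 else 0

  digit≤1 : ∀ b → digit b ≤ 1
  digit≤1 false = z≤n
  digit≤1 true  = s≤s z≤n

  code-∷ : ∀ b σ → code (b ∷ σ) ≡ suc (digit b + 2 * code σ)
  code-∷ false σ = refl
  code-∷ true  σ = refl

  digit-injective : ∀ b b′ m m′ → digit b + 2 * m ≡ digit b′ + 2 * m′ → b ≡ b′ × m ≡ m′
  digit-injective false false m m′ eq = refl , *-cancelˡ-≡ m m′ 2 eq
  digit-injective true  true  m m′ eq = refl , *-cancelˡ-≡ m m′ 2 (suc-injective eq)
  digit-injective false true  m m′ eq = contradiction eq (even≢odd m m′)
  digit-injective true  false m m′ eq = contradiction (sym eq) (even≢odd m′ m)

  code-injective : ∀ σ τ → code σ ≡ code τ → σ ≡ τ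
  code-injective []      []      eq = refl
  code-injective []      (c ∷ τ) eq = contradiction (trans eq (code-∷ c τ)) λ ()
  code-injective (b ∷ σ) []      eq = contradiction (trans (sym eq) (code-∷ b σ)) λ ()
  code-injective (b ∷ σ) (c ∷ τ) eq
    with digit-injective b c (code σ) (code τ)
           (suc-injective (trans (sym (code-∷ b σ)) (trans eq (code-∷ c τ))))
  ... | b≡c , eq′ = cong₂ _∷_ b≡c (code-injective σ τ eq′)

  code-surjective : ∀ n → ∃[ σ ] code σ ≡ n
  code-surjective zero = [] , refl
  code-surjective (suc n) with code-surjective n
  ... | σ , eq = next σ , trans (code-next σ) (cong suc eq)
    where
    next : List Bool → List Bool
    next []          = false ∷ []
    next (false ∷ σ) = true ∷ σ
    next (true ∷ σ)  = false ∷ next σ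

    code-next : ∀ σ → code (next σ) ≡ suc (code σ)
    code-next []          = refl
    code-next (false ∷ σ) = refl
    code-next (true ∷ σ)  = cong suc (trans (cong (2 *_) (code-next σ)) (*-suc 2 (code σ)))

  -- `code` reads a string in base 2 with digits 1 and 2, least significant first, so appending on
  -- the right means scaling by 2^|σ|.
  code-++ : ∀ σ τ → code (σ ++ τ) ≡ code σ + 2 ^ length σ * code τ
  code-++ []      τ = sym (+-identityʳ (code τ))
  code-++ (b ∷ σ) τ = begin
    code (b ∷ (σ ++ τ))                                  ≡⟨ code-∷ b (σ ++ τ) ⟩
    suc (digit b + 2 * code (σ ++ τ))                    ≡⟨ cong (λ x → suc (digit b + 2 * x)) (code-++ σ τ) ⟩
    suc (digit b + 2 * (code σ + 2 ^ length σ * code τ)) ≡⟨ regroup (digit b) (code σ) (2 ^ length σ) (code τ) ⟩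
    suc (digit b + 2 * code σ) + 2 ^ suc (length σ) * code τ ≡⟨ cong (_+ 2 ^ suc (length σ) * code τ) (sym (code-∷ b σ)) ⟩
    code (b ∷ σ) + 2 ^ suc (length σ) * code τ           ∎
    where
    open ≡-Reasoning
    regroup : ∀ d x p y → suc (d + 2 * (x + p * y)) ≡ suc (d + 2 * x) + 2 * p * y
    regroup = solve-∀

  code-↾ : ∀ X n → code (X ↾ n) ≡ ∑< n (λ i → 2 ^ i * suc (digit (X i)))
  code-↾ X zero    = refl
  code-↾ X (suc n) = begin
    code (X ↾ suc n)                                        ≡⟨ cong code (sym (applyUpTo-∷ʳ X n)) ⟩
    code (X ↾ n ++ [ X n ])                                 ≡⟨ code-++ (X ↾ n) [ X n ] ⟩
    code (X ↾ n) + 2 ^ length (X ↾ n) * code [ X n ]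
      ≡⟨ cong₂ (λ a b → code (X ↾ n) + 2 ^ a * b) (length-applyUpTo X n)
           (trans (code-∷ (X n) []) (cong suc (+-identityʳ (digit (X n))))) ⟩
    code (X ↾ n) + 2 ^ n * suc (digit (X n))                ≡⟨ cong (_+ 2 ^ n * suc (digit (X n))) (code-↾ X n) ⟩
    ∑< (suc n) (λ i → 2 ^ i * suc (digit (X i)))            ∎
    where open ≡-Reasoning

  ↾-cong : ∀ {X Y : ℕ → Bool} n → (∀ i → i < n → X i ≡ Y i) → X ↾ n ≡ Y ↾ n
  ↾-cong zero    eq = refl
  ↾-cong (suc n) eq = cong₂ _∷_ (eq 0 z<s) (↾-cong n λ i i<n → eq (suc i) (s≤s i<n))

  ↾-+ : ∀ (X : ℕ → Bool) m n → X ↾ (m + n) ≡ X ↾ m ++ (λ i → X (m + i)) ↾ n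
  ↾-+ X zero    n = refl
  ↾-+ X (suc m) n = cong (X 0 ∷_) (↾-+ (X ∘ suc) m n)

  unary : ℕ → List Bool
  unary zero    = true ∷ []
  unary (suc k) = false ∷ unary k

  length-unary : ∀ k → length (unary k) ≡ suc k
  length-unary zero    = refl
  length-unary (suc k) = cong suc (length-unary k)

  -- Prepending a 0 doubles `suc (code σ)`. The closed form makes these self-delimiting strings
  -- recursive in k.
  code-unary : ∀ k → suc (code (unary k)) ≡ 3 * 2 ^ k
  code-unary zero    = refl
  code-unary (suc k) = trans (double (code (unary k))) (trans (cong (2 *_) (code-unary k)) (swap (2 ^ k)))
    where
    double : ∀ c → suc (1 + 2 * c) ≡ 2 * suc c
    double = solve-∀
    swap : ∀ x → 2 * (3 * x) ≡ 3 * (2 * x)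
    swap = solve-∀

  -- Compatible strings: one of them is a prefix of the other.
  infix 4 _∼_
  data _∼_ : List Bool → List Bool → Set where
    []ˡ : ∀ {τ} → [] ∼ τ
    []ʳ : ∀ {σ} → σ ∼ []
    _∷_ : ∀ {σ τ} b → σ ∼ τ → b ∷ σ ∼ b ∷ τ

  ∼-sym : ∀ {σ τ} → σ ∼ τ → τ ∼ σ
  ∼-sym []ˡ     = []ʳ
  ∼-sym []ʳ     = []ˡ
  ∼-sym (b ∷ h) = b ∷ ∼-sym h

  Prefix⇒∼ : ∀ {σ τ} → Prefix _≡_ σ τ → σ ∼ τ
  Prefix⇒∼ []         = []ˡ
  Prefix⇒∼ (refl ∷ h) = _ ∷ Prefix⇒∼ h

  ∼-++⁻ : ∀ σ σ′ {τ τ′} → σ ++ τ ∼ σ′ ++ τ′ → σ ∼ σ′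
  ∼-++⁻ []      σ′       h       = []ˡ
  ∼-++⁻ (b ∷ σ) []       h       = []ʳ
  ∼-++⁻ (b ∷ σ) (_ ∷ σ′) (_ ∷ h) = b ∷ ∼-++⁻ σ σ′ h

  ∼-++-cancel : ∀ σ {τ τ′} → σ ++ τ ∼ σ ++ τ′ → τ ∼ τ′
  ∼-++-cancel []      h       = h
  ∼-++-cancel (b ∷ σ) (_ ∷ h) = ∼-++-cancel σ h

  ∼-length : ∀ {σ τ} → σ ∼ τ → length σ ≡ length τ → σ ≡ τ
  ∼-length {τ = []}    []ˡ _  = refl
  ∼-length {σ = []}    []ʳ _  = refl
  ∼-length (b ∷ h) eq = cong (b ∷_) (∼-length h (suc-injective eq))

  ∼-unary : ∀ k k′ {σ σ′} → unary k ++ σ ∼ unary k′ ++ σ′ → k ≡ k′ × σ ∼ σ′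
  ∼-unary zero    zero     (_ ∷ h) = refl , h
  ∼-unary (suc k) (suc k′) (_ ∷ h) with ∼-unary k k′ h
  ... | refl , h′ = refl , h′

  ∼-↾ : ∀ (X Y : ℕ → Bool) m n → m ≤ n → X ↾ m ∼ Y ↾ n → ∀ i → i < m → X i ≡ Y i
  ∼-↾ X Y (suc m) (suc n) m≤n h zero i<m with X 0 | Y 0 | h
  ... | b | .b | _ ∷ _ = refl
  ∼-↾ X Y (suc m) (suc n) (s≤s m≤n) h (suc i) (s≤s i<m) =
    ∼-↾ (X ∘ suc) (Y ∘ suc) m n m≤n (∼-++-cancel′ h) i i<m
    where
    ∼-++-cancel′ : ∀ {b c σ τ} → b ∷ σ ∼ c ∷ τ → σ ∼ τ
    ∼-++-cancel′ (_ ∷ h) = h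

  odd : ℕ → Bool
  odd zero    = false
  odd (suc n) = not (odd n)

  shift : ℕ → ℕ → ℕ
  shift zero    v = v
  shift (suc i) v = ⌊ shift i v /2⌋

  -- Initial segments of sequences are handed to machines as numbers: the binary digits of `v`,
  -- least significant first, continue with zeros to an infinite sequence.
  bits : ℕ → ℕ → Bool
  bits v i = odd (shift i v)

  digit-half : ∀ v → digit (odd v) + 2 * ⌊ v /2⌋ ≡ v
  digit-half zero          = refl
  digit-half (suc zero)    = refl
  digit-half (suc (suc v)) = trans (cong₂ (λ b h → digit b + 2 * h) (not² (odd v)) (refl {x = suc ⌊ v /2⌋}))
    (trans (regroup (digit (odd v)) ⌊ v /2⌋) (cong (2 +_) (digit-half v)))
    where
    not² : ∀ b → not (not b) ≡ b
    not² false = refl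
    not² true  = refl
    regroup : ∀ d h → d + 2 * suc h ≡ 2 + (d + 2 * h)
    regroup = solve-∀

  odd-digit : ∀ b m → odd (digit b + 2 * m) ≡ b
  odd-digit b m = proj₁ (digit-injective (odd v) b ⌊ v /2⌋ m (digit-half v))
    where v = digit b + 2 * m

  half-digit : ∀ b m → ⌊ digit b + 2 * m /2⌋ ≡ m
  half-digit b m = proj₂ (digit-injective (odd v) b ⌊ v /2⌋ m (digit-half v))
    where v = digit b + 2 * m

  half-shift : ∀ i v → shift i ⌊ v /2⌋ ≡ shift (suc i) v
  half-shift zero    v = refl
  half-shift (suc i) v = cong ⌊_/2⌋ (half-shift i v)

  bits-surjective : ∀ (X : ℕ → Bool) n → ∃[ v ] (∀ i → i < n → bits v i ≡ X i)
  bits-surjective X zero    = 0 , λ _ ()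
  bits-surjective X (suc n) with bits-surjective (X ∘ suc) n
  ... | v , eq = digit (X 0) + 2 * v , λ
    { zero    _         → odd-digit (X 0) v
    ; (suc i) (s≤s i<n) → trans (cong odd (sym (half-shift i (digit (X 0) + 2 * v))))
                            (trans (cong (λ w → odd (shift i w)) (half-digit (X 0) v)) (eq i i<n)) }

  half≤ : ∀ v → 2 * ⌊ v /2⌋ ≤ v
  half≤ v = ≤-trans (m≤n+m _ (digit (odd v))) (≤-reflexive (digit-half v))

  bits-injective : ∀ j {c d} → c < 2 ^ j → d < 2 ^ j → (∀ i → i < j → bits c i ≡ bits d i) → c ≡ d
  bits-injective zero    {zero}  {zero}  c<    d<    eq = refl
  bits-injective zero    {suc c}         (s≤s ()) d< eq
  bits-injective zero    {zero}  {suc d} c< (s≤s ()) eq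
  bits-injective (suc j) {c} {d} c< d< eq = begin
    c                           ≡⟨ sym (digit-half c) ⟩
    digit (odd c) + 2 * ⌊ c /2⌋ ≡⟨ cong₂ (λ b h → digit b + 2 * h) (eq 0 z<s) halves ⟩
    digit (odd d) + 2 * ⌊ d /2⌋ ≡⟨ digit-half d ⟩
    d                           ∎
    where
    open ≡-Reasoning
    half< : ∀ {c} → c < 2 ^ suc j → ⌊ c /2⌋ < 2 ^ j
    half< {c} c< = *-cancelˡ-< 2 _ _ (≤-<-trans (half≤ c) c<)

    halves : ⌊ c /2⌋ ≡ ⌊ d /2⌋
    halves = bits-injective j (half< c<) (half< d<) λ i i<j →
      trans (cong odd (half-shift i c)) (trans (eq (suc i) (s≤s i<j)) (cong odd (sym (half-shift i d))))

  <half : ∀ v → v < 2 * suc ⌊ v /2⌋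
  <half v = begin
    suc v                             ≡⟨ cong suc (sym (digit-half v)) ⟩
    suc (digit (odd v) + 2 * ⌊ v /2⌋) ≤⟨ s≤s (+-monoˡ-≤ (2 * ⌊ v /2⌋) (digit≤1 (odd v))) ⟩
    2 + 2 * ⌊ v /2⌋                   ≡⟨ sym (*-suc 2 ⌊ v /2⌋) ⟩
    2 * suc ⌊ v /2⌋                   ∎
    where
    open ≤-Reasoning

  -- `shift d` is division by 2^d with rounding down. This bound and `shift<` are obtained by
  -- peeling off one binary digit at a time.
  ≤shift : ∀ d {a x} → a * 2 ^ d ≤ x → a ≤ shift d x
  ≤shift zero    {a} {x} h = subst (_≤ x) (*-identityʳ a) h
  ≤shift (suc d) {a} {x} h = ≤-pred (*-cancelˡ-< 2 a _ (≤-<-trans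
    (≤shift d (subst (_≤ x) (regroup a (2 ^ d)) h)) (<half (shift d x))))
    where
    regroup : ∀ a y → a * (2 * y) ≡ 2 * a * y
    regroup = solve-∀

  shift< : ∀ d {b x} → x < b * 2 ^ d → shift d x < b
  shift< zero    {b} {x} h = subst (x <_) (*-identityʳ b) h
  shift< (suc d) {b} {x} h = *-cancelˡ-< 2 _ b (≤-<-trans (half≤ (shift d x))
    (shift< d (subst (x <_) (regroup b (2 ^ d)) h)))
    where
    regroup : ∀ a y → a * (2 * y) ≡ 2 * a * y
    regroup = solve-∀

  bits-shift : ∀ v d i → bits (shift d v) i ≡ bits v (i + d)
  bits-shift v d i = cong odd (shift-shift i)
    where
    shift-shift : ∀ i → shift i (shift d v) ≡ shift (i + d) v
    shift-shift zero    = refl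
    shift-shift (suc i) = cong ⌊_/2⌋ (shift-shift i)

open Strings

-- Prefix-free machines from antichains of codewords.

module Machines where

  open import Data.Bool using (Bool)
  open import Data.Fin using (zero; suc)
  open import Data.Fin.Patterns using (0F; 1F; 2F)
  open import Data.List using (List; []; _∷_; _++_; length)
  open import Data.List.Properties using (++-identityʳ)
  open import Data.List.Relation.Binary.Prefix.Heterogeneous using ([]; _∷_)
  open import Data.Nat
  open import Data.Nat.Properties
  open import Data.Nat.DivMod using (m≡m%n+[m/n]*n; m%n<n; m/n*n≤m)
  open import Data.Product using (_×_; _,_; proj₁; proj₂; ∃-syntax)
  open import Data.Vec using ([]; _∷_)
  open import Relation.Binary.PropositionalEquality hiding ([_])
  open import Defs using (PartialRecursive; _·_↦_; code; _[_]=_; PrefixFree; _↾_)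
  open Rec
  open Rec*

  ∼-refl : ∀ σ → σ ∼ σ
  ∼-refl []      = []ˡ
  ∼-refl (b ∷ σ) = b ∷ ∼-refl σ

  ∼-unary⇒≡ : ∀ x y → unary x ∼ unary y → x ≡ y
  ∼-unary⇒≡ x y h = proj₁ (∼-unary x y {[]} {[]}
    (subst₂ _∼_ (sym (++-identityʳ (unary x))) (sym (++-identityʳ (unary y))) h))

  unary-injective : ∀ x y → unary x ≡ unary y → x ≡ y
  unary-injective x y eq = ∼-unary⇒≡ x y (subst (unary x ∼_) eq (∼-refl (unary x)))

  -- Equality as a zero of a recursive function, the form in which conditions enter a search.
  ∣-∣≡0 : ∀ m n → m ∸ n + (n ∸ m) ≡ 0 → m ≡ n
  ∣-∣≡0 m n eq = ≤-antisym (m∸n≡0⇒m≤n (m+n≡0⇒m≡0 (m ∸ n) eq)) (m∸n≡0⇒m≤n (m+n≡0⇒n≡0 (m ∸ n) eq))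

  n∸n+n∸n≡0 : ∀ n → n ∸ n + (n ∸ n) ≡ 0
  n∸n+n∸n≡0 n = cong₂ _+_ (n∸n≡0 n) (n∸n≡0 n)

  -- The machine searches for parameters `ρ` whose codeword is the input and runs `F` on them. Its
  -- domain consists of codewords, so prefix-freeness comes down to compatible codewords being
  -- equal. Distinct parameters may share a codeword, since only some bits of a parameter enter it;
  -- the last hypothesis makes `F` blind to the difference.
  codeword-machine : ∀ {n} (str : Env n → List Bool) → Rec none (λ ρ → code (str ρ)) →
    (F : PartialRecursive n) →
    (∀ ρ σ → str ρ ∼ str σ → str ρ ≡ str σ) →
    (∀ ρ σ y → str ρ ≡ str σ → F · toVec ρ ↦ y → F · toVec σ ↦ y) →
    ∃[ M ] PrefixFree M
      × (∀ ρ σ → F · toVec ρ ↦ code σ → M [ str ρ ]= σ)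
      × (∀ τ σ → M [ τ ]= σ → ∃[ ρ ] τ ≡ str ρ × F · toVec ρ ↦ code σ)
  codeword-machine {n} str strᵣ F antichain functional = package
    (search-then {P = λ ρ → proj₁ ρ ∸ E (proj₂ ρ) + (E (proj₂ ρ) ∸ proj₁ ρ)}
      ((var 0F ∸ᵣ E∘tail) +ᵣ (E∘tail ∸ᵣ var 0F)) F
      λ x ρ σ y p q → functional ρ σ y
        (code-injective (str ρ) (str σ) (trans (sym (same x ρ p)) (same x σ q))))
    where
    E : Env n → ℕ
    E ρ = code (str ρ)

    E∘tail : Rec none {suc n} (λ ρ → E (proj₂ ρ))
    E∘tail = rec-ext (rec-comp strᵣ (selectᵣ suc)) λ ρ →
      cong E (select≡ {X = none} suc ρ (proj₂ ρ) λ _ → refl)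

    same : ∀ x ρ → x ∸ E ρ + (E ρ ∸ x) ≡ 0 → x ≡ E ρ
    same x ρ = ∣-∣≡0 x (E ρ)

    package : ∃[ M ] ((∀ x ρ y → x ∸ E ρ + (E ρ ∸ x) ≡ 0 → F · toVec ρ ↦ y → M · (x ∷ []) ↦ y)
            × (∀ x y → M · (x ∷ []) ↦ y → ∃[ ρ ] x ∸ E ρ + (E ρ ∸ x) ≡ 0 × F · toVec ρ ↦ y)) →
      ∃[ M ] PrefixFree M
        × (∀ ρ σ → F · toVec ρ ↦ code σ → M [ str ρ ]= σ)
        × (∀ τ σ → M [ τ ]= σ → ∃[ ρ ] τ ≡ str ρ × F · toVec ρ ↦ code σ)
    package (M , run , halt) = M , prefixFree , (λ ρ σ → run (E ρ) ρ (code σ) (n∸n+n∸n≡0 (E ρ))) , from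
      where
      from : ∀ τ σ → M [ τ ]= σ → ∃[ ρ ] τ ≡ str ρ × F · toVec ρ ↦ code σ
      from τ σ h with halt (code τ) (code σ) h
      ... | ρ , p , Fρ = ρ , code-injective τ (str ρ) (same (code τ) ρ p) , Fρ

      prefixFree : PrefixFree M
      prefixFree τ τ′ σ σ′ h h′ τ⊑τ′ with from τ σ h | from τ′ σ′ h′
      ... | ρ , refl , _ | ρ′ , refl , _ = antichain ρ ρ′ (Prefix⇒∼ τ⊑τ′)

  m<suc[m/n]*n : ∀ m n .{{_ : NonZero n}} → m < suc (m / n) * n
  m<suc[m/n]*n m n = begin-strict
    m                 ≡⟨ m≡m%n+[m/n]*n m n ⟩
    m % n + m / n * n <⟨ +-monoˡ-< (m / n * n) (m%n<n m n) ⟩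
    n + m / n * n     ∎
    where open ≤-Reasoning

  module _ {O : Set} {X : O → ℕ → ℕ} where

    private
      R : ∀ {n} → (Env n → ℕ) → Set
      R = Rec X

    abstract
      halfᵣ : ∀ {n} {f : Env n → ℕ} → R f → R (λ ρ → ⌊ f ρ /2⌋)
      halfᵣ = ap₁ {f = λ ρ → ⌊ proj₁ ρ /2⌋} (rec-least {f = λ ρ → proj₁ (proj₂ ρ) ∸ suc (2 * proj₁ ρ)}
        (var 1F ∸ᵣ sucᵣ (lit 2 *ᵣ var 0F))
        (λ ρ → m≤n⇒m∸n≡0 (≤-pred (≤-trans (<half (proj₁ ρ)) (≤-reflexive (*-suc 2 ⌊ proj₁ ρ /2⌋)))))
        λ ρ i i< → m>n⇒m∸n≢0 (≤-trans (≤-reflexive (sym (*-suc 2 i))) (≤-trans (*-monoʳ-≤ 2 i<) (half≤ (proj₁ ρ)))))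

      shiftᵣ : ∀ {n} {f g : Env n → ℕ} → R f → R g → R (λ ρ → shift (f ρ) (g ρ))
      shiftᵣ = ap₂ (rec-ext (rec-prim (var 0F) (halfᵣ (var 1F))) λ ρ → go (proj₁ ρ) (proj₂ ρ))
        where
        go : ∀ k ρ → primrec {1} proj₁ (λ σ → ⌊ proj₁ (proj₂ σ) /2⌋) k ρ ≡ shift k (proj₁ ρ)
        go zero    ρ = refl
        go (suc k) ρ = cong ⌊_/2⌋ (go k ρ)

      bitsᵣ : ∀ {n} {f g : Env n → ℕ} → R f → R g → R (λ ρ → digit (bits (f ρ) (g ρ)))
      bitsᵣ {f = f} {g} r s = rec-ext (shiftᵣ s r ∸ᵣ lit 2 *ᵣ halfᵣ (shiftᵣ s r)) λ ρ →
        let v = shift (g ρ) (f ρ) in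
        trans (cong (_∸ 2 * ⌊ v /2⌋) (sym (digit-half v))) (m+n∸n≡m (digit (odd v)) (2 * ⌊ v /2⌋))

      code-↾ᵣ : ∀ {n} {b : Env n → ℕ} {Y : Env n → ℕ → Bool} → R b →
        R {suc n} (λ ρ → digit (Y (proj₂ ρ) (proj₁ ρ))) → R (λ ρ → code (Y ρ ↾ b ρ))
      code-↾ᵣ {b = b} {Y} r s = rec-ext
        (∑ᵣ {f = λ i ρ → 2 ^ i * suc (digit (Y ρ i))} r (lit 2 ^ᵣ var 0F *ᵣ sucᵣ s))
        λ ρ → sym (code-↾ (Y ρ) (b ρ))

      code-unaryᵣ : ∀ {n} {f : Env n → ℕ} → R f → R (λ ρ → code (unary (f ρ)))
      code-unaryᵣ {f = f} r = rec-ext (predᵣ (lit 3 *ᵣ lit 2 ^ᵣ r)) λ ρ →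
        cong pred (sym (code-unary (f ρ)))

      code-++ᵣ : ∀ {n} {σ τ : Env n → List Bool} → R (λ ρ → code (σ ρ)) → R (λ ρ → length (σ ρ)) →
        R (λ ρ → code (τ ρ)) → R (λ ρ → code (σ ρ ++ τ ρ))
      code-++ᵣ {σ = σ} {τ} r l s = rec-ext (r +ᵣ lit 2 ^ᵣ l *ᵣ s) λ ρ → sym (code-++ (σ ρ) (τ ρ))

      infixl 7 _/ᵣ_
      _/ᵣ_ : ∀ {n} {f g : Env n → ℕ} → R f → R g → R (λ ρ → f ρ / suc (g ρ))
      _/ᵣ_ = ap₂ {f = λ ρ → look 0F ρ / suc (look 1F ρ)} (rec-least {f = λ ρ → suc (look 1F ρ) ∸ suc (look 0F ρ) * suc (look 2F ρ)}
        (sucᵣ (var 1F) ∸ᵣ sucᵣ (var 0F) *ᵣ sucᵣ (var 2F))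
        (λ ρ → m≤n⇒m∸n≡0 (m<suc[m/n]*n (look 0F ρ) (suc (look 1F ρ))))
        λ ρ i i< → m>n⇒m∸n≢0 (s≤s (≤-trans (*-monoˡ-≤ (suc (look 1F ρ)) i<)
          (m/n*n≤m (look 0F ρ) (suc (look 1F ρ))))))

open Machines

-- Linearly universal functions and their restrictions to final segments.

module LinearUniversality where

  open import Data.Bool using (Bool)
  open import Data.Fin using (zero; suc)
  open import Data.Fin.Patterns using (0F; 1F; 2F; 3F)
  open import Data.List using (List; []; _∷_; _++_; length)
  open import Data.List.Relation.Binary.Prefix.Heterogeneous using ([]; _∷_)
  open import Data.Nat
  open import Data.Nat.Properties
  open import Data.Nat.Tactic.RingSolver using (solve-∀)
  open import Data.Product using (_×_; _,_; proj₁; proj₂; ∃-syntax)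
  open import Data.Unit using (tt)
  open import Data.Vec using ([]; _∷_)
  open import Relation.Binary.PropositionalEquality hiding ([_])
  open import Relation.Nullary using (contradiction)
  open import Function using (_⇔_; mk⇔; Equivalence)
  open import Defs using (comp; PartialRecursive; _·_↦_; code; Machine; _[_]=_; Universal; LinearlyUniversal)
  open Rec
  open Rec*

  abstract
    _∘ᵣ_ : ∀ {n} {f : Env n → ℕ} → PartialRecursive 1 → Rec none f → PartialRecursive n
    F ∘ᵣ r = comp F (program r ∷ [])

    ∘ᵣ-⇔ : ∀ {n} (F : PartialRecursive 1) {f : Env n → ℕ} (r : Rec none f) ρ y →
      ((F ∘ᵣ r) · toVec ρ ↦ y) ⇔ (F · (f ρ ∷ []) ↦ y)
    ∘ᵣ-⇔ F {f} r ρ y = mk⇔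
      (λ { (z ∷ [] , (h , _) , Fz) →
             subst (λ z → F · (z ∷ []) ↦ y) (deterministic (program r) none _ h (runs r ρ)) Fz })
      λ Ff → f ρ ∷ [] , (runs r ρ , tt) , Ff

  -- The machine 0ˣ1 ↦ θ(x ∸ N), as simulated by U.
  simulate : ∀ U → Universal U → (θ : PartialRecursive 1) (N : ℕ) →
    ∃[ ρ ] ∀ x y → (U · (code (ρ ++ unary (x + N)) ∷ []) ↦ y) ⇔ (θ · (x ∷ []) ↦ y)
  simulate U universal θ N = ρ , λ x y → mk⇔ (from x y) (to x y)
    where
    ∸Nᵣ : Rec none {1} (λ ρ → look 0F ρ ∸ N)
    ∸Nᵣ = var 0F ∸ᵣ lit N

    machine : _
    machine = codeword-machine {1} (λ ρ → unary (look 0F ρ)) (code-unaryᵣ (var 0F))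
      (θ ∘ᵣ ∸Nᵣ)
      (λ { (x , tt) (y , tt) h → cong unary (∼-unary⇒≡ x y h) })
      (λ { (x , tt) (y , tt) z eq h →
        subst (λ y → (θ ∘ᵣ ∸Nᵣ) · (y ∷ []) ↦ z)
          (unary-injective x y eq) h })

    M : Machine
    M = proj₁ machine

    simulation : ∃[ ρ ] ∀ τ σ → (U [ ρ ++ τ ]= σ) ⇔ (M [ τ ]= σ)
    simulation = Universal.universal universal M (proj₁ (proj₂ machine))

    ρ : List Bool
    ρ = proj₁ simulation

    from : ∀ x y → U · (code (ρ ++ unary (x + N)) ∷ []) ↦ y → θ · (x ∷ []) ↦ y
    from x y h =
      let σ , eq = code-surjective y
          h₁ = subst (λ y → U · (code (ρ ++ unary (x + N)) ∷ []) ↦ y) (sym eq) h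
          (x′ , tt) , eq′ , h₂ = proj₂ (proj₂ (proj₂ machine)) (unary (x + N)) σ
                                   (Equivalence.to (proj₂ simulation (unary (x + N)) σ) h₁)
          x≡x′∸N = trans (cong (_∸ N) (sym (unary-injective (x + N) x′ eq′))) (m+n∸n≡m x N)
      in subst₂ (λ x y → θ · (x ∷ []) ↦ y) x≡x′∸N eq (Equivalence.to (∘ᵣ-⇔ θ ∸Nᵣ (x′ , tt) (code σ)) h₂)

    to : ∀ x y → θ · (x ∷ []) ↦ y → U · (code (ρ ++ unary (x + N)) ∷ []) ↦ y
    to x y h =
      let σ , eq = code-surjective y
          h₁ = subst₂ (λ x y → θ · (x ∷ []) ↦ y) (sym (m+n∸n≡m x N)) (sym eq) h
      in subst (λ y → U · (code (ρ ++ unary (x + N)) ∷ []) ↦ y) eq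
           (Equivalence.from (proj₂ simulation (unary (x + N)) σ)
             (proj₁ (proj₂ (proj₂ machine)) (x + N , tt) σ
               (Equivalence.from (∘ᵣ-⇔ θ ∸Nᵣ (x + N , tt) (code σ)) h₁)))

  -- An injective pairing that is affine in its second argument. Nesting it keeps the position of x
  -- inside an input of ψ affine, as linear universality demands.
  oddMultiple : ℕ → ℕ → ℕ
  oddMultiple a b = 2 ^ a * suc (2 * b)

  oddMultiple-injective : ∀ a b a′ b′ → oddMultiple a b ≡ oddMultiple a′ b′ → a ≡ a′ × b ≡ b′
  oddMultiple-injective zero b zero b′ eq =
    refl , *-cancelˡ-≡ b b′ 2 (suc-injective (trans (sym (+-identityʳ _)) (trans eq (+-identityʳ _))))
  oddMultiple-injective zero b (suc a′) b′ eq =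
    contradiction (trans (sym (*-assoc 2 (2 ^ a′) (suc (2 * b′)))) (trans (sym eq) (+-identityʳ _))) (even≢odd (oddMultiple a′ b′) b)
  oddMultiple-injective (suc a) b zero b′ eq =
    contradiction (trans (sym (*-assoc 2 (2 ^ a) (suc (2 * b)))) (trans eq (+-identityʳ _))) (even≢odd (oddMultiple a b) b′)
  oddMultiple-injective (suc a) b (suc a′) b′ eq
    with oddMultiple-injective a b a′ b′ (*-cancelˡ-≡ (oddMultiple a b) (oddMultiple a′ b′) 2
           (trans (sym (*-assoc 2 (2 ^ a) (suc (2 * b)))) (trans eq (*-assoc 2 (2 ^ a′) (suc (2 * b′))))))
  ... | refl , b≡b′ = refl , b≡b′

  ≤-oddMultiple : ∀ a b → b ≤ oddMultiple a b
  ≤-oddMultiple a b = begin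
    b                   ≤⟨ ≤-trans (m≤n*m b 2) (n≤1+n (2 * b)) ⟩
    suc (2 * b)         ≤⟨ m≤n*m (suc (2 * b)) (2 ^ a) {{m^n≢0 2 a}} ⟩
    2 ^ a * suc (2 * b) ∎
    where open ≤-Reasoning

  -- The linearly universal function sends 2ʳ(2·2ᵠ(2x+1)+1), for r the code of a prefix ρ
  -- and q = 2^|ρ|, to U(ρ0ˣ1); its restrictions to [N,∞) are again linearly universal.
  universal-restrictions : ∀ U → Universal U → ∃[ ψ ]
    (∀ N → LinearlyUniversal (ψ N))
    × (∀ N m y → ψ N · (m ∷ []) ↦ y → N ≤ m × ψ 0 · (m ∷ []) ↦ y)
  universal-restrictions U universal = ψ , linear , restricts
    where
    E : ℕ → ℕ → ℕ → ℕ
    E r q x = oddMultiple r (oddMultiple q x)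

    P : ℕ → Env 4 → ℕ
    -- A zero means that the input m equals `E r q x`, and also that N ≤ m; the latter is the
    -- restriction to [N,∞).
    P N ρ = look 0F ρ ∸ E (look 1F ρ) (look 2F ρ) (look 3F ρ)
          + (E (look 1F ρ) (look 2F ρ) (look 3F ρ) ∸ look 0F ρ) + (N ∸ look 0F ρ)

    oddᵣ : ∀ {n} {f g : Env n → ℕ} → Rec none f → Rec none g → Rec none (λ ρ → oddMultiple (f ρ) (g ρ))
    oddᵣ r s = lit 2 ^ᵣ r *ᵣ sucᵣ (lit 2 *ᵣ s)

    Pᵣ : ∀ N → Rec none (P N)
    Pᵣ N = (var 0F ∸ᵣ Eᵣ) +ᵣ (Eᵣ ∸ᵣ var 0F) +ᵣ (lit N ∸ᵣ var 0F)
      where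
      Eᵣ : Rec none {4} (λ ρ → E (look 1F ρ) (look 2F ρ) (look 3F ρ))
      Eᵣ = oddᵣ (var 1F) (oddᵣ (var 2F) (var 3F))

    -- By `code-++` this is the code of ρ0ˣ1 if r = code ρ and q = 2^|ρ|. Linear universality asks
    -- nothing about the values at other r and q.
    inputᵣ : Rec none {3} (λ ρ → look 0F ρ + look 1F ρ * code (unary (look 2F ρ)))
    inputᵣ = var 0F +ᵣ var 1F *ᵣ code-unaryᵣ (var 2F)

    F : PartialRecursive 3
    F = U ∘ᵣ inputᵣ

    P⇒≡ : ∀ N m r q x → P N (m , r , q , x , tt) ≡ 0 → m ≡ E r q x
    P⇒≡ N m r q x eq = ∣-∣≡0 m (E r q x) (m+n≡0⇒m≡0 _ eq)

    P⇒≤ : ∀ N m r q x → P N (m , r , q , x , tt) ≡ 0 → N ≤ m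
    P⇒≤ N m r q x eq = m∸n≡0⇒m≤n (m+n≡0⇒n≡0 (m ∸ E r q x + (E r q x ∸ m)) eq)

    ⇒P : ∀ N r q x → N ≤ E r q x → P N (E r q x , r , q , x , tt) ≡ 0
    ⇒P N r q x h = cong₂ _+_ (n∸n+n∸n≡0 (E r q x)) (m≤n⇒m∸n≡0 h)

    E-injective : ∀ r q x r′ q′ x′ → E r q x ≡ E r′ q′ x′ → toVec {3} (r , q , x , tt) ≡ toVec {3} (r′ , q′ , x′ , tt)
    E-injective r q x r′ q′ x′ eq with oddMultiple-injective r _ r′ _ eq
    ... | refl , eq′ with oddMultiple-injective q x q′ x′ eq′
    ... | refl , refl = refl

    searched : ∀ N → _
    searched N = search-then (Pᵣ N) F λ { m (r , q , x , tt) (r′ , q′ , x′ , tt) y p p′ →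
      subst (λ v → F · v ↦ y) (E-injective r q x r′ q′ x′
        (trans (sym (P⇒≡ N m r q x p)) (P⇒≡ N m r′ q′ x′ p′))) }

    ψ : ℕ → PartialRecursive 1
    ψ N = proj₁ (searched N)

    restricts : ∀ N m y → ψ N · (m ∷ []) ↦ y → N ≤ m × ψ 0 · (m ∷ []) ↦ y
    restricts N m y h =
      let (r , q , x , tt) , p , Fy = proj₂ (proj₂ (searched N)) m y h
          m≡E = P⇒≡ N m r q x p
      in P⇒≤ N m r q x p ,
         subst (λ m → ψ 0 · (m ∷ []) ↦ y) (sym m≡E)
           (proj₁ (proj₂ (searched 0)) (E r q x) (r , q , x , tt) y (⇒P 0 r q x z≤n) Fy)

    linear : ∀ N → LinearlyUniversal (ψ N)
    linear N θ = a , b , λ x y → mk⇔ (from x y) (to x y)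
      where
      simulation : _
      simulation = simulate U universal θ N

      r q a b : ℕ
      r = code (proj₁ simulation)
      q = 2 ^ length (proj₁ simulation)
      -- Coefficient of x in `E r q (x + N)`; `b` is the value at x = 0.
      a = 2 ^ r * (2 * (2 ^ q * 2))
      b = E r q N

      E≡ : ∀ x → a * x + b ≡ E r q (x + N)
      E≡ x = regroup (2 ^ r) (2 ^ q) x N
        where
        regroup : ∀ r q x N → r * (2 * (q * 2)) * x + r * suc (2 * (q * suc (2 * N)))
                            ≡ r * suc (2 * (q * suc (2 * (x + N))))
        regroup = solve-∀

      input≡ : ∀ x → code (proj₁ simulation ++ unary (x + N)) ≡ r + q * code (unary (x + N))
      input≡ x = code-++ (proj₁ simulation) (unary (x + N))

      from : ∀ x y → ψ N · (a * x + b ∷ []) ↦ y → θ · (x ∷ []) ↦ y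
      from x y h =
        let (r′ , q′ , x′ , tt) , p , Fy = proj₂ (proj₂ (searched N)) (a * x + b) y h
        in Equivalence.to (proj₂ simulation x y)
          (subst (λ z → U · (z ∷ []) ↦ y) (sym (input≡ x))
            (Equivalence.to (∘ᵣ-⇔ U inputᵣ (r , q , x + N , tt) y)
              (subst (λ v → F · v ↦ y)
                (E-injective r′ q′ x′ r q (x + N)
                  (trans (sym (P⇒≡ N (a * x + b) r′ q′ x′ p)) (E≡ x))) Fy)))

      to : ∀ x y → θ · (x ∷ []) ↦ y → ψ N · (a * x + b ∷ []) ↦ y
      -- The encoded argument is x + N and not x, so every a x + b is at least N and the restriction
      -- loses nothing of θ.
      to x y h = subst (λ m → ψ N · (m ∷ []) ↦ y) (sym (E≡ x))
        (proj₁ (proj₂ (searched N)) (E r q (x + N)) (r , q , x + N , tt) y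
          (⇒P N r q (x + N) (≤-trans (m≤n+m N x)
            (≤-trans (≤-oddMultiple q (x + N)) (≤-oddMultiple r _))))
          (Equivalence.from (∘ᵣ-⇔ U inputᵣ (r , q , x + N , tt) y)
            (subst (λ z → U · (z ∷ []) ↦ y) (input≡ x) (Equivalence.from (proj₂ simulation x y) h))))

open LinearUniversality

-- Kraft's inequality.

module Incompressibility where

  open import Axiom.ExcludedMiddle using (ExcludedMiddle)
  open import Data.Bool using (Bool; true; false; not; if_then_else_; _∧_)
  open import Data.Fin using (zero; suc)
  open import Data.Fin.Patterns using (0F; 1F; 2F)
  open import Data.List using (List; []; _∷_; _++_; length; _∷ʳ_; map)
  open import Data.List.Properties using (applyUpTo-∷ʳ; length-applyUpTo; length-++; ∷ʳ-injective; map-++; ++-assoc; ++-identityʳ; ++-cancelˡ)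
  open import Data.List.Relation.Unary.All as All using (All; []; _∷_)
  open import Data.List.Relation.Unary.All.Properties using () renaming (++⁺ to All-++⁺)
  open import Data.List.Relation.Unary.AllPairs using (AllPairs; []; _∷_)
  open import Data.List.Relation.Unary.AllPairs.Properties using () renaming (++⁺ to AllPairs-++⁺)
  open import Data.List.Relation.Binary.Prefix.Heterogeneous using (Prefix; []; _∷_)
  open import Data.Nat
  open import Data.Nat.ListAction using (sum)
  open import Data.Nat.ListAction.Properties using (sum-++)
  open import Data.Nat.Properties
  open import Data.Nat.Tactic.RingSolver using (solve-∀)
  open import Data.Product using (_×_; _,_; proj₁; proj₂; ∃-syntax)
  open import Data.Sum using (_⊎_; inj₁; inj₂)
  open import Data.Unit using (tt)
  open import Data.Vec using ([]; _∷_)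
  open import Level using (0ℓ)
  open import Relation.Binary.PropositionalEquality hiding ([_])
  open import Relation.Nullary using (¬_; contradiction; yes; no)
  open import Function using (_∘_; _⇔_; Equivalence)
  open import Defs using (_·_↦_; code; Machine; _[_]=_; PrefixFree; _↾_; Universal)
  open Rec
  open Rec*

  -- The sum of 2^(-|τ|) in units of 2^(-L), an integer when no string is longer than L.
  weight : ℕ → List (List Bool) → ℕ
  weight L ts = sum (map (λ τ → 2 ^ (L ∸ length τ)) ts)

  private
    tails : Bool → List (List Bool) → List (List Bool)
    tails b []                  = []
    tails b ([] ∷ ts)           = tails b ts
    tails true  ((true ∷ τ) ∷ ts)  = τ ∷ tails true ts
    tails true  ((false ∷ τ) ∷ ts) = tails true ts
    tails false ((true ∷ τ) ∷ ts)  = tails false ts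
    tails false ((false ∷ τ) ∷ ts) = τ ∷ tails false ts

    tails-All : ∀ {P : List Bool → Set} b {ts} → All P ts → All (λ τ → P (b ∷ τ)) (tails b ts)
    tails-All b     {[]}                []       = []
    tails-All b     {[] ∷ ts}           (p ∷ ps) = tails-All b ps
    tails-All true  {(true ∷ τ) ∷ ts}   (p ∷ ps) = p ∷ tails-All true ps
    tails-All true  {(false ∷ τ) ∷ ts}  (p ∷ ps) = tails-All true ps
    tails-All false {(true ∷ τ) ∷ ts}   (p ∷ ps) = tails-All false ps
    tails-All false {(false ∷ τ) ∷ ts}  (p ∷ ps) = p ∷ tails-All false ps

    tails-AllPairs : ∀ b {ts} → AllPairs (λ σ τ → ¬ σ ∼ τ) ts → AllPairs (λ σ τ → ¬ σ ∼ τ) (tails b ts)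
    tails-AllPairs b     {[]}               []       = []
    tails-AllPairs b     {[] ∷ ts}          (p ∷ ps) = tails-AllPairs b ps
    tails-AllPairs true  {(true ∷ τ) ∷ ts}  (p ∷ ps) =
      All.map (λ h → h ∘ (true ∷_)) (tails-All true p) ∷ tails-AllPairs true ps
    tails-AllPairs true  {(false ∷ τ) ∷ ts} (p ∷ ps) = tails-AllPairs true ps
    tails-AllPairs false {(true ∷ τ) ∷ ts}  (p ∷ ps) = tails-AllPairs false ps
    tails-AllPairs false {(false ∷ τ) ∷ ts} (p ∷ ps) =
      All.map (λ h → h ∘ (false ∷_)) (tails-All false p) ∷ tails-AllPairs false ps

    weight-tails : ∀ L {ts} → All ([] ≢_) ts →
      weight (suc L) ts ≡ weight L (tails false ts) + weight L (tails true ts)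
    weight-tails L {[]}               []       = refl
    weight-tails L {[] ∷ ts}          (p ∷ ps) = contradiction refl p
    weight-tails L {(true ∷ τ) ∷ ts}  (p ∷ ps) = trans (cong (2 ^ (L ∸ length τ) +_) (weight-tails L ps))
      (regroup (2 ^ (L ∸ length τ)) (weight L (tails false ts)) (weight L (tails true ts)))
      where
      regroup : ∀ x a b → x + (a + b) ≡ a + (x + b)
      regroup = solve-∀
    weight-tails L {(false ∷ τ) ∷ ts} (p ∷ ps) = trans (cong (2 ^ (L ∸ length τ) +_) (weight-tails L ps))
      (sym (+-assoc (2 ^ (L ∸ length τ)) _ _))

    nonempty : ∀ {σ τ ts} → AllPairs (λ σ τ → ¬ σ ∼ τ) (σ ∷ τ ∷ ts) → All ([] ≢_) (σ ∷ τ ∷ ts)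
    nonempty {σ} ((p ∷ ps) ∷ _) = (λ { refl → p []ˡ }) ∷ All.map (λ h → λ { refl → h []ʳ }) (p ∷ ps)

  -- Induction on L, sorting the strings by their first bit. A single string is treated apart,
  -- because it may be empty and then `tails` would drop it; among two or more incompatible strings
  -- none is empty.
  kraft : ∀ L ts → All (λ τ → length τ ≤ L) ts → AllPairs (λ σ τ → ¬ σ ∼ τ) ts → weight L ts ≤ 2 ^ L
  kraft L []       _ _ = z≤n
  kraft L (τ ∷ []) _ _ = ≤-trans (≤-reflexive (+-identityʳ _)) (^-monoʳ-≤ 2 (m∸n≤m L (length τ)))
  kraft zero    (σ ∷ τ ∷ ts) (p ∷ q ∷ _) ((r ∷ _) ∷ _) with σ | τ | p | q
  ... | [] | _ | _ | _ = contradiction []ˡ r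
  kraft (suc L) ts@(_ ∷ _ ∷ _) lengths apart = begin
    weight (suc L) ts                                   ≡⟨ weight-tails L (nonempty apart) ⟩
    weight L (tails false ts) + weight L (tails true ts) ≤⟨ +-mono-≤ (half false) (half true) ⟩
    2 ^ L + 2 ^ L                                       ≡⟨ cong (2 ^ L +_) (sym (+-identityʳ (2 ^ L))) ⟩
    2 ^ suc L                                           ∎
    where
    open ≤-Reasoning
    half : ∀ b → weight L (tails b ts) ≤ 2 ^ L
    half b = kraft L (tails b ts) (All.map ≤-pred (tails-All b lengths)) (tails-AllPairs b apart)

  -- Compatible programs are comparable in one order or the other, hence equal. Used
  -- contrapositively: programs with different outputs are incompatible.
  prefixFree-∼ : ∀ {M : Machine} → PrefixFree M → ∀ {τ τ′ σ σ′} → M [ τ ]= σ → M [ τ′ ]= σ′ → τ ∼ τ′ → σ ≡ σ′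
  prefixFree-∼ {M} pf {τ} {τ′} {σ} {σ′} h h′ τ∼τ′ with ordered τ∼τ′
    where
    ordered : ∀ {τ τ′} → τ ∼ τ′ → Prefix _≡_ τ τ′ ⊎ Prefix _≡_ τ′ τ
    ordered []ˡ = inj₁ []
    ordered []ʳ = inj₂ []
    ordered (b ∷ h) with ordered h
    ... | inj₁ p = inj₁ (refl ∷ p)
    ... | inj₂ p = inj₂ (refl ∷ p)
  ... | inj₁ p with refl ← pf τ τ′ σ σ′ h h′ p = code-injective σ σ′ (deterministic M _ _ h h′)
  ... | inj₂ p with refl ← pf τ′ τ σ′ σ h′ h p = code-injective σ σ′ (deterministic M _ _ h h′)

  -- The tree of sequences with forced zeros: an incompressible path and its compression.

  module SlowlyGrowing
    (z : ℕ → ℕ) (z-zero : z 0 ≡ 0)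
    (z-suc : ∀ n → z (suc n) ≡ z n ⊎ z (suc n) ≡ suc (z n))
    (z-unbounded : ∀ k → ∃[ n ] k ≤ z n)
    (z-rec : ∀ {O} {X : O → ℕ → ℕ} {n} {f : Env n → ℕ} → Rec X f → Rec X (λ ρ → z (f ρ)))
    where

    z≤id : ∀ n → z n ≤ n
    z≤id zero = ≤-reflexive z-zero
    z≤id (suc n) with z-suc n
    ... | inj₁ eq = ≤-trans (≤-reflexive eq) (≤-trans (z≤id n) (n≤1+n n))
    ... | inj₂ eq = ≤-trans (≤-reflexive eq) (s≤s (z≤id n))

    g : ℕ → ℕ
    g n = n ∸ z n

    g+z : ∀ n → g n + z n ≡ n
    g+z n = m∸n+n≡m (z≤id n)

    -- The tree considered below consists of the strings with a 0 at every position that is not free.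
    data Step (n : ℕ) : Bool → Set where
      free   : g (suc n) ≡ suc (g n) → Step n true
      forced : g (suc n) ≡ g n → Step n false

    step : ∀ n → ∃[ b ] Step n b
    step n with z-suc n
    ... | inj₁ eq = true  , free (trans (cong (suc n ∸_) eq) (+-∸-assoc 1 (z≤id n)))
    ... | inj₂ eq = false , forced (cong (suc n ∸_) eq)

    Free : ℕ → Bool
    Free n = proj₁ (step n)

    -- An arithmetic form of freeness, through which programs can use it.
    digit-free : ∀ n → digit (Free n) ≡ g (suc n) ∸ g n
    digit-free n with step n
    ... | true  , free eq   = sym (trans (cong (_∸ g n) eq) (m+n∸n≡m 1 (g n)))
    ... | false , forced eq = sym (trans (cong (_∸ g n) eq) (n∸n≡0 (g n)))

    g-suc : ∀ n → g (suc n) ≡ digit (Free n) + g n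
    g-suc n with step n
    ... | true  , free eq   = eq
    ... | false , forced eq = eq

    g≤id : ∀ n → g n ≤ n
    g≤id n = m∸n≤m n (z n)

    module Incompressible (U : Machine) (pf : PrefixFree U) where

      Bad : List Bool → Set
      Bad σ = ∃[ τ ] U [ τ ]= σ × length τ < g (length σ)

      -- Covered d σ: every path of the tree through σ meets a bad string within d steps.
      Covered : ℕ → List Bool → Set
      Covered zero    σ = Bad σ
      Covered (suc d) σ = Bad σ
        ⊎ Covered d (σ ∷ʳ false) × (Free (length σ) ≡ true → Covered d (σ ∷ʳ true))

      -- A cover of σ yields incomparable programs of total measure at least 2 · 2^(- g |σ|),
      -- which Kraft's inequality forbids for σ = [].
      Programs : List Bool → ℕ → List (List Bool) → Set
      Programs σ L ts = All (λ τ → length τ ≤ L × ∃[ β ] U [ τ ]= (σ ++ β)) ts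
                      × AllPairs (λ σ τ → ¬ σ ∼ τ) ts
                      × 2 ^ suc (L ∸ g (length σ)) ≤ weight L ts

      private
        length-∷ʳ : ∀ (σ : List Bool) b → length (σ ∷ʳ b) ≡ suc (length σ)
        length-∷ʳ σ b = trans (length-++ σ) (+-comm (length σ) 1)

        extend : ∀ σ b {ts L} → All (λ τ → length τ ≤ L × ∃[ β ] U [ τ ]= (σ ∷ʳ b ++ β)) ts →
          All (λ τ → length τ ≤ L × ∃[ β ] U [ τ ]= (σ ++ β)) ts
        extend σ b = All.map λ { {τ} (l , β , h) → l , b ∷ β , subst (U [ τ ]=_) (++-assoc σ (b ∷ []) β) h }

        bad-programs : ∀ σ L → length σ ≤ L → Bad σ → ∃[ ts ] Programs σ L ts
        bad-programs σ L σ≤L (τ , h , τ<g) = τ ∷ [] ,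
          (≤-trans (<⇒≤ τ<g) g≤L , [] , subst (U [ τ ]=_) (sym (++-identityʳ σ)) h) ∷ [] ,
          [] ∷ [] ,
          -- The strict inequality in `Bad` yields the extra factor 2.
          ≤-trans (^-monoʳ-≤ 2 (∸-monoʳ-< τ<g g≤L)) (≤-reflexive (sym (+-identityʳ _)))
          where
          g≤L : g (length σ) ≤ L
          g≤L = ≤-trans (g≤id (length σ)) σ≤L

      -- At a forced position only the child with 0 is in the tree and `g` stays the same, so its
      -- programs serve. At a free position `g` grows by one, so each child contributes half of what
      -- is required; programs for the two children have different outputs and are therefore
      -- incompatible.
      covered-programs : ∀ d σ L → length σ + d ≤ L → Covered d σ → ∃[ ts ] Programs σ L ts
      covered-programs zero    σ L l≤L bad = bad-programs σ L (m+n≤o⇒m≤o (length σ) l≤L) bad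
      covered-programs (suc d) σ L l≤L (inj₁ bad) = bad-programs σ L (m+n≤o⇒m≤o (length σ) l≤L) bad
      covered-programs (suc d) σ L l≤L (inj₂ (c₀ , c₁)) with Free (length σ) in free-eq
      ... | false with covered-programs d (σ ∷ʳ false) L l≤L′ c₀
        where
        l≤L′ : length (σ ∷ʳ false) + d ≤ L
        l≤L′ = ≤-trans (≤-reflexive (trans (cong (_+ d) (length-∷ʳ σ false)) (sym (+-suc (length σ) d)))) l≤L
      ... | ts , ps , apart , w = ts , extend σ false ps , apart , subst (λ x → 2 ^ suc (L ∸ x) ≤ weight L ts)
        (trans (cong g (length-∷ʳ σ false)) (trans (g-suc (length σ)) (cong (λ b → digit b + g (length σ)) free-eq))) w
      covered-programs (suc d) σ L l≤L (inj₂ (c₀ , c₁)) | true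
        with covered-programs d (σ ∷ʳ false) L (l≤L′ false) c₀
           | covered-programs d (σ ∷ʳ true) L (l≤L′ true) (c₁ refl)
        where
        l≤L′ : ∀ b → length (σ ∷ʳ b) + d ≤ L
        l≤L′ b = ≤-trans (≤-reflexive (trans (cong (_+ d) (length-∷ʳ σ b)) (sym (+-suc (length σ) d)))) l≤L
      ... | ts , ps , apart , w | ts′ , ps′ , apart′ , w′ =
        ts ++ ts′ , All-++⁺ (extend σ false ps) (extend σ true ps′) ,
        AllPairs-++⁺ apart apart′ (All.map (λ { (_ , β , h) → All.map (λ { (_ , β′ , h′) τ∼τ′ →
          disjoint β β′ (prefixFree-∼ {U} pf {σ = σ ∷ʳ false ++ β} {σ ∷ʳ true ++ β′} h h′ τ∼τ′) }) ps′ }) ps) ,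
        total
        where
        n : ℕ
        n = length σ

        disjoint : ∀ β β′ → σ ∷ʳ false ++ β ≢ σ ∷ʳ true ++ β′
        disjoint β β′ eq with ++-cancelˡ σ (false ∷ β) (true ∷ β′)
                                (trans (sym (++-assoc σ (false ∷ []) β)) (trans eq (++-assoc σ (true ∷ []) β′)))
        ... | ()

        g-child : ∀ b → g (length (σ ∷ʳ b)) ≡ suc (g n)
        g-child b = trans (cong g (length-∷ʳ σ b)) (trans (g-suc n) (cong (λ b → digit b + g n) free-eq))

        exponent : suc (L ∸ suc (g n)) ≡ L ∸ g n
        exponent = sym (+-∸-assoc 1 (≤-trans (s≤s (g≤id n)) (≤-trans (s≤s (m≤m+n n d)) (≤-trans (≤-reflexive (sym (+-suc n d))) l≤L))))

        total : 2 ^ suc (L ∸ g n) ≤ weight L (ts ++ ts′)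
        total = begin
          2 ^ suc (L ∸ g n)                        ≡⟨ cong (2 ^ (L ∸ g n) +_) (+-identityʳ _) ⟩
          2 ^ (L ∸ g n) + 2 ^ (L ∸ g n)            ≡⟨ cong₂ _+_ (sym (half false)) (sym (half true)) ⟩
          2 ^ suc (L ∸ g (length (σ ∷ʳ false))) + 2 ^ suc (L ∸ g (length (σ ∷ʳ true))) ≤⟨ +-mono-≤ w w′ ⟩
          weight L ts + weight L ts′               ≡⟨ sym (sum-++ (map (λ τ → 2 ^ (L ∸ length τ)) ts) _) ⟩
          sum (map (λ τ → 2 ^ (L ∸ length τ)) ts ++ map (λ τ → 2 ^ (L ∸ length τ)) ts′) ≡⟨ cong sum (sym (map-++ _ ts ts′)) ⟩
          weight L (ts ++ ts′)                     ∎
          where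
          open ≤-Reasoning
          half : ∀ b → 2 ^ suc (L ∸ g (length (σ ∷ʳ b))) ≡ 2 ^ (L ∸ g n)
          half b = cong (2 ^_) (trans (cong (λ x → suc (L ∸ x)) (g-child b)) exponent)

      -- Since `g` vanishes at 0, the programs obtained from a cover of the root would weigh at
      -- least 2^(d+1), while Kraft allows 2^d.
      root-uncovered : ∀ d → ¬ Covered d []
      root-uncovered d c with covered-programs d [] d ≤-refl c
      ... | ts , ps , apart , w = <⇒≱ (^-monoʳ-< 2 (s≤s (s≤s z≤n)) (n<1+n d))
        (≤-trans (subst (λ x → 2 ^ suc (d ∸ x) ≤ weight d ts) (0∸n≡0 (z 0)) w) (kraft d ts (All.map proj₁ ps) apart))

      covered-suc : ∀ d σ → Covered d σ → Covered (suc d) σ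
      covered-suc zero    σ c = inj₁ c
      covered-suc (suc d) σ (inj₁ bad) = inj₁ bad
      covered-suc (suc d) σ (inj₂ (c₀ , c₁)) =
        inj₂ (covered-suc d (σ ∷ʳ false) c₀ , λ eq → covered-suc d (σ ∷ʳ true) (c₁ eq))

      covered-+ : ∀ k d σ → Covered d σ → Covered (k + d) σ
      covered-+ zero    d σ c = c
      covered-+ (suc k) d σ c = covered-suc (k + d) σ (covered-+ k d σ c)

      Uncovered : List Bool → Set
      Uncovered σ = ∀ d → ¬ Covered d σ

      module _ (em : ExcludedMiddle 0ℓ) where

        private
          cover : ∀ σ → ¬ Uncovered σ → ∃[ d ] Covered d σ
          cover σ h with em {∃[ d ] Covered d σ}
          ... | yes c = c
          ... | no ¬c = contradiction (λ d c → ¬c (d , c)) h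

        -- If all children in the tree were covered, within d and d′ steps, then σ would be covered
        -- within `suc (d + d′)`.
        uncovered-child : ∀ σ → Uncovered σ → ∃[ b ] Uncovered (σ ∷ʳ b) × (b ≡ true → Free (length σ) ≡ true)
        uncovered-child σ u with em {Uncovered (σ ∷ʳ false)}
        ... | yes u₀ = false , u₀ , λ ()
        ... | no ¬u₀ with cover (σ ∷ʳ false) ¬u₀ | em {Uncovered (σ ∷ʳ true)} | Free (length σ) in eq
        ... | d , c₀ | _ | false = contradiction (inj₂ (c₀ , λ f → contradiction (trans (sym eq) f) λ ())) (u (suc d))
        ... | d , c₀ | yes u₁ | true = true , u₁ , λ _ → refl
        ... | d , c₀ | no ¬u₁ | true with cover (σ ∷ʳ true) ¬u₁
        ... | d′ , c₁ = contradiction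
          (inj₂ (subst (λ k → Covered k (σ ∷ʳ false)) (+-comm d′ d) (covered-+ d′ d (σ ∷ʳ false) c₀) ,
                 λ _ → covered-+ d d′ (σ ∷ʳ true) c₁))
          (u (suc (d + d′)))

        path : ℕ → ∃[ σ ] Uncovered σ
        path zero    = [] , root-uncovered
        path (suc n) = let σ , u = path n ; b , u′ , _ = uncovered-child σ u in σ ∷ʳ b , u′

        branch : ℕ → Bool
        branch n = proj₁ (uncovered-child (proj₁ (path n)) (proj₂ (path n)))

        branch-↾ : ∀ n → branch ↾ n ≡ proj₁ (path n)
        branch-↾ zero    = refl
        branch-↾ (suc n) = trans (sym (applyUpTo-∷ʳ branch n)) (cong (_∷ʳ branch n) (branch-↾ n))

        branch-free : ∀ n → branch n ≡ true → Free n ≡ true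
        branch-free n eq = subst (λ k → Free k ≡ true)
          (trans (cong length (sym (branch-↾ n))) (length-applyUpTo branch n))
          (proj₂ (proj₂ (uncovered-child (proj₁ (path n)) (proj₂ (path n)))) eq)

        branch-incompressible : ∀ n τ → U [ τ ]= (branch ↾ n) → g n ≤ length τ
        branch-incompressible n τ h = ≮⇒≥ λ τ<g → proj₂ (path n) 0
          (τ , subst (U [ τ ]=_) (branch-↾ n) h ,
           subst (λ k → length τ < g k) (sym (trans (cong length (sym (branch-↾ n))) (length-applyUpTo branch n))) τ<g)

    compress : (ℕ → Bool) → ℕ → List Bool
    compress X zero    = []
    compress X (suc n) = if Free n then compress X n ∷ʳ X n else compress X n

    length-compress : ∀ X n → length (compress X n) ≡ g n
    length-compress X zero = sym (0∸n≡0 (z 0))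
    length-compress X (suc n) with step n
    ... | true  , free eq   = trans (length-++ (compress X n))
      (trans (+-comm _ 1) (trans (cong suc (length-compress X n)) (sym eq)))
    ... | false , forced eq = trans (length-compress X n) (sym eq)

    -- The first factor is 1 at free positions and 0 elsewhere, and `g i` is the place where bit i
    -- lands. The sum shows that compression is recursive.
    code-compress : ∀ X n → code (compress X n)
      ≡ ∑< n (λ i → (g (suc i) ∸ g i) * (2 ^ g i * suc (digit (X i))))
    code-compress X zero = refl
    code-compress X (suc n) with Free n | digit-free n
    ... | true  | eq = trans (code-++ (compress X n) (X n ∷ [])) (cong₂ _+_ (code-compress X n)
      (trans (cong₂ (λ a b → 2 ^ a * b) (length-compress X n)
               (trans (code-∷ (X n) []) (cong suc (+-identityʳ (digit (X n))))))
             (trans (sym (*-identityˡ _)) (cong (_* (2 ^ g n * suc (digit (X n)))) eq))))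
    ... | false | eq = trans (code-compress X n) (trans (sym (+-identityʳ _))
      (cong (∑< n (λ i → (g (suc i) ∸ g i) * (2 ^ g i * suc (digit (X i)))) +_)
        (cong (_* (2 ^ g n * suc (digit (X n)))) eq)))

    compress-injective : ∀ X Y n → compress X n ≡ compress Y n → ∀ i → i < n → Free i ≡ true → X i ≡ Y i
    compress-injective X Y (suc n) eq i (s≤s i≤n) f with m≤n⇒m<n∨m≡n i≤n
    ... | inj₁ i<n with Free n
    ... | true  = compress-injective X Y n (proj₁ (∷ʳ-injective _ _ eq)) i i<n f
    ... | false = compress-injective X Y n eq i i<n f
    compress-injective X Y (suc n) eq i (s≤s i≤n) f | inj₂ refl with Free n | f
    ... | true | refl = proj₂ (∷ʳ-injective (compress X n) (compress Y n) eq)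

    module Compressible (U : Machine) (universal : Universal U) where

      private
        deficient-exists : ∀ (ρ : Env 1) → ∃[ n ] 2 * look 0F ρ ∸ z n ≡ 0
        deficient-exists ρ = let n , h = z-unbounded (2 * look 0F ρ) in n , m≤n⇒m∸n≡0 h

        -- A length with at least 2j forced zeros: half of them pay for the unary name of j, the
        -- other half are the gain.
        deficient : ℕ → ℕ
        deficient j = proj₁ (leastZero (λ n → 2 * j ∸ z n) (deficient-exists (j , tt)))

        deficient-z : ∀ j → 2 * j ≤ z (deficient j)
        deficient-z j = m∸n≡0⇒m≤n (proj₁ (proj₂ (leastZero (λ n → 2 * j ∸ z n) (deficient-exists (j , tt)))))

        deficientᵣ : ∀ {n} {f : Env n → ℕ} → Rec none f → Rec none (λ ρ → deficient (f ρ))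
        deficientᵣ = ap₁ (rec-leastZero (lit 2 *ᵣ var 1F ∸ᵣ z-rec (var 0F)) deficient-exists)

        gᵣ : ∀ {n} {f : Env n → ℕ} → Rec none f → Rec none (λ ρ → g (f ρ))
        gᵣ r = r ∸ᵣ z-rec r

        str : Env 2 → List Bool
        str ρ = unary (look 0F ρ) ++ compress (bits (look 1F ρ)) (deficient (look 0F ρ))

        strᵣ : Rec none (λ ρ → code (str ρ))
        strᵣ = code-++ᵣ {σ = λ ρ → unary (look 0F ρ)} {λ ρ → compress (bits (look 1F ρ)) (deficient (look 0F ρ))}
          (code-unaryᵣ (var 0F)) (rec-ext (sucᵣ (var 0F)) λ ρ → sym (length-unary (look 0F ρ)))
          (rec-ext
            (∑ᵣ {f = λ i ρ → (g (suc i) ∸ g i) * (2 ^ g i * suc (digit (bits (look 1F ρ) i)))}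
              (deficientᵣ (var 0F))
              ((gᵣ (sucᵣ (var 0F)) ∸ᵣ gᵣ (var 0F)) *ᵣ (lit 2 ^ᵣ gᵣ (var 0F) *ᵣ sucᵣ (bitsᵣ (var 2F) (var 0F)))))
            λ ρ → sym (code-compress (bits (look 1F ρ)) (deficient (look 0F ρ))))

        masked : ℕ → ℕ → Bool
        masked v i = Free i ∧ bits v i

        out : Env 2 → ℕ
        out ρ = code (masked (look 1F ρ) ↾ deficient (look 0F ρ))

        outᵣ : Rec none out
        outᵣ = code-↾ᵣ {Y = λ ρ → masked (look 1F ρ)} (deficientᵣ (var 0F))
          (rec-ext ((gᵣ (sucᵣ (var 0F)) ∸ᵣ gᵣ (var 0F)) *ᵣ bitsᵣ (var 2F) (var 0F)) λ ρ →
            trans (cong (_* digit (bits (look 2F ρ) (look 0F ρ))) (sym (digit-free (look 0F ρ))))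
                  (digit-∧ (Free (look 0F ρ)) (bits (look 2F ρ) (look 0F ρ))))
          where
          digit-∧ : ∀ a b → digit a * digit b ≡ digit (a ∧ b)
          digit-∧ true  b = +-identityʳ (digit b)
          digit-∧ false b = refl

        str-∼ : ∀ ρ σ → str ρ ∼ str σ → look 0F ρ ≡ look 0F σ
              × compress (bits (look 1F ρ)) (deficient (look 0F ρ)) ≡ compress (bits (look 1F σ)) (deficient (look 0F σ))
        str-∼ (j , v , tt) (j′ , v′ , tt) h with ∼-unary j j′ h
        ... | refl , h′ = refl , ∼-length h′
          (trans (length-compress (bits v) (deficient j)) (sym (length-compress (bits v′) (deficient j))))

        -- The parameters may disagree at forced positions, where `masked` erases the disagreement.
        out-functional : ∀ ρ σ → str ρ ≡ str σ → out ρ ≡ out σ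
        out-functional (j , v , tt) (j′ , v′ , tt) eq with str-∼ (j , v , tt) (j′ , v′ , tt) (subst (str (j , v , tt) ∼_) eq (∼-refl _))
        ... | refl , eq′ = cong code (↾-cong (deficient j) λ i i<n → mask i (compress-injective (bits v) (bits v′) (deficient j) eq′ i i<n))
          where
          mask : ∀ i → (Free i ≡ true → bits v i ≡ bits v′ i) → masked v i ≡ masked v′ i
          mask i h with Free i
          ... | true  = h refl
          ... | false = refl

      -- The machine reads j from its input, so the constant depends neither on j nor on X.
      compressor : ∃[ c ] ∀ X → (∀ i → X i ≡ true → Free i ≡ true) →
        ∀ j → ∃[ n ] ∃[ τ ] U [ τ ]= (X ↾ n) × length τ + j ≤ c + n
      compressor = suc (length ρ) , compresses
        where
        machine : _
        machine = codeword-machine str strᵣ (program outᵣ)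
          (λ ρ σ h → cong₂ (λ j c → unary j ++ c) (proj₁ (str-∼ ρ σ h)) (proj₂ (str-∼ ρ σ h)))
          (λ ρ σ y eq h → subst (program outᵣ · toVec σ ↦_)
            (trans (sym (out-functional ρ σ eq)) (deterministic (program outᵣ) _ _ (runs outᵣ ρ) h)) (runs outᵣ σ))

        simulation : ∃[ ρ ] ∀ τ σ → (U [ ρ ++ τ ]= σ) ⇔ (proj₁ machine [ τ ]= σ)
        simulation = Universal.universal universal (proj₁ machine) (proj₁ (proj₂ machine))

        ρ : List Bool
        ρ = proj₁ simulation

        compresses : ∀ X → (∀ i → X i ≡ true → Free i ≡ true) →
          ∀ j → ∃[ n ] ∃[ τ ] U [ τ ]= (X ↾ n) × length τ + j ≤ suc (length ρ) + n
        compresses X X-free j = n , ρ ++ str (j , v , tt) ,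
          Equivalence.from (proj₂ simulation (str (j , v , tt)) (X ↾ n))
            (proj₁ (proj₂ (proj₂ machine)) (j , v , tt) (X ↾ n)
              (subst (program outᵣ · (j ∷ v ∷ []) ↦_) (cong code (↾-cong n agrees)) (runs outᵣ (j , v , tt)))) ,
          short
          where
          n v : ℕ
          n = deficient j
          v = proj₁ (bits-surjective X n)

          agrees : ∀ i → i < n → masked v i ≡ X i
          agrees i i<n rewrite proj₂ (bits-surjective X n) i i<n with X i in eq
          ... | true  = cong (_∧ true) (X-free i eq)
          ... | false with Free i
          ... | true  = refl
          ... | false = refl

          short : length (ρ ++ str (j , v , tt)) + j ≤ suc (length ρ) + n
          short = begin
            length (ρ ++ str (j , v , tt)) + j          ≡⟨ cong (_+ j) (length-++ ρ) ⟩
            length ρ + length (str (j , v , tt)) + j    ≡⟨ cong (λ x → length ρ + x + j) (length-++ (unary j)) ⟩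
            length ρ + (length (unary j) + length (compress (bits v) n)) + j
              ≡⟨ cong₂ (λ x y → length ρ + (x + y) + j) (length-unary j) (length-compress (bits v) n) ⟩
            length ρ + (suc j + g n) + j                ≡⟨ regroup (length ρ) j (g n) ⟩
            suc (length ρ) + (g n + 2 * j)              ≤⟨ +-monoʳ-≤ (suc (length ρ)) (+-monoʳ-≤ (g n) (deficient-z j)) ⟩
            suc (length ρ) + (g n + z n)                ≡⟨ cong (suc (length ρ) +_) (g+z n) ⟩
            suc (length ρ) + n                          ∎
            where
            open ≤-Reasoning
            regroup : ∀ r j x → r + (suc j + x) + j ≡ suc r + (x + 2 * j)
            regroup = solve-∀

open Incompressibility

-- Rational lower and upper bounds of Cauchy reals.

module RationalBounds where

  open import Data.Integer as ℤ using (ℤ; _⊖_) renaming (+_ to pos)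
  import Data.Integer.Properties as ℤₚ
  open import Data.Integer.Tactic.RingSolver using () renaming (solve-∀ to ℤ-solve-∀)
  open import Data.Nat as ℕ using (ℕ; zero; suc; _^_; z≤n; s≤s)
  import Data.Nat.Properties as ℕₚ
  open import Data.Product using (∃-syntax)
  open import Data.Rational using (ℚ; _≤_; _+_; _-_; _*_; 0ℚ; 1ℚ; ½; toℚᵘ)
  import Data.Rational as ℚ
  import Data.Rational.Properties as ℚₚ
  open import Data.Rational.Solver using (module +-*-Solver)
  import Data.Rational.Unnormalised as ℚᵘ
  import Data.Rational.Unnormalised.Properties as ℚᵘₚ
  open import Data.Sum using (inj₁; inj₂)
  open import Relation.Binary.PropositionalEquality hiding ([_])
  open import Relation.Nullary using (¬_)
  open import Defs hiding (_<_; _≤_; _-_; -_; ∣_∣; _+_)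
  open import Defs as ℝ using ()
  open +-*-Solver using (solve; _:+_; _:*_; _:-_; :-_; _:=_; con)

  ι : ℕ → ℚ
  ι n = pos n ℚ./ 1

  abstract
    /-* : ∀ i d → (i ℚ./ suc d) * ι (suc d) ≡ i ℚ./ 1
    /-* i d = ℚₚ.toℚᵘ-injective (begin
      toℚᵘ ((i ℚ./ suc d) * ι (suc d))                    ≈⟨ ℚₚ.toℚᵘ-homo-* (i ℚ./ suc d) (ι (suc d)) ⟩
      toℚᵘ (i ℚ./ suc d) ℚᵘ.* toℚᵘ (ι (suc d))            ≈⟨ ℚᵘₚ.*-cong (ℚₚ.toℚᵘ-fromℚᵘ (ℚᵘ.mkℚᵘ i d)) (ℚₚ.toℚᵘ-fromℚᵘ (ℚᵘ.mkℚᵘ (pos (suc d)) 0)) ⟩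
      ℚᵘ.mkℚᵘ i d ℚᵘ.* ℚᵘ.mkℚᵘ (pos (suc d)) 0                ≈⟨ ℚᵘ.*≡* (regroup i (pos (suc d))) ⟩
      ℚᵘ.mkℚᵘ i 0                                         ≈⟨ ℚᵘₚ.≃-sym (ℚₚ.toℚᵘ-fromℚᵘ (ℚᵘ.mkℚᵘ i 0)) ⟩
      toℚᵘ (i ℚ./ 1)                                      ∎)
      where
      open ℚᵘₚ.≃-Reasoning
      regroup : ∀ i d → i ℤ.* d ℤ.* pos 1 ≡ i ℤ.* (d ℤ.* pos 1)
      regroup = ℤ-solve-∀

    /1-+ : ∀ i j → (i ℤ.+ j) ℚ./ 1 ≡ i ℚ./ 1 + j ℚ./ 1
    /1-+ i j = ℚₚ.toℚᵘ-injective (begin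
      toℚᵘ ((i ℤ.+ j) ℚ./ 1)             ≈⟨ ℚₚ.toℚᵘ-fromℚᵘ (ℚᵘ.mkℚᵘ (i ℤ.+ j) 0) ⟩
      ℚᵘ.mkℚᵘ (i ℤ.+ j) 0                ≈⟨ ℚᵘ.*≡* (regroup i j) ⟩
      ℚᵘ.mkℚᵘ i 0 ℚᵘ.+ ℚᵘ.mkℚᵘ j 0       ≈⟨ ℚᵘₚ.≃-sym (ℚᵘₚ.+-cong (ℚₚ.toℚᵘ-fromℚᵘ (ℚᵘ.mkℚᵘ i 0)) (ℚₚ.toℚᵘ-fromℚᵘ (ℚᵘ.mkℚᵘ j 0))) ⟩
      toℚᵘ (i ℚ./ 1) ℚᵘ.+ toℚᵘ (j ℚ./ 1) ≈⟨ ℚᵘₚ.≃-sym (ℚₚ.toℚᵘ-homo-+ (i ℚ./ 1) (j ℚ./ 1)) ⟩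
      toℚᵘ (i ℚ./ 1 + j ℚ./ 1)           ∎)
      where
      open ℚᵘₚ.≃-Reasoning
      regroup : ∀ i j → (i ℤ.+ j) ℤ.* pos 1 ≡ (i ℤ.* pos 1 ℤ.+ j ℤ.* pos 1) ℤ.* pos 1
      regroup = ℤ-solve-∀

    ι-+ : ∀ m n → ι (m ℕ.+ n) ≡ ι m + ι n
    ι-+ m n = /1-+ (pos m) (pos n)

    ι-* : ∀ m n → ι (m ℕ.* n) ≡ ι m * ι n
    ι-* m n = ℚₚ.toℚᵘ-injective (begin
      toℚᵘ (ι (m ℕ.* n))                       ≈⟨ ℚₚ.toℚᵘ-fromℚᵘ (ℚᵘ.mkℚᵘ (pos (m ℕ.* n)) 0) ⟩
      ℚᵘ.mkℚᵘ (pos (m ℕ.* n)) 0                  ≈⟨ ℚᵘ.*≡* (cong (ℤ._* pos 1) (ℤₚ.pos-* m n)) ⟩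
      ℚᵘ.mkℚᵘ (pos m) 0 ℚᵘ.* ℚᵘ.mkℚᵘ (pos n) 0     ≈⟨ ℚᵘₚ.≃-sym (ℚᵘₚ.*-cong (ℚₚ.toℚᵘ-fromℚᵘ (ℚᵘ.mkℚᵘ (pos m) 0)) (ℚₚ.toℚᵘ-fromℚᵘ (ℚᵘ.mkℚᵘ (pos n) 0))) ⟩
      toℚᵘ (ι m) ℚᵘ.* toℚᵘ (ι n)               ≈⟨ ℚᵘₚ.≃-sym (ℚₚ.toℚᵘ-homo-* (ι m) (ι n)) ⟩
      toℚᵘ (ι m * ι n)                         ∎)
      where open ℚᵘₚ.≃-Reasoning

    ι-mono : ∀ {m n} → m ℕ.≤ n → ι m ≤ ι n
    ι-mono {m} {n} m≤n = ℚₚ.toℚᵘ-cancel-≤ (ℚᵘₚ.≤-trans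
      (ℚᵘₚ.≤-reflexive (ℚₚ.toℚᵘ-fromℚᵘ (ℚᵘ.mkℚᵘ (pos m) 0)))
      (ℚᵘₚ.≤-trans (ℚᵘ.*≤* (ℤₚ.*-monoʳ-≤-nonNeg (pos 1) (ℤ.+≤+ m≤n)))
        (ℚᵘₚ.≤-reflexive (ℚᵘₚ.≃-sym (ℚₚ.toℚᵘ-fromℚᵘ (ℚᵘ.mkℚᵘ (pos n) 0))))))

    ι-cancel : ∀ {m n} → ι m ≤ ι n → m ℕ.≤ n
    ι-cancel {m} {n} h with ℚᵘₚ.≤-trans
      (ℚᵘₚ.≤-reflexive (ℚᵘₚ.≃-sym (ℚₚ.toℚᵘ-fromℚᵘ (ℚᵘ.mkℚᵘ (pos m) 0))))
      (ℚᵘₚ.≤-trans (ℚₚ.toℚᵘ-mono-≤ h) (ℚᵘₚ.≤-reflexive (ℚₚ.toℚᵘ-fromℚᵘ (ℚᵘ.mkℚᵘ (pos n) 0))))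
    ... | ℚᵘ.*≤* h′ = ℤₚ.drop‿+≤+ (ℤₚ.*-cancelʳ-≤-pos (pos m) (pos n) (pos 1) h′)

    0≤ι : ∀ n → 0ℚ ≤ ι n
    0≤ι n = ι-mono {0} {n} z≤n

    ⊖/1 : ∀ m n → (m ⊖ n) ℚ./ 1 + ι n ≡ ι m
    ⊖/1 m n = trans (sym (/1-+ (m ⊖ n) (pos n))) (cong (ℚ._/ 1)
      (trans (cong (ℤ._+ pos n) (sym (ℤₚ.m-n≡m⊖n m n))) (regroup (pos m) (pos n))))
      where
      regroup : ∀ m n → m ℤ.+ ℤ.- n ℤ.+ n ≡ m
      regroup = ℤ-solve-∀

    *-monoʳ : ∀ {c a b} → 0ℚ ≤ c → a ≤ b → a * c ≤ b * c
    *-monoʳ {c} 0≤c = ℚₚ.*-monoʳ-≤-nonNeg c {{ℚ.nonNegative 0≤c}}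

    *-monoˡ : ∀ {c a b} → 0ℚ ≤ c → a ≤ b → c * a ≤ c * b
    *-monoˡ {c} 0≤c = ℚₚ.*-monoˡ-≤-nonNeg c {{ℚ.nonNegative 0≤c}}

    *-mono-≤ : ∀ {a b c d} → 0ℚ ≤ a → 0ℚ ≤ d → a ≤ b → c ≤ d → a * c ≤ b * d
    *-mono-≤ 0≤a 0≤d a≤b c≤d = ℚₚ.≤-trans (*-monoˡ 0≤a c≤d) (*-monoʳ 0≤d a≤b)

    0≤* : ∀ {a b} → 0ℚ ≤ a → 0ℚ ≤ b → 0ℚ ≤ a * b
    0≤* {a} {b} 0≤a 0≤b = subst (_≤ a * b) (ℚₚ.*-zeroˡ b) (*-monoʳ 0≤b 0≤a)

    *-cancelʳ : ∀ {c a b} → ℚ.Positive c → a * c ≤ b * c → a ≤ b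
    *-cancelʳ {c} c>0 = ℚₚ.*-cancelʳ-≤-pos c {{c>0}}

    ι-pos : ∀ n .{{_ : ℕ.NonZero n}} → ℚ.Positive (ι n)
    ι-pos n = ℚ.positive (ℚₚ.<-≤-trans (ℚₚ.positive⁻¹ 1ℚ) (ι-mono {1} {n} (ℕ.>-nonZero⁻¹ n)))

    ½+½ : ∀ u → ½ * u + ½ * u ≡ u
    ½+½ = solve 1 (λ x → con ½ :* x :+ con ½ :* x := x) refl

    0≤½^ : ∀ n → 0ℚ ≤ ½^ n
    0≤½^ zero    = ℚₚ.nonNegative⁻¹ 1ℚ
    0≤½^ (suc n) = 0≤* (ℚₚ.nonNegative⁻¹ ½) (0≤½^ n)

    ½^-2^ : ∀ n → ½^ n * ι (2 ^ n) ≡ 1ℚ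
    ½^-2^ zero    = refl
    ½^-2^ (suc n) = trans (cong (½^ suc n *_) (ι-* 2 (2 ^ n)))
      (trans (regroup (½^ n) (ι (2 ^ n))) (½^-2^ n))
      where
      regroup : ∀ u v → ½ * u * (ι 2 * v) ≡ u * v
      regroup = solve 2 (λ u v → con ½ :* u :* (con (ι 2) :* v) := u :* v) refl

    ½^-+ : ∀ m n → ½^ (m ℕ.+ n) ≡ ½^ m * ½^ n
    ½^-+ zero    n = sym (ℚₚ.*-identityˡ (½^ n))
    ½^-+ (suc m) n = trans (cong (½ *_) (½^-+ m n)) (sym (ℚₚ.*-assoc ½ (½^ m) (½^ n)))

    ½^≤1 : ∀ n → ½^ n ≤ 1ℚ
    ½^≤1 zero    = ℚₚ.≤-refl
    ½^≤1 (suc n) = ℚₚ.≤-trans (subst (½ * ½^ n ≤_) (½+½ (½^ n))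
      (ℚₚ.≤-trans (ℚₚ.≤-reflexive (sym (ℚₚ.+-identityʳ _))) (ℚₚ.+-monoʳ-≤ (½ * ½^ n) (0≤½^ (suc n))))) (½^≤1 n)

    -- Linear inequalities follow from an identity between the differences of the two sides.
    linear₁ : ∀ {a b L R} → a ≤ b → L + (b - a) ≡ R → L ≤ R
    linear₁ {a} {b} {L} a≤b refl = subst (_≤ L + (b - a)) (trans (cong (L +_) (ℚₚ.+-inverseʳ a)) (ℚₚ.+-identityʳ L))
      (ℚₚ.+-monoʳ-≤ L (ℚₚ.+-monoˡ-≤ (ℚ.- a) a≤b))

    linear₂ : ∀ {a b c d L R} → a ≤ b → c ≤ d → L + (b - a) + (d - c) ≡ R → L ≤ R
    linear₂ a≤b c≤d eq = ℚₚ.≤-trans (linear₁ a≤b refl) (linear₁ c≤d eq)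

    linear₃ : ∀ {a b c d e f L R} → a ≤ b → c ≤ d → e ≤ f → L + (b - a) + (d - c) + (f - e) ≡ R → L ≤ R
    linear₃ a≤b c≤d e≤f eq = ℚₚ.≤-trans (linear₂ a≤b c≤d refl) (linear₁ e≤f eq)

    n≤2^n : ∀ n → n ℕ.≤ 2 ^ n
    n≤2^n zero    = z≤n
    n≤2^n (suc n) = ℕₚ.≤-trans (s≤s (n≤2^n n)) (ℕₚ.^-monoʳ-< 2 (s≤s (s≤s z≤n)) (ℕₚ.n<1+n n))

    -- A positive q - r with denominator D is at least 1/D, so at i = (c + 1) D the estimate 2^i ≥ i
    -- gives (q - r) 2^i ≥ c + 1, more than the hypothesis allows.
    archimedean : ∀ c {q r} → (∀ i → q ≤ r + ι c * ½^ i) → q ≤ r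
    archimedean c {q} {r} h = ℚₚ.≮⇒≥ λ r<q → go r<q
      where
      go : ¬ r ℚ.< q
      go r<q = ℚₚ.<-irrefl refl (ℚₚ.<-≤-trans (ℚₚ.positive⁻¹ 1ℚ) 1≤0)
        where
        d : ℚ
        d = q - r
        d>0 : 0ℚ ℚ.< d
        d>0 = subst (ℚ._< d) (ℚₚ.+-inverseʳ r) (ℚₚ.+-monoˡ-< (ℚ.- r) r<q)
        m n i : ℕ
        m = ℚ.ℚ.denominator-1 d
        n = ℤ.∣ ℚ.↥ d ∣
        i = suc c ℕ.* suc m
        num : ℚ.↥ d ≡ pos (suc (ℕ.pred n))
        num with ℚ.↥ d | ℚₚ.drop-*<* d>0
        ... | pos (suc k) | _ = refl
        ... | pos zero  | ℤ.+<+ ()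
        ... | ℤ.-[1+ k ] | ()
        d≡ : d * ι (suc m) ≡ ι (suc (ℕ.pred n))
        d≡ = trans (cong (_* ι (suc m)) (sym (ℚₚ.↥p/↧p≡p d))) (trans (/-* (ℚ.↥ d) m) (cong (ℚ._/ 1) num))
        1≤dm : 1ℚ ≤ d * ι (suc m)
        1≤dm = subst (1ℚ ≤_) (sym d≡) (ι-mono {1} {suc (ℕ.pred n)} (s≤s z≤n))
        c+1≤ : ι (suc c) ≤ d * ι (2 ^ i)
        c+1≤ = ℚₚ.≤-trans
          (subst₂ _≤_ (ℚₚ.*-identityˡ (ι (suc c)))
            (trans (ℚₚ.*-assoc d (ι (suc m)) (ι (suc c))) (cong (d *_) (trans (sym (ι-* (suc m) (suc c))) (cong ι (ℕₚ.*-comm (suc m) (suc c))))))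
            (*-monoʳ (0≤ι (suc c)) 1≤dm))
          (*-monoˡ (ℚₚ.<⇒≤ d>0) (ι-mono (n≤2^n i)))
        d≤ : d * ι (2 ^ i) ≤ ι c
        d≤ = subst (d * ι (2 ^ i) ≤_) (trans (ℚₚ.*-assoc (ι c) (½^ i) (ι (2 ^ i))) (trans (cong (ι c *_) (½^-2^ i)) (ℚₚ.*-identityʳ (ι c))))
          (*-monoʳ {ι (2 ^ i)} {d} (0≤ι (2 ^ i)) (linear₁ (h i) (regroup q r (ι c * ½^ i))))
          where
          regroup : ∀ q r x → (q - r) + ((r + x) - q) ≡ x
          regroup = solve 3 (λ q r x → (q :- r) :+ ((r :+ x) :- q) := x) refl
        1≤0 : 1ℚ ≤ 0ℚ
        1≤0 = linear₁ (ℚₚ.≤-trans (ℚₚ.≤-reflexive (sym (ι-+ 1 c))) (ℚₚ.≤-trans c+1≤ d≤)) (regroup (ι c))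
          where
          regroup : ∀ x → 1ℚ + (x - (ι 1 + x)) ≡ 0ℚ
          regroup = solve 1 (λ x → con 1ℚ :+ (x :- (con (ι 1) :+ x)) := con 0ℚ) refl

  -- This is q ≤ x, with the slack 2^(-i) of a regular sequence. All estimates below are phrased
  -- through such rational bounds, so that products are formed of rationals only.
  record Lower (x : ℝ) (q : ℚ) : Set where
    constructor lower
    field below : ∀ i → q ≤ approx x i + ½^ i

  record Upper (x : ℝ) (q : ℚ) : Set where
    constructor upper
    field above : ∀ i → approx x i ≤ q + ½^ i

  open Lower public
  open Upper public

  private
    p≤∣p∣ : ∀ p → p ≤ ℚ.∣ p ∣
    p≤∣p∣ p with ℚₚ.≤-total 0ℚ p
    ... | inj₁ 0≤p = ℚₚ.≤-reflexive (sym (ℚₚ.0≤p⇒∣p∣≡p 0≤p))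
    ... | inj₂ p≤0 = ℚₚ.≤-trans p≤0 (ℚₚ.0≤∣p∣ p)

  regular-≤ : ∀ x m n → approx x m ≤ approx x n + ½^ m + ½^ n
  regular-≤ x m n = linear₁ (ℚₚ.≤-trans (p≤∣p∣ _) (regular x m n)) (regroup (approx x m) (approx x n) (½^ m) (½^ n))
    where
    regroup : ∀ a b u v → a + ((u + v) - (a - b)) ≡ b + u + v
    regroup = solve 4 (λ a b u v → a :+ ((u :+ v) :- (a :- b)) := b :+ u :+ v) refl

  private
    ½^-suc : ∀ i → ½^ i ≡ ½^ suc i + ½^ suc i
    ½^-suc i = sym (½+½ (½^ i))

  -- Regularity of x absorbs any fixed multiple of 2⁻ⁱ.
  Lower-tighten : ∀ x q → (∀ i → q ≤ approx x (suc i) + ι 4 * ½^ i) → Lower x q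
  -- The 5 is 4 from the hypothesis, 1/2 from regularity at `suc i`, and 1/2 of rounding.
  Lower-tighten x q h = lower λ j → archimedean 5 λ i →
    linear₃ (h i) (regular-≤ x (suc i) j) (0≤½^ (suc i))
      (trans (cong (λ u → q + ((approx x (suc i) + ι 4 * u) - q) + ((approx x j + ½^ suc i + ½^ j) - approx x (suc i)) + (½^ suc i - 0ℚ)) (½^-suc i))
        (trans (regroup q (approx x (suc i)) (approx x j) (½^ suc i) (½^ j)) (cong (λ u → approx x j + ½^ j + ι 5 * u) (sym (½^-suc i)))))
    where
    regroup : ∀ q a b u v → q + ((a + ι 4 * (u + u)) - q) + ((b + u + v) - a) + (u - 0ℚ) ≡ b + v + ι 5 * (u + u)
    regroup = solve 5 (λ q a b u v → q :+ ((a :+ con (ι 4) :* (u :+ u)) :- q) :+ ((b :+ u :+ v) :- a) :+ (u :- con 0ℚ)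
      := b :+ v :+ con (ι 5) :* (u :+ u)) refl

  Upper-tighten : ∀ x q → (∀ i → approx x (suc i) ≤ q + ι 4 * ½^ i) → Upper x q
  Upper-tighten x q h = upper λ j → archimedean 5 λ i →
    linear₃ (h i) (regular-≤ x j (suc i)) (0≤½^ (suc i))
      (trans (cong (λ u → approx x j + ((q + ι 4 * u) - approx x (suc i)) + ((approx x (suc i) + ½^ j + ½^ suc i) - approx x j) + (½^ suc i - 0ℚ)) (½^-suc i))
        (trans (regroup q (approx x (suc i)) (approx x j) (½^ suc i) (½^ j)) (cong (λ u → q + ½^ j + ι 5 * u) (sym (½^-suc i)))))
    where
    regroup : ∀ q a b u v → b + ((q + ι 4 * (u + u)) - a) + ((a + v + u) - b) + (u - 0ℚ) ≡ q + v + ι 5 * (u + u)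
    regroup = solve 5 (λ q a b u v → b :+ ((q :+ con (ι 4) :* (u :+ u)) :- a) :+ ((a :+ v :+ u) :- b) :+ (u :- con 0ℚ)
      := q :+ v :+ con (ι 5) :* (u :+ u)) refl

  Lower-Upper : ∀ x q r → Lower x q → Upper x r → q ≤ r
  Lower-Upper x q r lo up = archimedean 2 λ i → linear₂ (below lo i) (above up i) (regroup q r (approx x i) (½^ i))
    where
    regroup : ∀ q r a u → q + ((a + u) - q) + ((r + u) - a) ≡ r + ι 2 * u
    regroup = solve 4 (λ q r a u → q :+ ((a :+ u) :- q) :+ ((r :+ u) :- a) := r :+ con (ι 2) :* u) refl

  Lower-≤ : ∀ x {q r} → q ≤ r → Lower x r → Lower x q
  Lower-≤ x q≤r lo = lower λ i → ℚₚ.≤-trans q≤r (below lo i)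

  Upper-≤ : ∀ x {q r} → q ≤ r → Upper x q → Upper x r
  Upper-≤ x q≤r up = upper λ i → ℚₚ.≤-trans (above up i) (ℚₚ.+-monoˡ-≤ (½^ i) q≤r)

  ≤+½^ : ∀ q i → q ≤ q + ½^ i
  ≤+½^ q i = linear₁ (0≤½^ i) (solve 2 (λ q u → q :+ (u :- con 0ℚ) := q :+ u) refl q (½^ i))

  Lower-fromℚ : ∀ q → Lower (fromℚ q) q
  Lower-fromℚ q = lower (≤+½^ q)

  Upper-fromℚ : ∀ q → Upper (fromℚ q) q
  Upper-fromℚ q = upper (≤+½^ q)

  Lower-+ : ∀ x y q r → Lower x q → Lower y r → Lower (x ℝ.+ y) (q + r)
  Lower-+ x y q r lo lo′ = lower λ i → linear₂ (below lo (suc i)) (below lo′ (suc i))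
    (trans (regroup q r (approx x (suc i)) (approx y (suc i)) (½^ suc i))
      (cong (approx x (suc i) + approx y (suc i) +_) (½+½ (½^ i))))
    where
    regroup : ∀ q r a b u → q + r + ((a + u) - q) + ((b + u) - r) ≡ a + b + (u + u)
    regroup = solve 5 (λ q r a b u → q :+ r :+ ((a :+ u) :- q) :+ ((b :+ u) :- r) := a :+ b :+ (u :+ u)) refl

  Upper-+ : ∀ x y q r → Upper x q → Upper y r → Upper (x ℝ.+ y) (q + r)
  Upper-+ x y q r up up′ = upper λ i → linear₂ (above up (suc i)) (above up′ (suc i))
    (trans (regroup q r (approx x (suc i)) (approx y (suc i)) (½^ suc i)) (cong (q + r +_) (½+½ (½^ i))))
    where
    regroup : ∀ q r a b u → a + b + ((q + u) - a) + ((r + u) - b) ≡ q + r + (u + u)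
    regroup = solve 5 (λ q r a b u → a :+ b :+ ((q :+ u) :- a) :+ ((r :+ u) :- b) := q :+ r :+ (u :+ u)) refl

  module _ (x y : ℝ) (ε : ℚ) (close : ℝ.∣ x ℝ.- y ∣ ℝ.≤ fromℚ ε) where

    private
      a≤b+ε : ∀ i → approx x (suc i) ≤ approx y (suc i) + (ε + (½^ i + ½^ i))
      a≤b+ε i = linear₁ (ℚₚ.≤-trans (p≤∣p∣ _) (close i)) (regroup (approx x (suc i)) (approx y (suc i)) (ε + (½^ i + ½^ i)))
        where
        regroup : ∀ a b e → a + (e - (a - b)) ≡ b + e
        regroup = solve 3 (λ a b e → a :+ (e :- (a :- b)) := b :+ e) refl

      b≤a+ε : ∀ i → approx y (suc i) ≤ approx x (suc i) + (ε + (½^ i + ½^ i))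
      b≤a+ε i = linear₁ (ℚₚ.≤-trans (p≤∣p∣ _) (ℚₚ.≤-trans (ℚₚ.≤-reflexive (ℚₚ.∣-p∣≡∣p∣ (approx x (suc i) - approx y (suc i)))) (close i)))
        (regroup (approx x (suc i)) (approx y (suc i)) (ε + (½^ i + ½^ i)))
        where
        regroup : ∀ a b e → b + (e - ℚ.- (a - b)) ≡ a + e
        regroup = solve 3 (λ a b e → b :+ (e :- (:- (a :- b))) := a :+ e) refl

      slack : ∀ i → ½^ suc i ≤ ½^ i + ½^ i
      slack i = linear₂ (0≤½^ i) (0≤½^ (suc i)) (trans (cong (λ u → ½^ suc i + (½^ i - 0ℚ) + u) (regroup₁ (½^ suc i)))
        (trans (regroup (½^ suc i) (½^ i)) (cong (½^ i +_) (½+½ (½^ i)))))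
        where
        regroup₁ : ∀ u → u - 0ℚ ≡ u
        regroup₁ = solve 1 (λ u → u :- con 0ℚ := u) refl
        regroup : ∀ u v → u + (v - 0ℚ) + u ≡ v + (u + u)
        regroup = solve 2 (λ u v → u :+ (v :- con 0ℚ) :+ u := v :+ (u :+ u)) refl

    Lower-close : ∀ {q} → Lower x q → Lower y (q - ε)
    Lower-close {q} lo = Lower-tighten y (q - ε) λ i → linear₃ (below lo (suc i)) (a≤b+ε i) (slack i)
      (regroup q ε (approx x (suc i)) (approx y (suc i)) (½^ suc i) (½^ i))
      where
      regroup : ∀ q e a b u v → q - e + ((a + u) - q) + ((b + (e + (v + v))) - a) + ((v + v) - u) ≡ b + ι 4 * v
      regroup = solve 6 (λ q e a b u v → q :- e :+ ((a :+ u) :- q) :+ ((b :+ (e :+ (v :+ v))) :- a) :+ ((v :+ v) :- u) := b :+ con (ι 4) :* v) refl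

    Lower-close′ : ∀ {q} → Lower y q → Lower x (q - ε)
    Lower-close′ {q} lo = Lower-tighten x (q - ε) λ i → linear₃ (below lo (suc i)) (b≤a+ε i) (slack i)
      (regroup q ε (approx y (suc i)) (approx x (suc i)) (½^ suc i) (½^ i))
      where
      regroup : ∀ q e a b u v → q - e + ((a + u) - q) + ((b + (e + (v + v))) - a) + ((v + v) - u) ≡ b + ι 4 * v
      regroup = solve 6 (λ q e a b u v → q :- e :+ ((a :+ u) :- q) :+ ((b :+ (e :+ (v :+ v))) :- a) :+ ((v :+ v) :- u) := b :+ con (ι 4) :* v) refl

    Upper-close′ : ∀ {q} → Upper y q → Upper x (q + ε)
    Upper-close′ {q} up = Upper-tighten x (q + ε) λ i → linear₃ (above up (suc i)) (a≤b+ε i) (slack i)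
      (regroup q ε (approx x (suc i)) (approx y (suc i)) (½^ suc i) (½^ i))
      where
      regroup : ∀ q e a b u v → a + ((q + u) - b) + ((b + (e + (v + v))) - a) + ((v + v) - u) ≡ q + e + ι 4 * v
      regroup = solve 6 (λ q e a b u v → a :+ ((q :+ u) :- b) :+ ((b :+ (e :+ (v :+ v))) :- a) :+ ((v :+ v) :- u) := q :+ e :+ con (ι 4) :* v) refl

  Lower-mono : ∀ x y q → x ℝ.≤ y → Lower x q → Lower y q
  Lower-mono x y q x≤y lo = Lower-tighten y q λ i → linear₃ (below lo (suc i)) (x≤y (suc i)) (0≤* (0≤ι 5) (0≤½^ (suc i)))
    (trans (regroup q (a i) (b i) (½^ suc i)) (cong (λ u → b i + ι 4 * u) (½+½ (½^ i))))
    where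
    a b : ℕ → ℚ
    a i = approx x (suc i)
    b i = approx y (suc i)
    regroup : ∀ q a b u → q + ((a + u) - q) + ((b + (u + u)) - a) + (ι 5 * u - 0ℚ) ≡ b + ι 4 * (u + u)
    regroup = solve 4 (λ q a b u → q :+ ((a :+ u) :- q) :+ ((b :+ (u :+ u)) :- a) :+ (con (ι 5) :* u :- con 0ℚ)
      := b :+ con (ι 4) :* (u :+ u)) refl

open RationalBounds

-- Reciprocals, series, and integer approximations of computable reals.

module ComputableReals where

  open import Data.Fin.Patterns using (0F; 1F)
  open import Data.Integer as ℤ using (ℤ; _⊖_) renaming (+_ to pos)
  open import Data.Nat as ℕ using (ℕ; zero; suc; _∸_; _^_)
  import Data.Nat.DivMod as DivMod
  import Data.Nat.Properties as ℕₚ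
  open import Data.Product using (_,_; ∃-syntax)
  open import Data.Rational using (ℚ; _≤_; _+_; _-_; _*_; 0ℚ; 1ℚ)
  import Data.Rational as ℚ
  import Data.Rational.Properties as ℚₚ
  open import Data.Rational.Solver using (module +-*-Solver)
  open import Data.Sum using (_⊎_; inj₁; inj₂)
  open import Relation.Binary.PropositionalEquality hiding ([_])
  open import Relation.Nullary using (contradiction)
  open import Defs hiding (_<_; _≤_; _-_; -_; ∣_∣; _+_)
  open import Defs as ℝ using ()
  open +-*-Solver using (solve; _:+_; _:*_; _:-_; :-_; _:=_; con)

  private
    recip-inverse : ∀ p → (p ℚ.⊔ 1ℚ) * recip≥1 p ≡ 1ℚ
    recip-inverse p = ℚₚ.*-inverseʳ (p ℚ.⊔ 1ℚ)
      {{ℚₚ.pos⇒nonZero (p ℚ.⊔ 1ℚ) {{ℚ.positive (ℚₚ.<-≤-trans (ℚₚ.positive⁻¹ 1ℚ) (ℚₚ.p≤q⊔p p 1ℚ))}}}}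

    0≤recip : ∀ p → 0ℚ ≤ recip≥1 p
    0≤recip p with ℚₚ.≤-total 0ℚ (recip≥1 p)
    ... | inj₁ h = h
    ... | inj₂ h = contradiction
      (ℚₚ.<-≤-trans (ℚₚ.positive⁻¹ 1ℚ) (subst₂ _≤_ (recip-inverse p) (ℚₚ.*-zeroʳ (p ℚ.⊔ 1ℚ))
        (*-monoˡ {p ℚ.⊔ 1ℚ} {recip≥1 p} {0ℚ} (ℚₚ.≤-trans (ℚₚ.nonNegative⁻¹ 1ℚ) (ℚₚ.p≤q⊔p p 1ℚ)) h)))
      (ℚₚ.<-irrefl refl)

    recip≤1 : ∀ p → recip≥1 p ≤ 1ℚ
    recip≤1 p = subst₂ _≤_ (ℚₚ.*-identityˡ (recip≥1 p)) (recip-inverse p)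
      (*-monoʳ {recip≥1 p} {1ℚ} {p ℚ.⊔ 1ℚ} (0≤recip p) (ℚₚ.p≤q⊔p p 1ℚ))

    *-recip : ∀ q p → q * (p ℚ.⊔ 1ℚ) * recip≥1 p ≡ q
    *-recip q p = trans (ℚₚ.*-assoc q (p ℚ.⊔ 1ℚ) (recip≥1 p))
      (trans (cong (q *_) (recip-inverse p)) (ℚₚ.*-identityʳ q))

  -- The condition q ≤ 1 has two uses: it settles approximants below 1, which are inverted as 1, and
  -- it bounds the error q e of q times an approximant by e.
  Lower-recip : ∀ x x>1 {u q} → Upper x u → 0ℚ ≤ q → q ≤ 1ℚ → q * u ≤ 1ℚ → Lower (recip x x>1) q
  Lower-recip x x>1 {u} {q} up 0≤q q≤1 qu≤1 = lower go
    where
    go : ∀ i → q ≤ recip≥1 (approx x i) + ½^ i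
    go i = ℚₚ.≤-trans
      (subst (_≤ (1ℚ + e) * r) (*-recip q a) (*-monoʳ {r} {q * (a ℚ.⊔ 1ℚ)} {1ℚ + e} (0≤recip a) qX≤))
      (linear₁ (*-monoˡ {e} {r} {1ℚ} (0≤½^ i) (recip≤1 a)) (regroup e r))
      where
      a e r : ℚ
      a = approx x i
      e = ½^ i
      r = recip≥1 a
      qX≤ : q * (a ℚ.⊔ 1ℚ) ≤ 1ℚ + e
      qX≤ with ℚₚ.⊔-sel a 1ℚ
      ... | inj₁ eq = subst (λ X → q * X ≤ 1ℚ + e) (sym eq)
        (linear₃ (*-monoˡ {q} {a} {u + e} 0≤q (above up i)) qu≤1 (*-monoʳ {e} {q} {1ℚ} (0≤½^ i) q≤1) (regroup₁ q a u e))
        where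
        regroup₁ : ∀ q a u e → q * a + (q * (u + e) - q * a) + (1ℚ - q * u) + (1ℚ * e - q * e) ≡ 1ℚ + e
        regroup₁ = solve 4 (λ q a u e → q :* a :+ (q :* (u :+ e) :- q :* a) :+ (con 1ℚ :- q :* u) :+ (con 1ℚ :* e :- q :* e)
          := con 1ℚ :+ e) refl
      ... | inj₂ eq = subst (λ X → q * X ≤ 1ℚ + e) (sym eq)
        (linear₂ q≤1 (0≤½^ i) (regroup₂ q e))
        where
        regroup₂ : ∀ q e → q * 1ℚ + (1ℚ - q) + (e - 0ℚ) ≡ 1ℚ + e
        regroup₂ = solve 2 (λ q e → q :* con 1ℚ :+ (con 1ℚ :- q) :+ (e :- con 0ℚ) := con 1ℚ :+ e) refl
      regroup : ∀ e r → (1ℚ + e) * r + (e * 1ℚ - e * r) ≡ r + e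
      regroup = solve 2 (λ e r → (con 1ℚ :+ e) :* r :+ (e :* con 1ℚ :- e :* r) := r :+ e) refl

  -- If 1 ≤ q the bound is trivial, as only numbers at least 1 are inverted. Otherwise q ≤ 1, and
  -- the error q e caused by approximating x is at most e X.
  Upper-recip : ∀ x x>1 {v q} → Lower x v → 0ℚ ≤ q → 1ℚ ≤ q ⊎ 1ℚ ≤ q * v → Upper (recip x x>1) q
  Upper-recip x x>1 {v} {q} lo 0≤q large = upper go
    where
    go : ∀ i → recip≥1 (approx x i) ≤ q + ½^ i
    go i =
      subst₂ _≤_ (ℚₚ.*-identityˡ r) (*-recip (q + e) a)
        (*-monoʳ {r} {1ℚ} {(q + e) * X} (0≤recip a) (1≤ large))
      where
      a e r X : ℚ
      a = approx x i
      e = ½^ i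
      r = recip≥1 a
      X = a ℚ.⊔ 1ℚ
      1≤X : 1ℚ ≤ X
      1≤X = ℚₚ.p≤q⊔p a 1ℚ
      case₁ : 1ℚ ≤ q → 1ℚ ≤ (q + e) * X
      case₁ 1≤q = linear₂ (*-mono-≤ {1ℚ} {q} {1ℚ} {X} (ℚₚ.nonNegative⁻¹ 1ℚ) (ℚₚ.≤-trans (ℚₚ.nonNegative⁻¹ 1ℚ) 1≤X) 1≤q 1≤X)
        (0≤* {e} {X} (0≤½^ i) (ℚₚ.≤-trans (ℚₚ.nonNegative⁻¹ 1ℚ) 1≤X)) (regroup q e X)
        where
        regroup : ∀ q e X → 1ℚ + (q * X - 1ℚ * 1ℚ) + (e * X - 0ℚ) ≡ (q + e) * X
        regroup = solve 3 (λ q e X → con 1ℚ :+ (q :* X :- con 1ℚ :* con 1ℚ) :+ (e :* X :- con 0ℚ) := (q :+ e) :* X) refl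
      1≤ : 1ℚ ≤ q ⊎ 1ℚ ≤ q * v → 1ℚ ≤ (q + e) * X
      1≤ large with large | ℚₚ.≤-total 1ℚ q
      ... | inj₁ 1≤q | _ = case₁ 1≤q
      ... | inj₂ _ | inj₁ 1≤q = case₁ 1≤q
      ... | inj₂ 1≤qv | inj₂ q≤1 = linear₃ 1≤qv
        (*-monoˡ {q} {v} {X + e} 0≤q (ℚₚ.≤-trans (below lo i) (ℚₚ.+-monoˡ-≤ e (ℚₚ.p≤p⊔q a 1ℚ))))
        (*-mono-≤ {q} {1ℚ} {e} {e * X} 0≤q (0≤* (0≤½^ i) (ℚₚ.≤-trans (ℚₚ.nonNegative⁻¹ 1ℚ) 1≤X)) q≤1
          (subst (_≤ e * X) (ℚₚ.*-identityʳ e) (*-monoˡ {e} {1ℚ} {X} (0≤½^ i) 1≤X)))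
        (regroup q e X v)
        where
        regroup : ∀ q e X v → 1ℚ + (q * v - 1ℚ) + (q * (X + e) - q * v) + (1ℚ * (e * X) - q * e) ≡ (q + e) * X
        regroup = solve 4 (λ q e X v → con 1ℚ :+ (q :* v :- con 1ℚ) :+ (q :* (X :+ e) :- q :* v) :+ (con 1ℚ :* (e :* X) :- q :* e)
          := (q :+ e) :* X) refl

  abstract
    ι0* : ∀ c → ι 0 * c ≡ 0ℚ
    ι0* = ℚₚ.*-zeroˡ

    ι-suc-∑ : ∀ f n c → ι (∑< n f) * c + ι (f n) * c ≡ ι (∑< (suc n) f) * c
    ι-suc-∑ f n c = trans (sym (ℚₚ.*-distribʳ-+ c (ι (∑< n f)) (ι (f n)))) (cong (_* c) (sym (ι-+ (∑< n f) (f n))))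

  Lower-∑ : ∀ (a : ℕ → ℝ) f c → (∀ n → Lower (a n) (ι (f n) * c)) → ∀ n → Lower (partialSum a n) (ι (∑< n f) * c)
  Lower-∑ a f c lo zero = subst (Lower 0ℝ) (sym (ι0* c)) (Lower-fromℚ (ι 0))
  Lower-∑ a f c lo (suc n) = subst (Lower (partialSum a (suc n))) (ι-suc-∑ f n c)
    (Lower-+ (partialSum a n) (a n) (ι (∑< n f) * c) (ι (f n) * c) (Lower-∑ a f c lo n) (lo n))

  Upper-∑ : ∀ (a : ℕ → ℝ) f c → (∀ n → Upper (a n) (ι (f n) * c)) → ∀ n → Upper (partialSum a n) (ι (∑< n f) * c)
  Upper-∑ a f c up zero = subst (Upper 0ℝ) (sym (ι0* c)) (Upper-fromℚ (ι 0))
  Upper-∑ a f c up (suc n) = subst (Upper (partialSum a (suc n))) (ι-suc-∑ f n c)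
    (Upper-+ (partialSum a n) (a n) (ι (∑< n f) * c) (ι (f n) * c) (Upper-∑ a f c up n) (up n))

  -- Nonnegative terms pass a lower bound on to all later partial sums, and those come within 2^(-k)
  -- of the limit.
  Lower-limit : ∀ (a : ℕ → ℝ) s → (∀ n → Lower (a n) 0ℚ) → partialSum a ⟶ s → ∀ m q → Lower (partialSum a m) q → Lower s q
  Lower-limit a s nonneg lim m q lo = lower λ i → archimedean 1 λ k →
    let N , close = lim k
        lo′ = Lower-close (partialSum a (m ℕ.+ N)) s (½^ k) (close (m ℕ.+ N) (ℕₚ.m≤n+m N m)) (later N)
    in linear₁ (below lo′ i) (regroup q (approx s i + ½^ i) (½^ k))
    where
    later : ∀ j → Lower (partialSum a (m ℕ.+ j)) q
    later zero    = subst (λ n → Lower (partialSum a n) q) (sym (ℕₚ.+-identityʳ m)) lo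
    later (suc j) = subst (λ n → Lower (partialSum a n) q) (sym (ℕₚ.+-suc m j))
      (subst (Lower (partialSum a (suc (m ℕ.+ j)))) (ℚₚ.+-identityʳ q) (Lower-+ (partialSum a (m ℕ.+ j)) (a (m ℕ.+ j)) q 0ℚ (later j) (nonneg (m ℕ.+ j))))
    regroup : ∀ q x e → q + (x - (q - e)) ≡ x + 1ℚ * e
    regroup = solve 3 (λ q x e → q :+ (x :- (q :- e)) := x :+ con 1ℚ :* e) refl

  Lower->1 : ∀ x → 1ℝ ℝ.< x → Lower x 1ℚ
  Lower->1 x (m , h) = lower λ i → linear₃ (ℚₚ.<⇒≤ h) (regular-≤ x m i) (0≤½^ m) (regroup (½^ m) (approx x m) (approx x i) (½^ i))
    where
    regroup : ∀ u a b e → 1ℚ + (a - (1ℚ + (u + u))) + ((b + u + e) - a) + (u - 0ℚ) ≡ b + e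
    regroup = solve 4 (λ u a b e → con 1ℚ :+ (a :- (con 1ℚ :+ (u :+ u))) :+ ((b :+ u :+ e) :- a) :+ (u :- con 0ℚ) := b :+ e) refl

  Lower⇒< : ∀ x n → Lower x (ι (suc n)) → fromℕ n ℝ.< x
  -- At index 2 the error is 1/4, and n + 1/4 + 1/4 is below n + 1 - 1/4.
  Lower⇒< x n lo = 2 , ℚₚ.<-≤-trans
    (ℚₚ.+-monoʳ-< (ι n) {½^ 2 + ½^ 2} {ι 1 - ½^ 2} (ℚ.*<* (ℤ.+<+ (ℕₚ.m≤m+n 5 1))))
    (linear₁ (below lo 2) (trans (cong (λ z → ι n + (ι 1 - ½^ 2) + ((approx x 2 + ½^ 2) - z)) (ι-+ 1 n)) (regroup (ι n) (½^ 2) (approx x 2))))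
    where
    regroup : ∀ n e a → n + (ι 1 - e) + ((a + e) - (ι 1 + n)) ≡ a
    regroup = solve 3 (λ n e a → n :+ (con (ι 1) :- e) :+ ((a :+ e) :- (con (ι 1) :+ n)) := a) refl

  -- Integer approximations: 2ᵏ f(n) lies between A n k ∸ 3 and A n k.
  module Approximation {f : ℕ → ℝ} (fc : UniformlyComputable f) where
    open UniformlyComputable fc

    private
      u d : ℕ → ℕ → ℕ
      -- Negative approximations are cut off at 0; for the bound from below, `Lower-A` therefore
      -- asks that the real be nonnegative.
      u n k = num⁺ n k ∸ num⁻ n k
      d n k = den-1 n k

      q : ℕ → ℕ → ℚ
      q n k = (num⁺ n k ⊖ num⁻ n k) ℚ./ suc (d n k)

      F : ℕ → ℕ → ℕ
      F n k = (2 ^ k ℕ.* u n k) ℕ./ suc (d n k)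

    A : ℕ → ℕ → ℕ
    -- From above, rounding down and the approximation error cost one unit each. From below only the
    -- error counts, which gives F - 1, that is A - 3.
    A n k = 2 ℕ.+ F n k

    Aᵣ : ∀ {O} {X : O → ℕ → ℕ} {m} {g h : Env m → ℕ} → Rec X g → Rec X h → Rec X (λ ρ → A (g ρ) (h ρ))
    Aᵣ {X = X} = ap₂ {f = λ ρ → A (look 0F ρ) (look 1F ρ)} (lit 2 +ᵣ
      (lit 2 ^ᵣ var 1F *ᵣ (use num⁺ num⁺-recursive ∸ᵣ use num⁻ num⁻-recursive)) /ᵣ use den-1 den-1-recursive)
      where
      use : ∀ h → Recursive₂ h → Rec X {2} (λ ρ → h (look 0F ρ) (look 1F ρ))
      use h (e , run) = rec-code {X₀ = none} e λ ρ → run (look 0F ρ) (look 1F ρ)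

    private
      scaled : ∀ n k → (q n k * ι (suc (d n k)) + ι (num⁻ n k)) ≡ ι (num⁺ n k)
      scaled n k = trans (cong (_+ ι (num⁻ n k)) (/-* (num⁺ n k ⊖ num⁻ n k) (d n k))) (⊖/1 (num⁺ n k) (num⁻ n k))

      scale : ∀ a n k → a * ½^ k * (ι (suc (d n k)) * ι (2 ^ k)) ≡ a * ι (suc (d n k))
      scale a n k = trans (regroup a (½^ k) (ι (suc (d n k))) (ι (2 ^ k)))
        (trans (cong (a * ι (suc (d n k)) *_) (½^-2^ k)) (ℚₚ.*-identityʳ _))
        where
        regroup : ∀ a e d w → a * e * (d * w) ≡ a * d * (e * w)
        regroup = solve 4 (λ a e d w → a :* e :* (d :* w) := a :* d :* (e :* w)) refl

      pos-scale : ∀ n k → ℚ.Positive (ι (suc (d n k)) * ι (2 ^ k))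
      pos-scale n k = subst ℚ.Positive (ι-* (suc (d n k)) (2 ^ k))
        (ι-pos (suc (d n k) ℕ.* 2 ^ k) {{ℕₚ.m*n≢0 (suc (d n k)) (2 ^ k) {{_}} {{ℕₚ.m^n≢0 2 k}}}})

      q≤ : ∀ n k → q n k ≤ ι (suc (F n k)) * ½^ k
      q≤ n k = *-cancelʳ {ι (suc (d n k)) * ι (2 ^ k)} {q n k} {ι (suc (F n k)) * ½^ k} (pos-scale n k)
        (subst (q n k * (ι (suc (d n k)) * ι (2 ^ k)) ≤_) (sym (scale (ι (suc (F n k))) n k))
          (ℚₚ.≤-trans
            (subst (_≤ ι (u n k) * ι (2 ^ k)) (ℚₚ.*-assoc (q n k) (ι (suc (d n k))) (ι (2 ^ k)))
              (*-monoʳ {ι (2 ^ k)} {q n k * ι (suc (d n k))} {ι (u n k)} (0≤ι (2 ^ k)) qd≤u))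
            (subst₂ _≤_ (trans (cong ι (ℕₚ.*-comm (2 ^ k) (u n k))) (ι-* (u n k) (2 ^ k))) (ι-* (suc (F n k)) (suc (d n k)))
              (ι-mono (ℕₚ.<⇒≤ (m<suc[m/n]*n (2 ^ k ℕ.* u n k) (suc (d n k))))))))
        where
        qd≤u : q n k * ι (suc (d n k)) ≤ ι (u n k)
        qd≤u = linear₁ (ℚₚ.≤-trans (ι-mono (ℕₚ.m≤n+m∸n (num⁺ n k) (num⁻ n k))) (ℚₚ.≤-reflexive (ι-+ (num⁻ n k) (u n k))))
          (trans (cong (λ z → q n k * ι (suc (d n k)) + ((ι (num⁻ n k) + ι (u n k)) - z)) (sym (scaled n k)))
            (regroup (q n k * ι (suc (d n k))) (ι (num⁻ n k)) (ι (u n k))))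
          where
          regroup : ∀ a b c → a + ((b + c) - (a + b)) ≡ c
          regroup = solve 3 (λ a b c → a :+ ((b :+ c) :- (a :+ b)) := c) refl

      ≤q : ∀ n k {F′} → F n k ≡ suc F′ → ι (suc F′) * ½^ k ≤ q n k
      ≤q n k {F′} eq = *-cancelʳ {ι (suc (d n k)) * ι (2 ^ k)} {ι (suc F′) * ½^ k} {q n k} (pos-scale n k)
        (subst (_≤ q n k * (ι (suc (d n k)) * ι (2 ^ k))) (sym (scale (ι (suc F′)) n k))
          (ℚₚ.≤-trans
            (subst₂ _≤_ (ι-* (suc F′) (suc (d n k))) (trans (cong ι (ℕₚ.*-comm (2 ^ k) (u n k))) (ι-* (u n k) (2 ^ k)))
              (ι-mono (subst (λ F → F ℕ.* suc (d n k) ℕ.≤ 2 ^ k ℕ.* u n k) eq (DivMod.m/n*n≤m (2 ^ k ℕ.* u n k) (suc (d n k))))))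
            (subst (ι (u n k) * ι (2 ^ k) ≤_) (ℚₚ.*-assoc (q n k) (ι (suc (d n k))) (ι (2 ^ k)))
              (*-monoʳ {ι (2 ^ k)} {ι (u n k)} {q n k * ι (suc (d n k))} (0≤ι (2 ^ k)) (ℚₚ.≤-reflexive u≡qd)))))
        where
        num⁻≤num⁺ : num⁻ n k ℕ.≤ num⁺ n k
        num⁻≤num⁺ with ℕₚ.≤-total (num⁻ n k) (num⁺ n k)
        ... | inj₁ h = h
        ... | inj₂ h = contradiction (trans (sym eq)
          (trans (cong (λ u → (2 ^ k ℕ.* u) ℕ./ suc (d n k)) (ℕₚ.m≤n⇒m∸n≡0 h))
            (trans (cong (ℕ._/ suc (d n k)) (ℕₚ.*-zeroʳ (2 ^ k))) (DivMod.0/n≡0 (suc (d n k)))))) λ ()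
        u≡qd : ι (u n k) ≡ q n k * ι (suc (d n k))
        u≡qd = trans (trans (regroup₁ (ι (u n k)) (ι (num⁻ n k))) (cong (_- ι (num⁻ n k)) (trans
          (trans (sym (ι-+ (u n k) (num⁻ n k))) (cong ι (ℕₚ.m∸n+n≡m num⁻≤num⁺))) (sym (scaled n k)))))
          (sym (regroup₁ (q n k * ι (suc (d n k))) (ι (num⁻ n k))))
          where
          regroup₁ : ∀ a b → a ≡ a + b - b
          regroup₁ = solve 2 (λ a b → a := a :+ b :- b) refl

    Upper-A : ∀ n k → Upper (f n) (ι (A n k) * ½^ k)
    Upper-A n k = Upper-≤ (f n) (linear₁ (q≤ n k) (trans (regroup (q n k) (½^ k) (ι (suc (F n k))))
      (cong (_* ½^ k) (sym (ι-+ 1 (suc (F n k))))))) (Upper-close′ (f n) (fromℚ (q n k)) (½^ k) (approximates n k) (Upper-fromℚ (q n k)))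
      where
      regroup : ∀ q e F → q + e + (F * e - q) ≡ (ι 1 + F) * e
      regroup = solve 3 (λ q e F → q :+ e :+ (F :* e :- q) := (con (ι 1) :+ F) :* e) refl

    Lower-A : ∀ n k → Lower (f n) 0ℚ → Lower (f n) (ι (A n k ∸ 3) * ½^ k)
    Lower-A n k nonneg with F n k in eq
    ... | zero   = Lower-≤ (f n) (ℚₚ.≤-reflexive (ℚₚ.*-zeroˡ (½^ k))) nonneg
    ... | suc F′ = Lower-≤ (f n) (linear₁ (≤q n k eq) (trans (cong (λ z → ι F′ * ½^ k + (q n k - z * ½^ k)) (ι-+ 1 F′))
      (regroup (q n k) (½^ k) (ι F′)))) (Lower-close′ (f n) (fromℚ (q n k)) (½^ k) (approximates n k) (Lower-fromℚ (q n k)))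
      where
      regroup : ∀ q e F → F * e + (q - (ι 1 + F) * e) ≡ q - e
      regroup = solve 3 (λ q e F → F :* e :+ (q :- (con (ι 1) :+ F) :* e) := q :- e) refl

open ComputableReals

-- Block lengths, the tails of the series, and a recursive modulus of convergence.

module Growth where

  open import Data.Fin.Patterns using (0F; 1F; 2F)
  open import Data.Nat as ℕ using (ℕ; zero; suc; _∸_; _^_; z≤n; s≤s)
  import Data.Nat.DivMod as DivMod
  import Data.Nat.Properties as ℕₚ
  open import Data.Nat.Tactic.RingSolver using (solve-∀)
  open import Data.Product using (_,_; proj₁; proj₂; ∃-syntax)
  open import Data.Rational using (ℚ; _≤_; _+_; _-_; _*_; 0ℚ; 1ℚ)
  import Data.Rational as ℚ
  import Data.Rational.Properties as ℚₚ
  open import Data.Rational.Solver using (module +-*-Solver)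
  open import Data.Sum using (_⊎_; inj₁; inj₂; [_,_]′)
  open import Data.Unit using (tt)
  open import Relation.Binary.PropositionalEquality hiding ([_])
  open import Relation.Nullary using (contradiction)
  open import Defs hiding (_<_; _≤_; _-_; -_; ∣_∣; _+_; K)
  open import Defs as ℝ using ()
  open +-*-Solver using (solve; _:+_; _:*_; _:-_; :-_; _:=_; con)

  private
    lg-exists : ∀ (ρ : Env 1) → ∃[ q ] suc (look 0F ρ) ∸ 2 ^ suc q ≡ 0
    lg-exists ρ = n , ℕₚ.m≤n⇒m∸n≡0 (ℕₚ.≤-trans (s≤s (n≤2^n n)) (ℕₚ.^-monoʳ-< 2 (s≤s (s≤s z≤n)) (ℕₚ.n<1+n n)))
      where n = look 0F ρ

  abstract
    -- The binary logarithm rounded down, with value 0 at 0.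
    lg : ℕ → ℕ
    lg n = proj₁ (leastZero (λ q → suc n ∸ 2 ^ suc q) (lg-exists (n , tt)))

    <2^lg : ∀ n → n ℕ.< 2 ^ suc (lg n)
    <2^lg n = ℕₚ.m∸n≡0⇒m≤n (proj₁ (proj₂ (leastZero (λ q → suc n ∸ 2 ^ suc q) (lg-exists (n , tt)))))

    2^lg≤ : ∀ n {q} → lg n ≡ suc q → 2 ^ suc q ℕ.≤ n
    2^lg≤ n {q} eq = ℕₚ.≮⇒≥ λ n< →
      proj₂ (proj₂ (leastZero (λ q → suc n ∸ 2 ^ suc q) (lg-exists (n , tt)))) q
        (ℕₚ.≤-reflexive (sym eq)) (ℕₚ.m≤n⇒m∸n≡0 n<)

    lgᵣ : ∀ {O} {X : O → ℕ → ℕ} {m} {f : Env m → ℕ} → Rec X f → Rec X (λ ρ → lg (f ρ))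
    lgᵣ = ap₁ {f = λ ρ → lg (look 0F ρ)} (rec-leastZero (sucᵣ (var 1F) ∸ᵣ lit 2 ^ᵣ sucᵣ (var 0F)) lg-exists)

  ∑-mono-≤ : ∀ f {m n} → m ℕ.≤ n → ∑< m f ℕ.≤ ∑< n f
  ∑-mono-≤ f {m} {n} m≤n with ℕₚ.m≤n⇒m<n∨m≡n m≤n
  ... | inj₂ refl = ℕₚ.≤-refl
  ∑-mono-≤ f {m} {suc n} m≤n | inj₁ (s≤s m≤n′) = ℕₚ.≤-trans (∑-mono-≤ f m≤n′) (ℕₚ.m≤m+n _ (f n))

  ∑-cong : ∀ {f g : ℕ → ℕ} n → (∀ i → i ℕ.< n → f i ≡ g i) → ∑< n f ≡ ∑< n g
  ∑-cong zero    eq = refl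
  ∑-cong (suc n) eq = cong₂ ℕ._+_ (∑-cong n λ i i<n → eq i (ℕₚ.m<n⇒m<1+n i<n)) (eq n ℕₚ.≤-refl)

  ∑-* : ∀ c f n → ∑< n (λ i → c ℕ.* f i) ≡ c ℕ.* ∑< n f
  ∑-* c f zero    = sym (ℕₚ.*-zeroʳ c)
  ∑-* c f (suc n) = trans (cong (ℕ._+ c ℕ.* f n) (∑-* c f n)) (sym (ℕₚ.*-distribˡ-+ c (∑< n f) (f n)))

  ∑-+const : ∀ c f n → ∑< n (λ i → c ℕ.+ f i) ≡ n ℕ.* c ℕ.+ ∑< n f
  ∑-+const c f zero    = refl
  ∑-+const c f (suc n) = trans (cong (ℕ._+ (c ℕ.+ f n)) (∑-+const c f n)) (regroup (n ℕ.* c) (∑< n f) c (f n))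
    where
    regroup : ∀ a b c d → a ℕ.+ b ℕ.+ (c ℕ.+ d) ≡ c ℕ.+ a ℕ.+ (b ℕ.+ d)
    regroup = solve-∀

  module FastGrowth (p : ℕ → ℝ) (p>1 : ∀ n → 1ℝ ℝ.< p n) (fast : FastGrowing p p>1)
    (sum-computable : Computable (FastGrowing.sum fast)) where

    open FastGrowing fast
    open OrderFunction orderFunction
    private
      module P = Approximation computable
      module S = Approximation sum-computable

      1≤p : ∀ n → Lower (p n) 1ℚ
      1≤p n = Lower->1 (p n) (p>1 n)

      0≤p : ∀ n → Lower (p n) 0ℚ
      0≤p n = Lower-≤ (p n) (ℚₚ.nonNegative⁻¹ 1ℚ) (1≤p n)

      1/p : ℕ → ℝ
      1/p n = recip (p n) (p>1 n)

      0≤1/p : ∀ n → Lower (1/p n) 0ℚ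
      0≤1/p n = Lower-recip (p n) (p>1 n) {ι (P.A n 0) * ½^ 0} {0ℚ} (P.Upper-A n 0) ℚₚ.≤-refl (ℚₚ.nonNegative⁻¹ 1ℚ)
        (ℚₚ.≤-trans (ℚₚ.≤-reflexive (ℚₚ.*-zeroˡ (ι (P.A n 0) * ½^ 0))) (ℚₚ.nonNegative⁻¹ 1ℚ))

      ∑≤sum : ∀ m q → Lower (partialSum 1/p m) q → Lower sum q
      ∑≤sum = Lower-limit 1/p sum 0≤1/p sum-converges

      0≤sum : Lower sum 0ℚ
      0≤sum = ∑≤sum 0 0ℚ (Lower-fromℚ 0ℚ)

      -- A n 0 exceeds p(n) by at most 3. Lowering its logarithm by 2 makes up for that, so 2^l₀ ≤
      -- p(n) ≤ 2^(3 + l₀).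
      l₀ : ℕ → ℕ
      l₀ n = lg (P.A n 0) ∸ 2

      Lower-l₀ : ∀ n → Lower (p n) (ι (2 ^ l₀ n))
      Lower-l₀ n with lg (P.A n 0) ∸ 2 in eq
      ... | zero  = 1≤p n
      ... | suc q = Lower-≤ (p n)
        (ℚₚ.≤-trans (ι-mono {2 ^ suc q} {P.A n 0 ∸ 3} bound) (ℚₚ.≤-reflexive (sym (ℚₚ.*-identityʳ (ι (P.A n 0 ∸ 3))))))
        (P.Lower-A n 0 (0≤p n))
        where
        lg≡ : lg (P.A n 0) ≡ suc (suc (suc q))
        lg≡ = trans (sym (ℕₚ.m+[n∸m]≡n {2} (ℕₚ.<⇒≤ (ℕₚ.m∸n≢0⇒n<m {lg (P.A n 0)} {2} λ z → contradiction (trans (sym eq) z) λ ()))))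
          (cong (2 ℕ.+_) eq)
        bound : 2 ^ suc q ℕ.≤ P.A n 0 ∸ 3
        bound = ℕₚ.m+n≤o⇒m≤o∸n (2 ^ suc q) (begin
          2 ^ suc q ℕ.+ 3              ≤⟨ ℕₚ.+-monoʳ-≤ (2 ^ suc q) (ℕₚ.*-monoʳ-≤ 3 (ℕₚ.m^n>0 2 (suc q))) ⟩
          2 ^ suc q ℕ.+ 3 ℕ.* 2 ^ suc q ≡⟨ regroup (2 ^ suc q) ⟩
          2 ^ suc (suc (suc q))        ≤⟨ 2^lg≤ (P.A n 0) lg≡ ⟩
          P.A n 0                      ∎)
          where
          open ℕₚ.≤-Reasoning
          regroup : ∀ x → x ℕ.+ 3 ℕ.* x ≡ 2 ℕ.* (2 ℕ.* x)
          regroup = solve-∀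

      Upper-l₀ : ∀ n → Upper (p n) (ι (2 ^ (3 ℕ.+ l₀ n)))
      Upper-l₀ n = Upper-≤ (p n)
        (ℚₚ.≤-trans (ℚₚ.≤-reflexive (ℚₚ.*-identityʳ (ι (P.A n 0)))) (ι-mono {P.A n 0} {2 ^ (3 ℕ.+ l₀ n)}
          (ℕₚ.≤-trans (ℕₚ.<⇒≤ (<2^lg (P.A n 0))) (ℕₚ.^-monoʳ-≤ 2 (s≤s (ℕₚ.m≤n+m∸n (lg (P.A n 0)) 2))))))
        (P.Upper-A n 0)

    -- The running maximum of `l₀`, which rounding may leave non-monotone. The bound 2^l ≤ p
    -- survives because p is nondecreasing; monotone lengths are what keeps `C` integral.
    l : ℕ → ℕ
    l zero    = l₀ 0
    l (suc n) = l n ℕ.+ (l₀ (suc n) ∸ l n)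

    l-suc : ∀ n → l n ℕ.≤ l (suc n)
    l-suc n = ℕₚ.m≤m+n (l n) (l₀ (suc n) ∸ l n)

    l-mono : ∀ {m n} → m ℕ.≤ n → l m ℕ.≤ l n
    l-mono {m} {n} m≤n with ℕₚ.m≤n⇒m<n∨m≡n m≤n
    ... | inj₂ refl = ℕₚ.≤-refl
    l-mono {m} {suc n} m≤n | inj₁ (s≤s m≤n′) = ℕₚ.≤-trans (l-mono m≤n′) (l-suc n)

    Lower-l : ∀ n → Lower (p n) (ι (2 ^ l n))
    Lower-l zero = Lower-l₀ 0
    Lower-l (suc n) = [ larger , smaller ]′ (ℕₚ.≤-total (l n) (l₀ (suc n)))
      where
      larger : l n ℕ.≤ l₀ (suc n) → Lower (p (suc n)) (ι (2 ^ l (suc n)))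
      larger h = subst (λ k → Lower (p (suc n)) (ι (2 ^ k))) (sym (ℕₚ.m+[n∸m]≡n h)) (Lower-l₀ (suc n))
      smaller : l₀ (suc n) ℕ.≤ l n → Lower (p (suc n)) (ι (2 ^ l (suc n)))
      smaller h = subst (λ k → Lower (p (suc n)) (ι (2 ^ k)))
        (sym (trans (cong (l n ℕ.+_) (ℕₚ.m≤n⇒m∸n≡0 h)) (ℕₚ.+-identityʳ (l n))))
        (Lower-mono (p n) (p (suc n)) (ι (2 ^ l n)) (nondecreasing n (suc n) (ℕₚ.n≤1+n n)) (Lower-l n))

    private
      l₀≤l : ∀ n → l₀ n ℕ.≤ l n
      l₀≤l zero    = ℕₚ.≤-refl
      l₀≤l (suc n) = ℕₚ.m≤n+m∸n (l₀ (suc n)) (l n)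

      Lower-1/p : ∀ n → Lower (1/p n) (½^ (3 ℕ.+ l n))
      Lower-1/p n = Lower-recip (p n) (p>1 n) {ι (2 ^ (3 ℕ.+ l n))} {½^ (3 ℕ.+ l n)}
        (Upper-≤ (p n) (ι-mono {2 ^ (3 ℕ.+ l₀ n)} {2 ^ (3 ℕ.+ l n)} (ℕₚ.^-monoʳ-≤ 2 (ℕₚ.+-monoʳ-≤ 3 (l₀≤l n)))) (Upper-l₀ n))
        (0≤½^ (3 ℕ.+ l n)) (½^≤1 (3 ℕ.+ l n)) (ℚₚ.≤-reflexive (½^-2^ (3 ℕ.+ l n)))

    lᵣ : ∀ {O} {X : O → ℕ → ℕ} {m} {f : Env m → ℕ} → Rec X f → Rec X (λ ρ → l (f ρ))
    lᵣ {X = X} = ap₁ {f = λ ρ → l (look 0F ρ)} (rec-ext (rec-prim (l₀ᵣ (lit 0)) (var 1F +ᵣ (l₀ᵣ (sucᵣ (var 0F)) ∸ᵣ var 1F)))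
      λ ρ → go (look 0F ρ))
      where
      l₀ᵣ : ∀ {m} {f : Env m → ℕ} → Rec X f → Rec X (λ ρ → l₀ (f ρ))
      l₀ᵣ r = lgᵣ (P.Aᵣ r (lit 0)) ∸ᵣ lit 2

      go : ∀ k → primrec {0} (λ _ → l₀ 0) (λ σ → look 1F σ ℕ.+ (l₀ (suc (look 0F σ)) ∸ look 1F σ)) k tt ≡ l k
      go zero    = refl
      go (suc k) = cong (λ x → x ℕ.+ (l₀ (suc k) ∸ x)) (go k)

    private
      ½^-units : ∀ a b m n → ι a * ½^ m * (ι b * ½^ n) * (ι (2 ^ m) * ι (2 ^ n)) ≡ ι (a ℕ.* b)
      ½^-units a b m n = trans (regroup (ι a) (ι b) (½^ m) (½^ n) (ι (2 ^ m)) (ι (2 ^ n)))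
        (trans (cong₂ (λ x y → ι a * ι b * (x * y)) (½^-2^ m) (½^-2^ n))
          (trans (ℚₚ.*-identityʳ (ι a * ι b)) (sym (ι-* a b))))
        where
        regroup : ∀ a b e f x y → a * e * (b * f) * (x * y) ≡ a * b * ((e * x) * (f * y))
        regroup = solve 6 (λ a b e f x y → a :* e :* (b :* f) :* (x :* y) := a :* b :* ((e :* x) :* (f :* y))) refl

      2^-pos : ∀ m n → ℚ.Positive (ι (2 ^ m) * ι (2 ^ n))
      2^-pos m n = subst ℚ.Positive (ι-* (2 ^ m) (2 ^ n))
        (ι-pos (2 ^ m ℕ.* 2 ^ n) {{ℕₚ.m*n≢0 (2 ^ m) (2 ^ n) {{ℕₚ.m^n≢0 2 m}} {{ℕₚ.m^n≢0 2 n}}}})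

      units≤1 : ∀ a b w → a ℕ.* b ℕ.≤ 2 ^ w ℕ.* 2 ^ w → ι a * ½^ w * (ι b * ½^ w) ≤ 1ℚ
      units≤1 a b w h = *-cancelʳ {ι (2 ^ w) * ι (2 ^ w)} {ι a * ½^ w * (ι b * ½^ w)} {1ℚ} (2^-pos w w)
        (subst₂ _≤_ (sym (½^-units a b w w)) (trans (ι-* (2 ^ w) (2 ^ w)) (sym (ℚₚ.*-identityˡ _)))
          (ι-mono {a ℕ.* b} {2 ^ w ℕ.* 2 ^ w} h))

      1≤units : ∀ a b w → 2 ^ w ℕ.* 2 ^ w ℕ.≤ a ℕ.* b → 1ℚ ≤ ι a * ½^ w * (ι b * ½^ w)
      1≤units a b w h = *-cancelʳ {ι (2 ^ w) * ι (2 ^ w)} {1ℚ} {ι a * ½^ w * (ι b * ½^ w)} (2^-pos w w)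
        (subst₂ _≤_ (trans (ι-* (2 ^ w) (2 ^ w)) (sym (ℚₚ.*-identityˡ _))) (sym (½^-units a b w w))
          (ι-mono {2 ^ w ℕ.* 2 ^ w} {a ℕ.* b} h))

      cross : ∀ a b m n → ι a * ½^ m ≤ ι b * ½^ n → a ℕ.* 2 ^ n ℕ.≤ b ℕ.* 2 ^ m
      cross a b m n h = ι-cancel {a ℕ.* 2 ^ n} {b ℕ.* 2 ^ m} (subst₂ _≤_
        (trans (regroup₁ (ι a) (½^ m) (ι (2 ^ m)) (ι (2 ^ n))) (trans (cong (ι a * ι (2 ^ n) *_) (½^-2^ m)) (trans (ℚₚ.*-identityʳ _) (sym (ι-* a (2 ^ n))))))
        (trans (regroup₂ (ι b) (½^ n) (ι (2 ^ m)) (ι (2 ^ n))) (trans (cong (ι b * ι (2 ^ m) *_) (½^-2^ n)) (trans (ℚₚ.*-identityʳ _) (sym (ι-* b (2 ^ m))))))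
        (*-monoʳ {ι (2 ^ m) * ι (2 ^ n)} {ι a * ½^ m} {ι b * ½^ n} (0≤* {ι (2 ^ m)} {ι (2 ^ n)} (0≤ι (2 ^ m)) (0≤ι (2 ^ n))) h))
        where
        regroup₁ : ∀ a e x y → a * e * (x * y) ≡ a * y * (e * x)
        regroup₁ = solve 4 (λ a e x y → a :* e :* (x :* y) := a :* y :* (e :* x)) refl
        regroup₂ : ∀ a e x y → a * e * (x * y) ≡ a * x * (e * y)
        regroup₂ = solve 4 (λ a e x y → a :* e :* (x :* y) := a :* x :* (e :* y)) refl

      1≤½^-2^ : ∀ a w → 1ℚ ≤ ι a * ½^ w → 2 ^ w ℕ.≤ a
      1≤½^-2^ a w h = subst₂ ℕ._≤_ (ℕₚ.+-identityʳ (2 ^ w)) (ℕₚ.*-identityʳ a) (cross 1 a 0 w h)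

      2^≤⇒1≤ : ∀ a w → 2 ^ w ℕ.≤ a → 1ℚ ≤ ι a * ½^ w
      2^≤⇒1≤ a w h = subst (_≤ ι a * ½^ w) (trans (ℚₚ.*-comm (ι (2 ^ w)) (½^ w)) (½^-2^ w))
        (*-monoʳ {½^ w} {ι (2 ^ w)} {ι a} (0≤½^ w) (ι-mono {2 ^ w} {a} h))

      -- An approximation of 2^w / p(n): the denominator is about 2^w p(n), hence the numerator 4^w.
      Q : ℕ → ℕ → ℕ
      Q n w = (2 ^ w ℕ.* 2 ^ w) ℕ./ P.A n w

      0≤units : ∀ a w → 0ℚ ≤ ι a * ½^ w
      0≤units a w = 0≤* {ι a} {½^ w} (0≤ι a) (0≤½^ w)

      1≤A : ∀ n w → 1ℚ ≤ ι (P.A n w) * ½^ w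
      1≤A n w = Lower-Upper (p n) 1ℚ (ι (P.A n w) * ½^ w) (1≤p n) (P.Upper-A n w)

      Lower-Q : ∀ n w → Lower (1/p n) (ι (Q n w) * ½^ w)
      Lower-Q n w = Lower-recip (p n) (p>1 n) {ι (P.A n w) * ½^ w} {ι (Q n w) * ½^ w} (P.Upper-A n w) (0≤units (Q n w) w)
        (ℚₚ.≤-trans (subst (_≤ ι (Q n w) * ½^ w * (ι (P.A n w) * ½^ w)) (ℚₚ.*-identityʳ (ι (Q n w) * ½^ w))
          (*-monoˡ {ι (Q n w) * ½^ w} {1ℚ} {ι (P.A n w) * ½^ w} (0≤units (Q n w) w) (1≤A n w))) q*u≤1)
        q*u≤1
        where
        q*u≤1 : ι (Q n w) * ½^ w * (ι (P.A n w) * ½^ w) ≤ 1ℚ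
        q*u≤1 = units≤1 (Q n w) (P.A n w) w (DivMod.m/n*n≤m (2 ^ w ℕ.* 2 ^ w) (P.A n w))

      -- If 4 + Q ≥ 2^w the bound is at least 1. Otherwise Q + 1 ≤ B = A - 3, as A ≥ 2^w, and 4^w ≤
      -- (Q + 1)(B + 3) ≤ (Q + 1) B + 3 B = (Q + 4) B.
      Upper-Q : ∀ n w → Upper (1/p n) (ι (4 ℕ.+ Q n w) * ½^ w)
      Upper-Q n w = Upper-recip (p n) (p>1 n) {ι (P.A n w ∸ 3) * ½^ w} {ι (4 ℕ.+ Q n w) * ½^ w}
        (P.Lower-A n w (0≤p n)) (0≤units (4 ℕ.+ Q n w) w) large
        where
        large : 1ℚ ≤ ι (4 ℕ.+ Q n w) * ½^ w ⊎ 1ℚ ≤ ι (4 ℕ.+ Q n w) * ½^ w * (ι (P.A n w ∸ 3) * ½^ w)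
        large with ℕₚ.≤-<-connex (2 ^ w) (4 ℕ.+ Q n w)
        ... | inj₁ h = inj₁ (2^≤⇒1≤ (4 ℕ.+ Q n w) w h)
        ... | inj₂ h = inj₂ (1≤units (4 ℕ.+ Q n w) (P.A n w ∸ 3) w (begin
          2 ^ w ℕ.* 2 ^ w             ≤⟨ ℕₚ.<⇒≤ (m<suc[m/n]*n (2 ^ w ℕ.* 2 ^ w) (P.A n w)) ⟩
          suc (Q n w) ℕ.* P.A n w     ≡⟨ cong (suc (Q n w) ℕ.*_) (sym (ℕₚ.m+[n∸m]≡n 3≤A)) ⟩
          suc (Q n w) ℕ.* (3 ℕ.+ B)   ≡⟨ regroup (Q n w) B ⟩
          suc (Q n w) ℕ.* B ℕ.+ 3 ℕ.* suc (Q n w) ≤⟨ ℕₚ.+-monoʳ-≤ (suc (Q n w) ℕ.* B) (ℕₚ.*-monoʳ-≤ 3 Q<B) ⟩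
          suc (Q n w) ℕ.* B ℕ.+ 3 ℕ.* B ≡⟨ regroup₂ (Q n w) B ⟩
          (4 ℕ.+ Q n w) ℕ.* B         ∎))
          where
          open ℕₚ.≤-Reasoning
          B : ℕ
          B = P.A n w ∸ 3
          4+Q<A : 4 ℕ.+ Q n w ℕ.< P.A n w
          4+Q<A = ℕₚ.<-≤-trans h (1≤½^-2^ (P.A n w) w (1≤A n w))
          3≤A : 3 ℕ.≤ P.A n w
          3≤A = ℕₚ.≤-trans (ℕₚ.m≤m+n 3 (suc (Q n w))) (ℕₚ.<⇒≤ 4+Q<A)
          Q<B : suc (Q n w) ℕ.≤ B
          Q<B = ℕₚ.m+n≤o⇒m≤o∸n (suc (Q n w)) (ℕₚ.≤-trans (ℕₚ.≤-reflexive (ℕₚ.+-comm (suc (Q n w)) 3)) (ℕₚ.<⇒≤ 4+Q<A))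
          regroup : ∀ q b → suc q ℕ.* (3 ℕ.+ b) ≡ suc q ℕ.* b ℕ.+ 3 ℕ.* suc q
          regroup = solve-∀
          regroup₂ : ∀ q b → suc q ℕ.* b ℕ.+ 3 ℕ.* b ≡ (4 ℕ.+ q) ℕ.* b
          regroup₂ = solve-∀

      S-A : ℕ → ℕ
      S-A = S.A 0

      -- 2⁻ʷ · remainder w bounds the part of the series from w on.
      remainder : ℕ → ℕ
      remainder w = S-A w ∸ ∑< w (λ n → Q n w)

      -- Convergence yields an `N` whose partial sum is within 2^(-K-1) of the whole. The rounding
      -- errors, at most 3 + 4 N units of 2^(-w), are fixed before w is chosen: M = 3 + 4 N is at
      -- most 2^M, so the remainder is at most 2^M + 2^M, and w = K + 1 + M is just large enough.
      -- Terms between N and w only decrease the remainder.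
      remainder-exists : ∀ (ρ : Env 1) → ∃[ w ] 2 ^ (3 ℕ.+ 3 ℕ.* look 0F ρ) ℕ.* remainder w ∸ 2 ^ w ≡ 0
      remainder-exists (k , tt) = w , ℕₚ.m≤n⇒m∸n≡0 (begin
        2 ^ K ℕ.* remainder w ≤⟨ ℕₚ.*-monoʳ-≤ (2 ^ K) remainder≤ ⟩
        2 ^ K ℕ.* 2 ^ suc M   ≡⟨ sym (ℕₚ.^-distribˡ-+-* 2 K (suc M)) ⟩
        2 ^ (K ℕ.+ suc M)     ≡⟨ cong (2 ^_) (ℕₚ.+-suc K M) ⟩
        2 ^ w                 ∎)
        where
        open ℕₚ.≤-Reasoning
        K N M w ∑Q : ℕ
        K = 3 ℕ.+ 3 ℕ.* k
        N = proj₁ (sum-converges (suc K))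
        M = 3 ℕ.+ N ℕ.* 4
        w = suc K ℕ.+ M
        ∑Q = ∑< N (λ n → Q n w)

        in-units : ∀ m n → ½^ m ≡ ι (2 ^ n) * ½^ (m ℕ.+ n)
        in-units m n = sym (trans (cong (ι (2 ^ n) *_) (½^-+ m n)) (trans (regroup (ι (2 ^ n)) (½^ m) (½^ n))
          (trans (cong (½^ m *_) (½^-2^ n)) (ℚₚ.*-identityʳ (½^ m)))))
          where
          regroup : ∀ x e f → x * (e * f) ≡ e * (f * x)
          regroup = solve 3 (λ x e f → x :* (e :* f) := e :* (f :* x)) refl

        ∑4+Q : ∑< N (λ n → 4 ℕ.+ Q n w) ≡ N ℕ.* 4 ℕ.+ ∑Q
        ∑4+Q = ∑-+const 4 (λ n → Q n w) N

        real-bound : ι (S-A w ∸ 3) * ½^ w - ½^ suc K ≤ ι (N ℕ.* 4 ℕ.+ ∑Q) * ½^ w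
        real-bound = Lower-Upper (partialSum 1/p N) (ι (S-A w ∸ 3) * ½^ w - ½^ suc K) (ι (N ℕ.* 4 ℕ.+ ∑Q) * ½^ w)
          (Lower-close′ (partialSum 1/p N) sum (½^ suc K) (proj₂ (sum-converges (suc K)) N ℕₚ.≤-refl) {ι (S-A w ∸ 3) * ½^ w}
            (S.Lower-A 0 w 0≤sum))
          (subst (λ x → Upper (partialSum 1/p N) (ι x * ½^ w)) ∑4+Q
            (Upper-∑ 1/p (λ n → 4 ℕ.+ Q n w) (½^ w) (λ n → Upper-Q n w) N))

        nat-bound : S-A w ∸ 3 ℕ.≤ N ℕ.* 4 ℕ.+ ∑Q ℕ.+ 2 ^ M
        nat-bound = ℕₚ.*-cancelʳ-≤ (S-A w ∸ 3) (N ℕ.* 4 ℕ.+ ∑Q ℕ.+ 2 ^ M) (2 ^ w) {{ℕₚ.m^n≢0 2 w}}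
          (cross (S-A w ∸ 3) (N ℕ.* 4 ℕ.+ ∑Q ℕ.+ 2 ^ M) w w
            (linear₁ real-bound (trans (cong (λ z → ι (S-A w ∸ 3) * ½^ w + (ι (N ℕ.* 4 ℕ.+ ∑Q) * ½^ w - (ι (S-A w ∸ 3) * ½^ w - z))) (in-units (suc K) M))
              (trans (regroup (ι (S-A w ∸ 3)) (ι (N ℕ.* 4 ℕ.+ ∑Q)) (ι (2 ^ M)) (½^ w))
                (cong (_* ½^ w) (sym (ι-+ (N ℕ.* 4 ℕ.+ ∑Q) (2 ^ M))))))))
          where
          regroup : ∀ s q m e → s * e + (q * e - (s * e - m * e)) ≡ (q + m) * e
          regroup = solve 4 (λ s q m e → s :* e :+ (q :* e :- (s :* e :- m :* e)) := (q :+ m) :* e) refl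

        remainder≤ : remainder w ℕ.≤ 2 ^ suc M
        remainder≤ = ℕₚ.m≤n+o⇒m∸n≤o (S-A w) (∑< w (λ n → Q n w)) (begin
          S-A w                                    ≤⟨ ℕₚ.m≤n+m∸n (S-A w) 3 ⟩
          3 ℕ.+ (S-A w ∸ 3)                        ≤⟨ ℕₚ.+-monoʳ-≤ 3 nat-bound ⟩
          3 ℕ.+ (N ℕ.* 4 ℕ.+ ∑Q ℕ.+ 2 ^ M)         ≡⟨ regroup (N ℕ.* 4) ∑Q (2 ^ M) ⟩
          ∑Q ℕ.+ (M ℕ.+ 2 ^ M)                     ≤⟨ ℕₚ.+-mono-≤ (∑-mono-≤ (λ n → Q n w) N≤w) (ℕₚ.+-monoˡ-≤ (2 ^ M) (n≤2^n M)) ⟩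
          ∑< w (λ n → Q n w) ℕ.+ (2 ^ M ℕ.+ 2 ^ M) ≡⟨ cong (λ x → ∑< w (λ n → Q n w) ℕ.+ (2 ^ M ℕ.+ x)) (sym (ℕₚ.+-identityʳ (2 ^ M))) ⟩
          ∑< w (λ n → Q n w) ℕ.+ 2 ^ suc M         ∎)
          where
          N≤w : N ℕ.≤ w
          N≤w = ℕₚ.≤-trans (ℕₚ.m≤m*n N 4) (ℕₚ.≤-trans (ℕₚ.m≤n+m (N ℕ.* 4) 3) (ℕₚ.m≤n+m M (suc K)))
          regroup : ∀ n q m → 3 ℕ.+ (n ℕ.+ q ℕ.+ m) ≡ q ℕ.+ (3 ℕ.+ n ℕ.+ m)
          regroup = solve-∀

    -- The additional 3 in the exponent compensates for the factor 8 between 2^(-l) and 1/p. The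
    -- search is effective because `remainder` is computed from approximations of the sum and of
    -- finitely many terms.
    N : ℕ → ℕ
    N k = proj₁ (leastZero (λ w → 2 ^ (3 ℕ.+ 3 ℕ.* k) ℕ.* remainder w ∸ 2 ^ w) (remainder-exists (k , tt)))

    Nᵣ : ∀ {O} {X : O → ℕ → ℕ} {m} {f : Env m → ℕ} → Rec X f → Rec X (λ ρ → N (f ρ))
    Nᵣ {X = X} = ap₁ {f = λ ρ → N (look 0F ρ)} (rec-leastZero
      (lit 2 ^ᵣ (lit 3 +ᵣ lit 3 *ᵣ var 1F) *ᵣ remainderᵣ (var 0F) ∸ᵣ lit 2 ^ᵣ var 0F) remainder-exists)
      where
      Qᵣ : ∀ {m} {f g : Env m → ℕ} → Rec X f → Rec X g → Rec X (λ ρ → Q (f ρ) (g ρ))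
      Qᵣ r s = (lit 2 ^ᵣ s *ᵣ lit 2 ^ᵣ s) /ᵣ predᵣ (P.Aᵣ r s)

      remainderᵣ : ∀ {m} {f : Env m → ℕ} → Rec X f → Rec X (λ ρ → remainder (f ρ))
      remainderᵣ = ap₁ {f = λ ρ → remainder (look 0F ρ)}
        (S.Aᵣ (lit 0) (var 0F) ∸ᵣ ∑ᵣ {f = λ n ρ → Q n (look 0F ρ)} (var 0F) (Qᵣ (var 0F) (var 1F)))

    -- 2^(- l (N+i)) · C N i is the sum of 2^(- l n) over N ≤ n < N+i.
    C : ℕ → ℕ → ℕ
    C N i = ∑< i (λ j → 2 ^ (l (N ℕ.+ i) ∸ l (N ℕ.+ j)))

    -- One more interval is appended in the old unit, then everything is rescaled to the new unit,
    -- which is finer because `l` is nondecreasing.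
    C-suc : ∀ N i → C N (suc i) ≡ 2 ^ (l (N ℕ.+ suc i) ∸ l (N ℕ.+ i)) ℕ.* suc (C N i)
    C-suc N i = trans (cong₂ ℕ._+_
        (trans (∑-cong i λ j j<i → trans (cong (2 ^_) (split j j<i)) (ℕₚ.^-distribˡ-+-* 2 Δ (l (N ℕ.+ i) ∸ l (N ℕ.+ j))))
               (∑-* (2 ^ Δ) (λ j → 2 ^ (l (N ℕ.+ i) ∸ l (N ℕ.+ j))) i))
        refl)
      (trans (ℕₚ.+-comm (2 ^ Δ ℕ.* C N i) (2 ^ Δ)) (sym (ℕₚ.*-suc (2 ^ Δ) (C N i))))
      where
      Δ : ℕ
      Δ = l (N ℕ.+ suc i) ∸ l (N ℕ.+ i)
      step : l (N ℕ.+ i) ℕ.≤ l (N ℕ.+ suc i)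
      step = l-mono (ℕₚ.+-monoʳ-≤ N (ℕₚ.n≤1+n i))
      split : ∀ j → j ℕ.< i → l (N ℕ.+ suc i) ∸ l (N ℕ.+ j) ≡ Δ ℕ.+ (l (N ℕ.+ i) ∸ l (N ℕ.+ j))
      split j j<i = trans (cong (_∸ l (N ℕ.+ j)) (sym (ℕₚ.m∸n+n≡m step)))
        (ℕₚ.+-∸-assoc Δ (l-mono (ℕₚ.+-monoʳ-≤ N (ℕₚ.<⇒≤ j<i))))

    Cᵣ : ∀ {O} {X : O → ℕ → ℕ} {m} {f g : Env m → ℕ} → Rec X f → Rec X g → Rec X (λ ρ → C (f ρ) (g ρ))
    Cᵣ = ap₂ {f = λ ρ → C (look 0F ρ) (look 1F ρ)} (∑ᵣ {f = λ j ρ → 2 ^ (l (look 0F ρ ℕ.+ look 1F ρ) ∸ l (look 0F ρ ℕ.+ j))}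
      (var 1F) (lit 2 ^ᵣ (lᵣ (var 1F +ᵣ var 2F) ∸ᵣ lᵣ (var 1F +ᵣ var 0F))))

    private
      -- Terms before w are estimated by `Q`, later ones by 2^(-3-l). The mutual induction adds a
      -- term in the old unit and then changes the unit.
      Lower-C : ∀ w i → Lower (partialSum 1/p (w ℕ.+ i)) (ι (∑< w (λ n → Q n w)) * ½^ w + ι (C w i) * ½^ (3 ℕ.+ l (w ℕ.+ i)))
      Lower-C-suc : ∀ w i → Lower (partialSum 1/p (suc (w ℕ.+ i)))
        (ι (∑< w (λ n → Q n w)) * ½^ w + ι (suc (C w i)) * ½^ (3 ℕ.+ l (w ℕ.+ i)))

      Lower-C w zero = subst₂ (λ n q → Lower (partialSum 1/p n) q) (sym (ℕₚ.+-identityʳ w))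
        (trans (sym (ℚₚ.+-identityʳ x)) (cong (x +_) (sym (ι0* (½^ (3 ℕ.+ l (w ℕ.+ 0)))))))
        (Lower-∑ 1/p (λ n → Q n w) (½^ w) (λ n → Lower-Q n w) w)
        where
        x : ℚ
        x = ι (∑< w (λ n → Q n w)) * ½^ w
      Lower-C w (suc i) = subst₂ (λ n q → Lower (partialSum 1/p n) q) (sym (ℕₚ.+-suc w i))
        (cong (ι (∑< w (λ n → Q n w)) * ½^ w +_) (sym rescale)) (Lower-C-suc w i)
        where
        Δ : ℕ
        Δ = l (w ℕ.+ suc i) ∸ l (w ℕ.+ i)
        e : ℚ
        e = ½^ (3 ℕ.+ l (w ℕ.+ i))
        exponent : 3 ℕ.+ l (w ℕ.+ suc i) ≡ Δ ℕ.+ (3 ℕ.+ l (w ℕ.+ i))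
        exponent = trans (cong (3 ℕ.+_) (sym (ℕₚ.m∸n+n≡m (l-mono (ℕₚ.+-monoʳ-≤ w (ℕₚ.n≤1+n i))))))
          (regroup Δ (l (w ℕ.+ i)))
          where
          regroup : ∀ a b → 3 ℕ.+ (a ℕ.+ b) ≡ a ℕ.+ (3 ℕ.+ b)
          regroup = solve-∀
        rescale : ι (C w (suc i)) * ½^ (3 ℕ.+ l (w ℕ.+ suc i)) ≡ ι (suc (C w i)) * e
        rescale = trans (cong₂ _*_ (trans (cong ι (C-suc w i)) (ι-* (2 ^ Δ) (suc (C w i)))) (trans (cong ½^_ exponent) (½^-+ Δ (3 ℕ.+ l (w ℕ.+ i)))))
          (trans (regroup (ι (2 ^ Δ)) (ι (suc (C w i))) (½^ Δ) e) (trans (cong (_* (ι (suc (C w i)) * e)) (½^-2^ Δ)) (ℚₚ.*-identityˡ _)))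
          where
          regroup : ∀ a b c d → a * b * (c * d) ≡ c * a * (b * d)
          regroup = solve 4 (λ a b c d → a :* b :* (c :* d) := c :* a :* (b :* d)) refl

      Lower-C-suc w i = subst (Lower (partialSum 1/p (suc (w ℕ.+ i))))
        (trans (regroup (ι (∑< w (λ n → Q n w)) * ½^ w) (ι (C w i)) e) (cong (λ z → ι (∑< w (λ n → Q n w)) * ½^ w + z * e) (sym (ι-+ 1 (C w i)))))
        (Lower-+ (partialSum 1/p (w ℕ.+ i)) (1/p (w ℕ.+ i)) (ι (∑< w (λ n → Q n w)) * ½^ w + ι (C w i) * e) e
          (Lower-C w i) (Lower-1/p (w ℕ.+ i)))
        where
        e : ℚ
        e = ½^ (3 ℕ.+ l (w ℕ.+ i))
        regroup : ∀ x c e → x + c * e + e ≡ x + (ι 1 + c) * e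
        regroup = solve 3 (λ x c e → x :+ c :* e :+ e := x :+ (con (ι 1) :+ c) :* e) refl

    -- Comparing the partial sum through term w + i with the upper approximation of the whole sum
    -- leaves at most `remainder w` units for the terms from w on. By the choice of `N` this is at
    -- most 2^(-3-3k), and the factor 8 cancels.
    C-bound : ∀ k i → suc (C (N k) i) ℕ.* 2 ^ (3 ℕ.* k) ℕ.≤ 2 ^ l (N k ℕ.+ i)
    C-bound k i = ℕₚ.*-cancelˡ-≤ (8 ℕ.* 2 ^ w) {{ℕₚ.m*n≢0 8 (2 ^ w) {{_}} {{ℕₚ.m^n≢0 2 w}}}} (begin
      8 ℕ.* 2 ^ w ℕ.* (c ℕ.* 2 ^ (3 ℕ.* k))        ≡⟨ regroup₁ (2 ^ w) c (2 ^ (3 ℕ.* k)) ⟩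
      c ℕ.* 2 ^ w ℕ.* 2 ^ (3 ℕ.+ 3 ℕ.* k)          ≤⟨ ℕₚ.*-monoˡ-≤ (2 ^ (3 ℕ.+ 3 ℕ.* k)) (cross c (remainder w) (3 ℕ.+ L) w c≤) ⟩
      remainder w ℕ.* 2 ^ (3 ℕ.+ L) ℕ.* 2 ^ (3 ℕ.+ 3 ℕ.* k) ≡⟨ regroup₂ (remainder w) (2 ^ (3 ℕ.+ L)) (2 ^ (3 ℕ.+ 3 ℕ.* k)) ⟩
      2 ^ (3 ℕ.+ 3 ℕ.* k) ℕ.* remainder w ℕ.* 2 ^ (3 ℕ.+ L) ≤⟨ ℕₚ.*-monoˡ-≤ (2 ^ (3 ℕ.+ L)) modulus ⟩
      2 ^ w ℕ.* 2 ^ (3 ℕ.+ L)                      ≡⟨ regroup₃ (2 ^ w) (2 ^ L) ⟩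
      8 ℕ.* 2 ^ w ℕ.* 2 ^ L                        ∎)
      where
      open ℕₚ.≤-Reasoning
      w c L : ℕ
      w = N k
      c = suc (C (N k) i)
      L = l (N k ℕ.+ i)
      modulus : 2 ^ (3 ℕ.+ 3 ℕ.* k) ℕ.* remainder w ℕ.≤ 2 ^ w
      modulus = ℕₚ.m∸n≡0⇒m≤n (proj₁ (proj₂ (leastZero (λ w → 2 ^ (3 ℕ.+ 3 ℕ.* k) ℕ.* remainder w ∸ 2 ^ w) (remainder-exists (k , tt)))))
      ∑Q : ℕ
      ∑Q = ∑< w (λ n → Q n w)
      real-bound : ι ∑Q * ½^ w + ι c * ½^ (3 ℕ.+ L) ≤ ι (S-A w) * ½^ w
      real-bound = Lower-Upper sum (ι ∑Q * ½^ w + ι c * ½^ (3 ℕ.+ L)) (ι (S-A w) * ½^ w)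
        (∑≤sum (suc (w ℕ.+ i)) (ι ∑Q * ½^ w + ι c * ½^ (3 ℕ.+ L)) (Lower-C-suc w i)) (S.Upper-A 0 w)
      c≤ : ι c * ½^ (3 ℕ.+ L) ≤ ι (remainder w) * ½^ w
      c≤ = linear₂ real-bound (*-monoʳ {½^ w} {ι (S-A w)} {ι ∑Q + ι (remainder w)} (0≤½^ w)
          (ℚₚ.≤-trans (ι-mono {S-A w} {∑Q ℕ.+ remainder w} (ℕₚ.m≤n+m∸n (S-A w) ∑Q)) (ℚₚ.≤-reflexive (ι-+ ∑Q (remainder w)))))
        (regroup (ι c * ½^ (3 ℕ.+ L)) (ι ∑Q) (ι (S-A w)) (ι (remainder w)) (½^ w))
        where
        regroup : ∀ x q s r e → x + (s * e - (q * e + x)) + ((q + r) * e - s * e) ≡ r * e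
        regroup = solve 5 (λ x q s r e → x :+ (s :* e :- (q :* e :+ x)) :+ ((q :+ r) :* e :- s :* e) := r :* e) refl
      regroup₁ : ∀ w c k → 8 ℕ.* w ℕ.* (c ℕ.* k) ≡ c ℕ.* w ℕ.* (2 ℕ.* (2 ℕ.* (2 ℕ.* k)))
      regroup₁ = solve-∀
      regroup₂ : ∀ r a b → r ℕ.* a ℕ.* b ≡ b ℕ.* r ℕ.* a
      regroup₂ = solve-∀
      regroup₃ : ∀ w l → w ℕ.* (2 ℕ.* (2 ℕ.* (2 ℕ.* l))) ≡ 8 ℕ.* w ℕ.* l
      regroup₃ = solve-∀

open Growth

-- The slowly growing deficiency z and the compression of sequences whose blocks hit ψ.

module BlockCoding where

  open import Data.Bool using (Bool)
  open import Data.Fin.Patterns using (0F; 1F; 2F; 3F)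
  open import Data.List using (List; []; _∷_; _++_; length)
  open import Data.List.Properties using (length-applyUpTo; length-++)
  open import Data.Nat
  open import Data.Nat.Properties
  open import Data.Nat.Tactic.RingSolver using (solve-∀)
  open import Data.Product using (_×_; _,_; proj₁; proj₂; ∃-syntax)
  open import Data.Sum using (_⊎_; inj₁; inj₂)
  open import Data.Unit using (tt)
  open import Data.Vec using ([]; _∷_)
  open import Relation.Binary.Definitions using (tri<; tri≈; tri>)
  open import Relation.Binary.PropositionalEquality hiding ([_])
  open import Relation.Nullary using (¬_; contradiction; yes; no)
  open import Function using (_⇔_; mk⇔; Equivalence)
  open import Defs using (comp; PartialRecursive; _·_↦_; code; Machine; _[_]=_; _↾_; Universal)
  open Rec
  open Rec*

  abstract
    then-apply : ∀ {n} {h : Env (suc n) → ℕ} → PartialRecursive n → Rec none h → PartialRecursive n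
    then-apply {n} G hᵣ = comp (program hᵣ) (G ∷ programs (selectᵣ {X = none} {n} λ i → i))

    then-apply-⇔ : ∀ {n} {h : Env (suc n) → ℕ} (G : PartialRecursive n) (hᵣ : Rec none h) ρ o →
      (then-apply G hᵣ · toVec ρ ↦ o) ⇔ (∃[ y ] G · toVec ρ ↦ y × o ≡ h (y , ρ))
    then-apply-⇔ {n} {h} G hᵣ ρ o = mk⇔
      (λ { (y ∷ zs , (Gy , ids) , ho) → y , Gy ,
        trans (deterministic (program hᵣ) none _
            (subst (λ zs → program hᵣ · (y ∷ zs) ↦ o) (deterministic* (programs idᵣ) none _ ids (runs* idᵣ ρ)) ho)
            (runs hᵣ (y , σ)))
          (cong (λ σ → h (y , σ)) σ≡ρ) })
      λ { (y , Gy , refl) → y ∷ toVec σ , (Gy , runs* idᵣ ρ) ,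
        subst (λ σ → program hᵣ · (y ∷ toVec (select {X = none} (λ i → i) ρ)) ↦ h (y , σ)) σ≡ρ (runs hᵣ (y , σ)) }
      where
      idᵣ : Rec* none {n} {n} (select {X = none} λ i → i)
      idᵣ = selectᵣ λ i → i
      σ : Env n
      σ = select {X = none} (λ i → i) ρ
      σ≡ρ : σ ≡ ρ
      σ≡ρ = select≡ {X = none} (λ i → i) ρ ρ λ _ → refl

  value : (ℕ → Bool) → ℕ → ℕ
  value X n = ∑< n (λ i → 2 ^ i * digit (X i))

  -- `code` has digits 1 and 2 where `value` has 0 and 1; the additional ones amount to 2^n - 1.
  code-value : ∀ X n → suc (code (X ↾ n)) ≡ value X n + 2 ^ n
  code-value X n = trans (cong suc (code-↾ X n)) (go n)
    where
    go : ∀ n → suc (∑< n (λ i → 2 ^ i * suc (digit (X i)))) ≡ value X n + 2 ^ n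
    go zero    = refl
    go (suc n) = trans (cong (_+ 2 ^ n * suc (digit (X n))) (go n)) (regroup (value X n) (2 ^ n) (digit (X n)))
      where
      regroup : ∀ v e d → v + e + e * suc d ≡ v + e * d + 2 * e
      regroup = solve-∀

  value< : ∀ X n → value X n < 2 ^ n
  value< X zero    = s≤s z≤n
  value< X (suc n) = begin-strict
    value X n + 2 ^ n * digit (X n) <⟨ +-mono-<-≤ (value< X n) (*-monoʳ-≤ (2 ^ n) (digit≤1 (X n))) ⟩
    2 ^ n + 2 ^ n * 1               ≡⟨ regroup (2 ^ n) ⟩
    2 ^ suc n                       ∎
    where
    open ≤-Reasoning
    regroup : ∀ e → e + e * 1 ≡ 2 * e
    regroup = solve-∀

  module Coding
    (l : ℕ → ℕ) (l-mono : ∀ {m n} → m ≤ n → l m ≤ l n)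
    (N : ℕ → ℕ) (C : ℕ → ℕ → ℕ)
    (C-suc : ∀ N i → C N (suc i) ≡ 2 ^ (l (N + suc i) ∸ l (N + i)) * suc (C N i))
    (C-bound : ∀ k i → suc (C (N k) i) * 2 ^ (3 * k) ≤ 2 ^ l (N k + i))
    (lᵣ : ∀ {O} {X : O → ℕ → ℕ} {n} {f : Env n → ℕ} → Rec X f → Rec X (λ ρ → l (f ρ)))
    (Nᵣ : ∀ {O} {X : O → ℕ → ℕ} {n} {f : Env n → ℕ} → Rec X f → Rec X (λ ρ → N (f ρ)))
    (Cᵣ : ∀ {O} {X : O → ℕ → ℕ} {n} {f g : Env n → ℕ} → Rec X f → Rec X g → Rec X (λ ρ → C (f ρ) (g ρ)))
    where

    -- The n-th block of an infinite sequence consists of its bits from t n up to s (suc n).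
    s t : ℕ → ℕ
    -- One spare bit in front of each block ensures n ≤ s n even where `l` vanishes, so that z grows
    -- along the block ends.
    s n = ∑< n (λ i → suc (l i))
    t n = suc (s n)

    s-suc : ∀ n → s (suc n) ≡ t n + l n
    s-suc n = +-suc (s n) (l n)

    n≤s : ∀ n → n ≤ s n
    n≤s zero    = z≤n
    n≤s (suc n) = ≤-trans (s≤s (n≤s n)) (≤-trans (m≤m+n (t n) (l n)) (≤-reflexive (sym (s-suc n))))

    s-mono : ∀ {m n} → m ≤ n → s m ≤ s n
    s-mono = ∑-mono-≤ (λ i → suc (l i))

    sᵣ : ∀ {O} {X : O → ℕ → ℕ} {n} {f : Env n → ℕ} → Rec X f → Rec X (λ ρ → s (f ρ))
    sᵣ = ap₁ {f = λ ρ → s (look 0F ρ)} (∑ᵣ {f = λ i ρ → suc (l i)} (var 0F) (sucᵣ (lᵣ (var 0F))))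

    -- If z m = k > 0 then m exceeds threshold k, so it lies beyond the blocks preceding N k;
    -- the summand 2 k makes m ∸ z m unbounded.
    threshold : ℕ → ℕ
    threshold k = s (N k) + 2 * k

    -- It rises as soon as the next threshold is passed, but by at most 1 at a time, so that m ∸ z m
    -- stays nondecreasing.
    z : ℕ → ℕ
    z zero    = 0
    z (suc m) = z m + (1 ∸ (threshold (suc (z m)) ∸ m))

    private
      z-step : ∀ m → (z (suc m) ≡ z m × m < threshold (suc (z m)))
                   ⊎ (z (suc m) ≡ suc (z m) × threshold (suc (z m)) ≤ m)
      z-step m with threshold (suc (z m)) ∸ m in eq
      ... | zero  = inj₂ (+-comm (z m) 1 , m∸n≡0⇒m≤n eq)
      ... | suc d = inj₁ (trans (cong (z m +_) (0∸n≡0 d)) (+-identityʳ (z m)) , m∸n≢0⇒n<m λ eq′ → contradiction (trans (sym eq) eq′) λ ())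

    z-suc : ∀ m → z (suc m) ≡ z m ⊎ z (suc m) ≡ suc (z m)
    z-suc m with z-step m
    ... | inj₁ (eq , _) = inj₁ eq
    ... | inj₂ (eq , _) = inj₂ eq

    z-threshold : ∀ m → z m ≢ 0 → threshold (z m) < m
    z-threshold zero nz = contradiction refl nz
    z-threshold (suc m) nz with z-step m
    ... | inj₁ (eq , _) = subst (λ k → threshold k < suc m) (sym eq)
      (m<n⇒m<1+n (z-threshold m λ z0 → nz (trans eq z0)))
    ... | inj₂ (eq , h) = subst (λ k → threshold k < suc m) (sym eq) (s≤s h)

    z-mono : ∀ {m n} → m ≤ n → z m ≤ z n
    z-mono {m} {n} m≤n with m≤n⇒m<n∨m≡n m≤n
    ... | inj₂ refl = ≤-refl
    z-mono {m} {suc n} m≤n | inj₁ (s≤s m≤n′) = ≤-trans (z-mono m≤n′) (m≤m+n (z n) _)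

    -- If z still equals k at `n + threshold (suc k)`, the next threshold has been passed there and
    -- the following step raises z.
    z-unbounded : ∀ k → ∃[ n ] k ≤ z n
    z-unbounded zero    = 0 , z≤n
    z-unbounded (suc k) with z-unbounded k
    ... | n , k≤z with m≤n⇒m<n∨m≡n (≤-trans k≤z (z-mono (m≤m+n n (threshold (suc k)))))
    ... | inj₁ k<z = n + threshold (suc k) , k<z
    ... | inj₂ k≡z with z-step (n + threshold (suc k))
    ... | inj₂ (eq , _) = suc (n + threshold (suc k)) , ≤-reflexive (trans (cong suc k≡z) (sym eq))
    ... | inj₁ (_ , h) = contradiction (m≤n+m (threshold (suc k)) n)
      (<⇒≱ (subst (λ k′ → n + threshold (suc k) < threshold (suc k′)) (sym k≡z) h))

    2z≤ : ∀ m → 2 * z m ≤ m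
    2z≤ m with z m ≟ 0
    ... | yes eq = ≤-trans (≤-reflexive (cong (2 *_) eq)) z≤n
    ... | no  nz = ≤-trans (m≤n+m (2 * z m) (s (N (z m)))) (<⇒≤ (z-threshold m nz))

    zᵣ : ∀ {O} {X : O → ℕ → ℕ} {n} {f : Env n → ℕ} → Rec X f → Rec X (λ ρ → z (f ρ))
    zᵣ = ap₁ {f = λ ρ → z (look 0F ρ)} (rec-ext
      (rec-prim (lit 0) (var 1F +ᵣ (lit 1 ∸ᵣ (sᵣ (Nᵣ (sucᵣ (var 1F))) +ᵣ lit 2 *ᵣ sucᵣ (var 1F) ∸ᵣ var 0F))))
      λ ρ → go (look 0F ρ))
      where
      go : ∀ k → primrec {0} (λ _ → 0) (λ σ → look 1F σ + (1 ∸ (threshold (suc (look 1F σ)) ∸ look 0F σ))) k tt ≡ z k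
      go zero    = refl
      go (suc k) = cong (λ x → x + (1 ∸ (threshold (suc x) ∸ k))) (go k)

    open SlowlyGrowing z refl z-suc z-unbounded zᵣ public

    width : ℕ → ℕ → ℕ
    width k i = l (N k + i) ∸ 3 * k

    -- By `C-bound`, as the factor in front of 2^(3k) is positive. The truncated subtraction in
    -- `width` is thus exact.
    3k≤l : ∀ k i → 3 * k ≤ l (N k + i)
    3k≤l k i = ≮⇒≥ λ l<3k → <⇒≱ (^-monoʳ-< 2 (s≤s (s≤s z≤n)) l<3k)
      (≤-trans (m≤n*m (2 ^ (3 * k)) (suc (C (N k) i))) (C-bound k i))

    C<2^width : ∀ k i → C (N k) i < 2 ^ width k i
    C<2^width k i = *-cancelʳ-≤ (suc (C (N k) i)) (2 ^ width k i) (2 ^ (3 * k)) {{m^n≢0 2 (3 * k)}} (begin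
      suc (C (N k) i) * 2 ^ (3 * k) ≤⟨ C-bound k i ⟩
      2 ^ l (N k + i)               ≡⟨ cong (2 ^_) (sym (m∸n+n≡m (3k≤l k i))) ⟩
      2 ^ (width k i + 3 * k)       ≡⟨ ^-distribˡ-+-* 2 (width k i) (3 * k) ⟩
      2 ^ width k i * 2 ^ (3 * k)   ∎)
      where open ≤-Reasoning

    -- `C-suc` gives equality for consecutive indices; each further step rescales both sides alike
    -- and adds an interval on the right.
    C-grows : ∀ N {i i′} → i < i′ → suc (C N i) * 2 ^ (l (N + i′) ∸ l (N + i)) ≤ C N i′
    C-grows N {i} {suc i′} (s≤s i≤i′) with m≤n⇒m<n∨m≡n i≤i′
    ... | inj₂ refl = ≤-reflexive (trans (*-comm (suc (C N i)) _) (sym (C-suc N i)))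
    ... | inj₁ i<i′ = begin
      suc (C N i) * 2 ^ (l (N + suc i′) ∸ l (N + i))     ≡⟨ cong (λ e → suc (C N i) * 2 ^ e) split ⟩
      suc (C N i) * 2 ^ (Δ + (l (N + i′) ∸ l (N + i)))   ≡⟨ cong (suc (C N i) *_) (^-distribˡ-+-* 2 Δ (l (N + i′) ∸ l (N + i))) ⟩
      suc (C N i) * (2 ^ Δ * 2 ^ (l (N + i′) ∸ l (N + i))) ≡⟨ regroup (suc (C N i)) (2 ^ Δ) _ ⟩
      2 ^ Δ * (suc (C N i) * 2 ^ (l (N + i′) ∸ l (N + i))) ≤⟨ *-monoʳ-≤ (2 ^ Δ) (≤-trans (C-grows N i<i′) (n≤1+n (C N i′))) ⟩
      2 ^ Δ * suc (C N i′)                               ≡⟨ sym (C-suc N i′) ⟩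
      C N (suc i′)                                       ∎
      where
      open ≤-Reasoning
      Δ : ℕ
      Δ = l (N + suc i′) ∸ l (N + i′)
      split : l (N + suc i′) ∸ l (N + i) ≡ Δ + (l (N + i′) ∸ l (N + i))
      split = trans (cong (_∸ l (N + i)) (sym (m∸n+n≡m (l-mono (+-monoʳ-≤ N (n≤1+n i′))))))
        (+-∸-assoc Δ (l-mono (+-monoʳ-≤ N i≤i′)))
      regroup : ∀ a b c → a * (b * c) ≡ b * (a * c)
      regroup = solve-∀

    -- Most significant digit first, so that comparable codewords would denote nested dyadic intervals
    digits : ℕ → ℕ → ℕ → Bool
    digits k i a = bits (C (N k) i) (width k i ∸ suc a)

    codeword : ℕ → ℕ → List Bool
    codeword k i = digits k i ↾ width k i

    -- Widths are nondecreasing, so compatibility makes the earlier codeword a prefix of the later,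
    -- that is c = ⌊c′ / 2^d⌋. But `C-grows` gives c + 1 ≤ ⌊c′ / 2^d⌋.
    codeword-antichain : ∀ k {i i′} → i < i′ → ¬ codeword k i ∼ codeword k i′
    codeword-antichain k {i} {i′} i<i′ h = <-irrefl same (≤shift d grown)
      where
      j j′ d c c′ : ℕ
      j  = width k i
      j′ = width k i′
      d  = j′ ∸ j
      c  = C (N k) i
      c′ = C (N k) i′

      j≤j′ : j ≤ j′
      j≤j′ = ∸-monoˡ-≤ (3 * k) (l-mono (+-monoʳ-≤ (N k) (<⇒≤ i<i′)))

      d≡ : l (N k + i′) ∸ l (N k + i) ≡ d
      d≡ = trans (cong (l (N k + i′) ∸_) (sym (m+[n∸m]≡n (3k≤l k i)))) (sym (∸-+-assoc (l (N k + i′)) (3 * k) j))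

      grown : suc c * 2 ^ d ≤ c′
      grown = subst (λ e → suc c * 2 ^ e ≤ c′) d≡ (C-grows (N k) i<i′)

      agree : ∀ a → a < j → bits c (j ∸ suc a) ≡ bits c′ (j′ ∸ suc a)
      agree = ∼-↾ (digits k i) (digits k i′) j j′ j≤j′ h

      agree′ : ∀ b → b < j → bits c b ≡ bits (shift d c′) b
      agree′ b b<j = trans (cong (bits c) (sym (trans (cong (j ∸_) j∸b) (m∸[m∸n]≡n (<⇒≤ b<j)))))
        (trans (agree (j ∸ suc b) (∸-monoʳ-< z<s b<j)) (trans (cong (bits c′) index) (sym (bits-shift c′ d b))))
        where
        j∸b : suc (j ∸ suc b) ≡ j ∸ b
        j∸b = sym (+-∸-assoc 1 b<j)
        index : j′ ∸ suc (j ∸ suc b) ≡ b + d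
        index = trans (cong₂ _∸_ (sym (m∸n+n≡m j≤j′)) j∸b)
          (trans (+-∸-assoc d (m∸n≤m j b)) (trans (cong (d +_) (m∸[m∸n]≡n (<⇒≤ b<j))) (+-comm d b)))

      c′< : c′ < 2 ^ j * 2 ^ d
      c′< = <-≤-trans (C<2^width k i′) (≤-reflexive (trans (cong (2 ^_) (sym (m+[n∸m]≡n j≤j′))) (^-distribˡ-+-* 2 j d)))

      same : c ≡ shift d c′
      same = bits-injective j (C<2^width k i) (shift< d c′<) agree′

    g-unbounded : ∀ b → ∃[ n ] b ≤ g n
    g-unbounded b = 2 * b , m+n≤o⇒m≤o∸n b {z (2 * b)}
      (≤-trans (+-monoʳ-≤ b z≤b) (≤-reflexive (cong (b +_) (sym (+-identityʳ b)))))
      where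
      z≤b : z (2 * b) ≤ b
      z≤b = *-cancelˡ-≤ 2 (2z≤ (2 * b))

    block : (ℕ → Bool) → ℕ → ℕ
    block X n = value (λ i → X (t n + i)) (l n)

    private
      -- The code through the end of a block is computed from the earlier bits and the block's
      -- value, which is how a value of ψ completes a description.
      code-blocks : ∀ X n → code (X ↾ s (suc n)) ≡ code (X ↾ t n) + 2 ^ t n * (block X n + pred (2 ^ l n))
      code-blocks X n = begin
        code (X ↾ s (suc n))                             ≡⟨ cong (λ m → code (X ↾ m)) (s-suc n) ⟩
        code (X ↾ (t n + l n))                           ≡⟨ cong code (↾-+ X (t n) (l n)) ⟩
        code (X ↾ t n ++ Y ↾ l n)                        ≡⟨ code-++ (X ↾ t n) (Y ↾ l n) ⟩
        code (X ↾ t n) + 2 ^ length (X ↾ t n) * code (Y ↾ l n)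
          ≡⟨ cong₂ (λ a b → code (X ↾ t n) + 2 ^ a * b) (length-applyUpTo X (t n)) code-Y ⟩
        code (X ↾ t n) + 2 ^ t n * (block X n + pred (2 ^ l n)) ∎
        where
        open ≡-Reasoning
        Y : ℕ → Bool
        Y i = X (t n + i)
        code-Y : code (Y ↾ l n) ≡ block X n + pred (2 ^ l n)
        code-Y = suc-injective (trans (code-value Y (l n))
          (trans (cong (block X n +_) (sym (suc-pred (2 ^ l n) {{m^n≢0 2 (l n)}}))) (+-suc (block X n) (pred (2 ^ l n)))))

    module _ (U : Machine) (universal : Universal U) (ψ : PartialRecursive 1) where

      private
        index : Env 3 → ℕ
        index ρ = N (look 0F ρ) + look 1F ρ

        indexᵣ : Rec none index
        indexᵣ = Nᵣ (var 0F) +ᵣ var 1F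

        initial : Env 3 → List Bool
        initial ρ = bits (look 2F ρ) ↾ t (index ρ)

        -- The three parts separate themselves: k is in unary, the codewords for fixed k form an
        -- antichain, and k and i determine the length of the rest.
        str : Env 3 → List Bool
        str ρ = unary (look 0F ρ) ++ (codeword (look 0F ρ) (look 1F ρ) ++ initial ρ)

        initialᵣ : Rec none (λ ρ → code (initial ρ))
        initialᵣ = code-↾ᵣ {Y = λ ρ → bits (look 2F ρ)} (sucᵣ (sᵣ indexᵣ)) (bitsᵣ (var 3F) (var 0F))

        strᵣ : Rec none (λ ρ → code (str ρ))
        strᵣ = code-++ᵣ {σ = λ ρ → unary (look 0F ρ)} {λ ρ → codeword (look 0F ρ) (look 1F ρ) ++ initial ρ}
          (code-unaryᵣ (var 0F)) (rec-ext (sucᵣ (var 0F)) λ ρ → sym (length-unary (look 0F ρ)))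
          (code-++ᵣ {σ = λ ρ → codeword (look 0F ρ) (look 1F ρ)} {initial}
            (code-↾ᵣ {Y = λ ρ → digits (look 0F ρ) (look 1F ρ)} widthᵣ
              (bitsᵣ (Cᵣ (Nᵣ (var 1F)) (var 2F)) ((lᵣ (Nᵣ (var 1F) +ᵣ var 2F) ∸ᵣ lit 3 *ᵣ var 1F) ∸ᵣ sucᵣ (var 0F))))
            (rec-ext widthᵣ λ ρ → sym (length-applyUpTo (digits (look 0F ρ) (look 1F ρ)) (width (look 0F ρ) (look 1F ρ))))
            initialᵣ)
          where
          widthᵣ : Rec none {3} (λ ρ → width (look 0F ρ) (look 1F ρ))
          widthᵣ = lᵣ indexᵣ ∸ᵣ lit 3 *ᵣ var 0F

        out : Env 4 → ℕ
        -- This is `code-blocks` with y as the value of the block. A y of 2^l or more yields some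
        -- unrelated output, which does no harm.
        out σ = code (initial (proj₂ σ)) + 2 ^ t (index (proj₂ σ)) * (proj₁ σ + pred (2 ^ l (index (proj₂ σ))))

        outᵣ : Rec none out
        outᵣ = tail initialᵣ +ᵣ lit 2 ^ᵣ sucᵣ (sᵣ (tail indexᵣ)) *ᵣ (var 0F +ᵣ predᵣ (lit 2 ^ᵣ lᵣ (tail indexᵣ)))
          where
          tail : {f : Env 3 → ℕ} → Rec none f → Rec none {4} (λ σ → f (proj₂ σ))
          tail r = rec-comp r (var 1F ∷ᵣ var 2F ∷ᵣ var 3F ∷ᵣ []ᵣ)

        F : PartialRecursive 3
        F = then-apply (ψ ∘ᵣ indexᵣ) outᵣ

        F⇒ : ∀ ρ o → F · toVec ρ ↦ o → ∃[ y ] ψ · (index ρ ∷ []) ↦ y × o ≡ out (y , ρ)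
        F⇒ ρ o h = let y , hy , eq = Equivalence.to (then-apply-⇔ (ψ ∘ᵣ indexᵣ) outᵣ ρ o) h
                   in y , Equivalence.to (∘ᵣ-⇔ ψ indexᵣ ρ y) hy , eq

        ⇒F : ∀ ρ y → ψ · (index ρ ∷ []) ↦ y → F · toVec ρ ↦ out (y , ρ)
        ⇒F ρ y h = Equivalence.from (then-apply-⇔ (ψ ∘ᵣ indexᵣ) outᵣ ρ (out (y , ρ)))
          (y , Equivalence.from (∘ᵣ-⇔ ψ indexᵣ ρ y) h , refl)

        str-∼ : ∀ ρ σ → str ρ ∼ str σ → look 0F ρ ≡ look 0F σ × look 1F ρ ≡ look 1F σ × initial ρ ≡ initial σ
        str-∼ (k , i , v , tt) (k′ , i′ , v′ , tt) h with ∼-unary k k′ h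
        ... | refl , h′ with <-cmp i i′
        ... | tri< i<i′ _ _ = contradiction (∼-++⁻ (codeword k i) (codeword k i′) h′) (codeword-antichain k i<i′)
        ... | tri> _ _ i′<i = contradiction (∼-sym (∼-++⁻ (codeword k i) (codeword k i′) h′)) (codeword-antichain k i′<i)
        ... | tri≈ _ refl _ = refl , refl , ∼-length (∼-++-cancel (codeword k i) h′)
          (trans (length-applyUpTo (bits v) (t (N k + i))) (sym (length-applyUpTo (bits v′) (t (N k + i)))))

        str-cong : ∀ ρ σ → look 0F ρ ≡ look 0F σ → look 1F ρ ≡ look 1F σ → initial ρ ≡ initial σ → str ρ ≡ str σ
        str-cong (k , i , v , tt) (k′ , i′ , v′ , tt) refl refl eq = cong (λ τ → unary k ++ (codeword k i ++ τ)) eq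

        F-functional : ∀ ρ σ y → str ρ ≡ str σ → F · toVec ρ ↦ y → F · toVec σ ↦ y
        F-functional ρ@(k , i , v , tt) σ@(k′ , i′ , v′ , tt) o eq h
          with str-∼ ρ σ (subst (str ρ ∼_) eq (∼-refl (str ρ)))
        ... | refl , refl , eq′ =
          let y , hy , o≡ = F⇒ ρ o h
          in subst (F · toVec σ ↦_) (trans (cong (λ τ → code τ + 2 ^ t (index ρ) * (y + pred (2 ^ l (index ρ)))) (sym eq′)) (sym o≡)) (⇒F σ y hy)

        machine : _
        machine = codeword-machine str strᵣ F
          (λ ρ σ h → let a , b , c = str-∼ ρ σ h in str-cong ρ σ a b c) F-functional

        simulation : ∃[ ρ ] ∀ τ σ → (U [ ρ ++ τ ]= σ) ⇔ (proj₁ machine [ τ ]= σ)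
        simulation = Universal.universal universal (proj₁ machine) (proj₁ (proj₂ machine))

        prefix : List Bool
        prefix = proj₁ simulation

      private
        -- The parts take k + 1, l(n) - 3k and t(n) bits, while the string described has t(n) +
        -- l(n).
        describe : ∀ X k i → ψ · (N k + i ∷ []) ↦ block X (N k + i) →
          ∃[ τ ] U [ τ ]= (X ↾ s (suc (N k + i))) × length τ + 2 * k ≡ suc (length prefix) + s (suc (N k + i))
        describe X k i h = prefix ++ str ρ ,
          Equivalence.from (proj₂ simulation (str ρ) (X ↾ s (suc n)))
            (proj₁ (proj₂ (proj₂ machine)) ρ (X ↾ s (suc n))
              (subst (F · toVec ρ ↦_) out≡ (⇒F ρ (block X n) h))) ,
          length≡
          where
          n v : ℕ
          n = N k + i
          v = proj₁ (bits-surjective X (t n))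
          ρ : Env 3
          ρ = k , i , v , tt
          out≡ : out (block X n , ρ) ≡ code (X ↾ s (suc n))
          out≡ = trans (cong (λ τ → code τ + 2 ^ t n * (block X n + pred (2 ^ l n)))
            (↾-cong (t n) (proj₂ (bits-surjective X (t n))))) (sym (code-blocks X n))
          length≡ : length (prefix ++ str ρ) + 2 * k ≡ suc (length prefix) + s (suc n)
          length≡ = begin
            length (prefix ++ str ρ) + 2 * k ≡⟨ cong (_+ 2 * k) (length-++ prefix) ⟩
            length prefix + length (str ρ) + 2 * k ≡⟨ cong (λ x → length prefix + x + 2 * k) (trans (length-++ (unary k))
              (cong₂ _+_ (length-unary k) (trans (length-++ (codeword k i)) (cong₂ _+_ (length-applyUpTo (digits k i) (width k i)) (length-applyUpTo (bits v) (t n)))))) ⟩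
            length prefix + (suc k + (width k i + t n)) + 2 * k ≡⟨ regroup (length prefix) k (width k i) (t n) ⟩
            suc (length prefix) + (t n + (width k i + 3 * k)) ≡⟨ cong (λ x → suc (length prefix) + (t n + x)) (m∸n+n≡m (3k≤l k i)) ⟩
            suc (length prefix) + (t n + l n) ≡⟨ cong (suc (length prefix) +_) (sym (s-suc n)) ⟩
            suc (length prefix) + s (suc n) ∎
            where
            open ≡-Reasoning
            regroup : ∀ p k w t → p + (suc k + (w + t)) + 2 * k ≡ suc p + (t + (w + 3 * k))
            regroup = solve-∀

      -- Let m be the end of block n and k = z m. A hit describes the first m bits with m - 2k bits
      -- up to a constant, whereas g m = m - k up to c is required; so k is bounded by a constant,
      -- which fails for large n.
      eventually-avoids : ∀ X c → (∀ n τ → U [ τ ]= (X ↾ n) → g n ≤ length τ + c) →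
        ∃[ n₀ ] ∀ n → n₀ ≤ n → ¬ ψ · (n ∷ []) ↦ block X n
      eventually-avoids X c complex = n₀ , avoids
        where
        k₀ n₀ : ℕ
        k₀ = suc (suc (length prefix + c))
        n₀ = proj₁ (z-unbounded k₀)

        avoids : ∀ n → n₀ ≤ n → ¬ ψ · (n ∷ []) ↦ block X n
        avoids n n₀≤n h = <⇒≱ (n<1+n (suc (length prefix + c))) (≤-trans k₀≤k k≤)
          where
          m k i : ℕ
          m = s (suc n)
          k = z m
          i = n ∸ N k

          k₀≤k : k₀ ≤ k
          k₀≤k = ≤-trans (proj₂ (z-unbounded k₀)) (z-mono (≤-trans n₀≤n (≤-trans (n≤1+n n) (n≤s (suc n)))))

          N≤n : N k ≤ n
          N≤n = ≮⇒≥ λ n<N → <⇒≱ (≤-<-trans (m≤m+n (s (N k)) (2 * k)) (z-threshold m λ k≡0 → contradiction (subst (k₀ ≤_) k≡0 k₀≤k) λ ()))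
            (s-mono n<N)

          description : ∃[ τ ] U [ τ ]= (X ↾ s (suc (N k + i))) × length τ + 2 * k ≡ suc (length prefix) + s (suc (N k + i))
          description = describe X k i (subst (λ n → ψ · (n ∷ []) ↦ block X n) (sym (m+[n∸m]≡n N≤n)) h)

          k≤ : k ≤ suc (length prefix + c)
          k≤ = +-cancelˡ-≤ (g m + k) k (suc (length prefix + c)) (begin
            g m + k + k                ≡⟨ regroup₁ (g m) k ⟩
            g m + 2 * k                ≤⟨ +-monoˡ-≤ (2 * k) (complex m τ (subst (λ n → U [ τ ]= (X ↾ s (suc n))) (m+[n∸m]≡n N≤n) (proj₁ (proj₂ description)))) ⟩
            length τ + c + 2 * k       ≡⟨ regroup₂ (length τ) c (2 * k) ⟩
            length τ + 2 * k + c       ≡⟨ cong (_+ c) (proj₂ (proj₂ description)) ⟩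
            suc (length prefix) + s (suc (N k + i)) + c ≡⟨ cong (λ n → suc (length prefix) + s (suc n) + c) (m+[n∸m]≡n N≤n) ⟩
            suc (length prefix) + m + c ≡⟨ cong (λ m → suc (length prefix) + m + c) (sym (g+z m)) ⟩
            suc (length prefix) + (g m + k) + c ≡⟨ regroup₃ (length prefix) (g m + k) c ⟩
            g m + k + suc (length prefix + c) ∎)
            where
            open ≤-Reasoning
            τ : List Bool
            τ = proj₁ description
            regroup₁ : ∀ a b → a + b + b ≡ a + 2 * b
            regroup₁ = solve-∀
            regroup₂ : ∀ a b c → a + b + c ≡ a + c + b
            regroup₂ = solve-∀
            regroup₃ : ∀ p m c → suc p + m + c ≡ m + suc (p + c)
            regroup₃ = solve-∀

open BlockCoding

-- Transfer to real-valued functions, the reduction, and the separation from MLR.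

module Conclusion where

  open import Axiom.ExcludedMiddle using (ExcludedMiddle)
  open import Data.Bool using (Bool)
  open import Data.Fin using (zero; suc)
  open import Data.Fin.Patterns using (0F; 1F; 2F)
  open import Data.Integer as ℤ using () renaming (+_ to pos)
  open import Data.List using (List; []; _∷_; _++_; length)
  open import Data.Nat as ℕ using (ℕ; zero; suc; _∸_; _^_; z≤n; s≤s)
  import Data.Nat.Properties as ℕₚ
  open import Data.Product using (_×_; _,_; proj₁; proj₂; ∃-syntax)
  open import Data.Rational using (ℚ; _≤_; _+_; _-_; _*_; 0ℚ; 1ℚ)
  import Data.Rational as ℚ
  import Data.Rational.Properties as ℚₚ
  open import Data.Rational.Solver using (module +-*-Solver)
  open import Data.Unit using (⊤; tt)
  open import Data.Vec using ([]; _∷_)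
  open import Function using (Equivalence)
  open import Level using (0ℓ)
  open import Relation.Binary.PropositionalEquality hiding ([_])
  open import Relation.Nullary using (¬_; contradiction; yes; no)
  open import Relation.Unary using (_≐_)
  open import Defs hiding (_<_; _≤_; _-_; -_; ∣_∣; _+_)
  open import Defs as ℝ using ()
  open +-*-Solver using (solve; _:+_; _:*_; _:-_; :-_; _:=_; con)
  open Rec
  open Rec*

  abstract
    ≤ι : ∀ q → ∃[ n ] q ≤ ι n
    ≤ι q = n , *-cancelʳ {ι (suc d)} {q} {ι n} (ι-pos (suc d))
      (ℚₚ.≤-trans (ℚₚ.≤-reflexive q*d) (ℚₚ.≤-trans i≤n
        (subst (_≤ ι n * ι (suc d)) (ℚₚ.*-identityʳ (ι n)) (*-monoˡ {ι n} {ι 1} {ι (suc d)} (0≤ι n) (ι-mono {1} {suc d} (s≤s z≤n))))))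
      where
      d n : ℕ
      d = ℚ.ℚ.denominator-1 q
      n = ℤ.∣ ℚ.↥ q ∣
      q*d : q * ι (suc d) ≡ ℚ.↥ q ℚ./ 1
      q*d = trans (cong (_* ι (suc d)) (sym (ℚₚ.↥p/↧p≡p q))) (/-* (ℚ.↥ q) d)
      i≤n : ℚ.↥ q ℚ./ 1 ≤ ι n
      i≤n with ℚ.↥ q
      ... | pos k       = ℚₚ.≤-refl
      ... | ℤ.-[1+ k ]  = linear₁ (0≤ι (suc k ℕ.+ suc k)) (trans (cong (ℤ.-[1+ k ] ℚ./ 1 +_) (ℚₚ.+-identityʳ _))
        (trans (cong (ℤ.-[1+ k ] ℚ./ 1 +_) (ι-+ (suc k) (suc k)))
          (trans (sym (ℚₚ.+-assoc (ℤ.-[1+ k ] ℚ./ 1) (ι (suc k)) (ι (suc k))))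
            (trans (cong (_+ ι (suc k)) (⊖/1 0 (suc k))) (ℚₚ.+-identityˡ (ι (suc k)))))))

  fromℕ-mono : ∀ {m n} → m ℕ.≤ n → fromℕ m ℝ.≤ fromℕ n
  fromℕ-mono {m} {n} m≤n i = linear₃ (ι-mono {m} {n} m≤n) (0≤½^ i) (0≤½^ i)
    (solve 3 (λ m n u → m :+ (n :- m) :+ (u :- con 0ℚ) :+ (u :- con 0ℚ) := n :+ (u :+ u)) refl (ι m) (ι n) (½^ i))

  fromℕ-∸ : ∀ {a c k} → a ℕ.≤ k ℕ.+ c → fromℕ a ℝ.- fromℕ c ℝ.≤ fromℕ k
  fromℕ-∸ {a} {c} {k} h i = linear₃ (ℚₚ.≤-trans (ι-mono {a} {k ℕ.+ c} h) (ℚₚ.≤-reflexive (ι-+ k c))) (0≤½^ i) (0≤½^ i)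
    (solve 4 (λ a c k u → (a :+ :- c) :+ ((k :+ c) :- a) :+ (u :- con 0ℚ) :+ (u :- con 0ℚ) := k :+ (u :+ u)) refl (ι a) (ι c) (ι k) (½^ i))

  fromℕ-∸⁻ : ∀ {a c k} → fromℕ a ℝ.- fromℕ c ℝ.≤ fromℕ k → a ℕ.≤ k ℕ.+ c
  fromℕ-∸⁻ {a} {c} {k} h = ι-cancel {a} {k ℕ.+ c} (ℚₚ.≤-trans
    (archimedean 2 {ι a} {ι k + ι c} λ i → linear₁ (h i) (regroup (ι a) (ι c) (ι k) (½^ i)))
    (ℚₚ.≤-reflexive (sym (ι-+ k c))))
    where
    regroup : ∀ a c k u → a + ((k + (u + u)) - (a + ℚ.- c)) ≡ (k + c) + ι 2 * u
    regroup = solve 4 (λ a c k u → a :+ ((k :+ (u :+ u)) :- (a :+ :- c)) := (k :+ c) :+ con (ι 2) :* u) refl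

  ≤fromℕ : ∀ x → ∃[ B ] ∀ m n → B ℕ.+ n ℕ.≤ m → x ℝ.≤ fromℕ m ℝ.- fromℕ n
  ≤fromℕ x = B , λ m n h i → ℚₚ.≤-trans
      (linear₃ {R = ½^ i + (ι m + ℚ.- ι n)} (regular-≤ x i 0) above-x
        (ℚₚ.≤-trans (ℚₚ.≤-reflexive (sym (ι-+ B n))) (ι-mono {B ℕ.+ n} {m} h))
        (regroup (approx x i) (approx x 0) (½^ i) (ι B) (ι m) (ι n)))
      (linear₁ (0≤½^ i) (regroup′ (½^ i) (ι m + ℚ.- ι n)))
    where
    B : ℕ
    B = proj₁ (≤ι (approx x 0 + 1ℚ))
    above-x : approx x 0 + 1ℚ ≤ ι B
    above-x = proj₂ (≤ι (approx x 0 + 1ℚ))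
    regroup : ∀ a x u b m n → a + ((x + u + 1ℚ) - a) + (b - (x + 1ℚ)) + (m - (b + n)) ≡ u + (m + ℚ.- n)
    regroup = solve 6 (λ a x u b m n → a :+ ((x :+ u :+ con 1ℚ) :- a) :+ (b :- (x :+ con 1ℚ)) :+ (m :- (b :+ n))
      := u :+ (m :+ :- n)) refl
    regroup′ : ∀ u d → u + d + (u - 0ℚ) ≡ d + (u + u)
    regroup′ = solve 2 (λ u d → u :+ d :+ (u :- con 0ℚ) := d :+ (u :+ u)) refl

  <fromℕ : ∀ x → ∃[ B ] ∀ n → B ℕ.≤ n → x ℝ.< fromℕ n
  <fromℕ x = B , λ n h → 0 , ℚₚ.<-≤-trans
      (ℚₚ.+-monoʳ-< (approx x 0) {1ℚ + 1ℚ} {1ℚ + 1ℚ + 1ℚ} (ℚ.*<* (ℤ.+<+ ℕₚ.≤-refl)))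
      (ℚₚ.≤-trans (proj₂ (≤ι (approx x 0 + (1ℚ + 1ℚ + 1ℚ)))) (ι-mono {B} {n} h))
    where
    B : ℕ
    B = proj₁ (≤ι (approx x 0 + (1ℚ + 1ℚ + 1ℚ)))

  fromℕ-computable : ∀ (f : ℕ → ℕ) → Rec none {1} (λ ρ → f (look 0F ρ)) → UniformlyComputable (λ n → fromℕ (f n))
  fromℕ-computable f fᵣ = record
    { num⁺ = λ n _ → f n
    ; num⁻ = λ _ _ → 0
    ; den-1 = λ _ _ → 0
    ; num⁺-recursive = program r , λ m n → runs r (m , n , tt)
    ; num⁻-recursive = program (lit {X = none} {2} 0) , λ m n → runs (lit {X = none} {2} 0) (m , n , tt)
    ; den-1-recursive = program (lit {X = none} {2} 0) , λ m n → runs (lit {X = none} {2} 0) (m , n , tt)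
    ; approximates = λ n k i → subst (_≤ ½^ k + (½^ i + ½^ i)) (sym (cong ℚ.∣_∣ (ℚₚ.+-inverseʳ (ι (f n)))))
        (ℚₚ.+-mono-≤ (0≤½^ k) (ℚₚ.+-mono-≤ (0≤½^ i) (0≤½^ i)))
    }
    where
    r : Rec none {2} (λ ρ → f (look 0F ρ))
    r = rec-comp fᵣ (var 0F ∷ᵣ []ᵣ)

  module _ (em : ExcludedMiddle 0ℓ) where

    least : (P : ℕ → Set) → ∀ n → P n → ∃[ k ] P k × (∀ i → P i → k ℕ.≤ i)
    least P n p with em {P 0}
    ... | yes p₀ = 0 , p₀ , λ _ _ → z≤n
    least P zero p | no ¬p₀ = contradiction p ¬p₀
    least P (suc n) p | no ¬p₀ with least (λ i → P (suc i)) n p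
    ... | k , pk , minimal = suc k , pk , λ { zero p₀ → contradiction p₀ ¬p₀ ; (suc i) pi → s≤s (minimal i pi) }

    -- Simulating the identity function, U outputs σ on ρ0ˣ1 for x = code σ, so σ has a program;
    -- excluded middle then selects a shortest one.
    K-exists : ∀ U → Universal U → ∀ σ → ∃[ k ] K U σ k
    K-exists U universal σ =
      let k , attained , minimal = least (λ k → ∃[ τ ] length τ ≡ k × U [ τ ]= σ) (length τ₀) (τ₀ , refl , described)
      in k , record { attained = attained ; minimal = λ τ h → minimal (length τ) (τ , refl , h) }
      where
      simulation : _
      simulation = simulate U universal (proj zero) 0
      τ₀ : List Bool
      τ₀ = proj₁ simulation ++ unary (code σ ℕ.+ 0)
      described : U [ τ₀ ]= σ
      described = Equivalence.from (proj₂ simulation (code σ) (code σ)) refl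

  -- The combinatorial arguments bound the lengths of all programs. This and `COMPLEX⁺` translate
  -- between such bounds and the complexity `K` of the definition.
  COMPLEX⁻ : ∀ U (h : ℕ → ℕ) {X} → COMPLEX U (λ n → fromℕ (h n)) X → ∃[ c ] ∀ n τ → U [ τ ]= (X ↾ n) → h n ℕ.≤ length τ ℕ.+ c
  COMPLEX⁻ U h (c , complex) = c , λ n τ run → let k , kK , bound = complex n in
    ℕₚ.≤-trans (fromℕ-∸⁻ {h n} {c} {k} bound) (ℕₚ.+-monoˡ-≤ c (K.minimal kK τ run))

  COMPLEX⁺ : ExcludedMiddle 0ℓ → ∀ U → Universal U → ∀ (h : ℕ → ℕ) X →
    (∀ n τ → U [ τ ]= (X ↾ n) → h n ℕ.≤ length τ) → COMPLEX U (λ n → fromℕ (h n)) X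
  COMPLEX⁺ em U universal h X bound = 0 , λ n →
    let k , kK = K-exists em U universal (X ↾ n)
        τ , length≡ , run = K.attained kK
    in k , kK , fromℕ-∸ {h n} {0} {k} (ℕₚ.≤-trans (bound n τ run) (ℕₚ.≤-trans (ℕₚ.≤-reflexive length≡) (ℕₚ.m≤m+n k 0)))

  module _ {l t : ℕ → ℕ} (lᵣ : Rec none {1} (λ ρ → l (look 0F ρ))) (tᵣ : Rec none {1} (λ ρ → t (look 0F ρ))) where

    -- Primitive recursion on the number of bits read, with one query per step; the programs for `l`
    -- and `t` are imported by `lift`.
    read-block : ∃[ Φ ] ∀ X → Φ ⟨ X ⟩≡ (λ n → ∑< (l n) (λ i → 2 ^ i ℕ.* X (t n ℕ.+ i)))
    read-block = comp (prec start next) (lift (program lᵣ) ∷ proj zero ∷ []) ,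
      λ X n → l n ∷ n ∷ [] , (lift-runs (program lᵣ) _ _ (runs lᵣ (n , tt)) , refl , tt) , sums X n (l n)
      where
      zeroᵣ : Rec none {1} (λ _ → 0)
      zeroᵣ = lit 0

      addᵣ : Rec none {3} (λ ρ → look 1F ρ ℕ.+ 2 ^ look 0F ρ ℕ.* look 2F ρ)
      addᵣ = var 1F +ᵣ lit 2 ^ᵣ var 0F *ᵣ var 2F

      queryᵣ : Rec none {3} (λ ρ → t (look 2F ρ) ℕ.+ look 0F ρ)
      queryᵣ = rec-comp tᵣ (var 2F ∷ᵣ []ᵣ) +ᵣ var 0F

      start : Code ⊤ 1
      start = lift (program zeroᵣ)

      next : Code ⊤ 3
      next = comp (lift (program addᵣ)) (proj zero ∷ proj (suc zero) ∷ comp (oracle tt) (lift (program queryᵣ) ∷ []) ∷ [])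

      sums : ∀ X n k → ⟦ prec start next ⟧ (λ _ → X) (k ∷ n ∷ []) (∑< k (λ i → 2 ^ i ℕ.* X (t n ℕ.+ i)))
      sums X n zero    = lift-runs (program zeroᵣ) _ _ (runs zeroᵣ (n , tt))
      sums X n (suc k) = r , sums X n k ,
        (k ∷ r ∷ X (t n ℕ.+ k) ∷ [] ,
         (refl , refl , (t n ℕ.+ k ∷ [] , (lift-runs (program queryᵣ) _ _ (runs queryᵣ (k , r , n , tt)) , tt) , refl) , tt) ,
         lift-runs (program addᵣ) _ _ (runs addᵣ (k , r , X (t n ℕ.+ k) , tt)))
        where
        r : ℕ
        r = ∑< k (λ i → 2 ^ i ℕ.* X (t n ℕ.+ i))

  module Theorem (em : ExcludedMiddle 0ℓ) (U : Machine) (universal : Universal U)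
    (p : ℕ → ℝ) (p>1 : ∀ n → 1ℝ ℝ.< p n)
    (fast : FastGrowing p p>1) (sum-computable : Computable (FastGrowing.sum fast)) where

    open FastGrowth p p>1 fast sum-computable
    open Coding l l-mono N C C-suc C-bound lᵣ Nᵣ Cᵣ

    G : ℕ → ℝ
    G n = fromℕ (g n)

    nonnegative : ∀ n → 0ℝ ℝ.≤ G n
    nonnegative n = fromℕ-mono {0} {g n} z≤n

    g≤1+g : ∀ n → g (suc n) ℕ.≤ 1 ℕ.+ g n
    g≤1+g n = subst (ℕ._≤ 1 ℕ.+ g n) (sym (g-suc n)) (ℕₚ.+-monoˡ-≤ (g n) (digit≤1 (Free n)))

    g-mono : ∀ m n → m ℕ.≤ n → g m ℕ.≤ g n
    g-mono m n m≤n = subst (λ n → g m ℕ.≤ g n) (ℕₚ.m+[n∸m]≡n m≤n) (go (n ∸ m))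
      where
      go : ∀ d → g m ℕ.≤ g (m ℕ.+ d)
      go zero    = ℕₚ.≤-reflexive (cong g (sym (ℕₚ.+-identityʳ m)))
      go (suc d) = ℕₚ.≤-trans (go d) (ℕₚ.≤-trans (ℕₚ.m≤n+m (g (m ℕ.+ d)) (digit (Free (m ℕ.+ d))))
        (ℕₚ.≤-reflexive (trans (sym (g-suc (m ℕ.+ d))) (cong g (sym (ℕₚ.+-suc m d))))))

    order : OrderFunction G
    order = record
      { computable = fromℕ-computable g (var 0F ∸ᵣ zᵣ (var 0F))
      ; nondecreasing = λ m n m≤n → fromℕ-mono (g-mono m n m≤n)
      ; unbounded = λ b → let B , h = <fromℕ b ; n , B≤g = g-unbounded B in n , h (g n) B≤g
      }

    subIdentical : SubIdentical G
    subIdentical b = let B , h = ≤fromℕ b ; n₀ , B≤z = z-unbounded B in n₀ , λ n n₀≤n →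
      h n (g n) (ℕₚ.≤-trans (ℕₚ.+-monoˡ-≤ (g n) (ℕₚ.≤-trans B≤z (z-mono n₀≤n)))
        (ℕₚ.≤-reflexive (trans (ℕₚ.+-comm (z n) (g n)) (g+z n))))

    convex : Convex G
    convex n = fromℕ-∸ {g (suc n)} {g n} {1} (g≤1+g n)

    -- The functional is the same for all X, but LUA lets ψ vary with X: once n₀ bounds the hits of
    -- `ψ 0`, the restriction `ψ n₀` is avoided everywhere.
    reduction : LUA p ≤ₛ asBaire (COMPLEX U G)
    reduction = proj₁ reader , λ Y → λ { (X , complex , Y≡X) →
      let c , bound = COMPLEX⁻ U g complex
          ψ , linear , restricts = universal-restrictions U universal
          n₀ , avoids = eventually-avoids U universal (ψ 0) X c bound
      in block X ,
         (λ n → subst (⟦ proj₁ reader ⟧ (λ _ → Y) (n ∷ []))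
           (∑-cong (l n) λ i _ → cong (2 ^ i ℕ.*_) (Y≡X (t n ℕ.+ i))) (proj₂ reader Y n)) ,
         (λ n → Lower⇒< (p n) (block X n) (Lower-≤ (p n) (ι-mono {suc (block X n)} {2 ^ l n} (value< (λ i → X (t n ℕ.+ i)) (l n))) (Lower-l n))) ,
         ψ n₀ , linear n₀ , λ n run → let n₀≤n , run₀ = restricts n₀ n (block X n) run in avoids n n₀≤n run₀ }
      where
      reader : _
      reader = read-block {l} {t} (lᵣ (var 0F)) (sucᵣ (sᵣ (var 0F)))

    distinct : ¬ (COMPLEX U G ≐ MLR U)
    distinct (⊆ , _) = contradiction short (ℕₚ.<⇒≱ (ℕₚ.n<1+n (c′ ℕ.+ c)))
      where
      open Incompressible U (Universal.prefixFree universal)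
      open Compressible U universal
      X : ℕ → Bool
      X = branch em
      random : ∃[ c ] ∀ n τ → U [ τ ]= (X ↾ n) → n ℕ.≤ length τ ℕ.+ c
      random = COMPLEX⁻ U (λ n → n) (⊆ (COMPLEX⁺ em U universal g X (branch-incompressible em)))
      c c′ j : ℕ
      c = proj₁ random
      c′ = proj₁ compressor
      -- The least gain that exceeds the constants of randomness and of the compressor together.
      j = suc (c′ ℕ.+ c)
      compressed : ∃[ n ] ∃[ τ ] U [ τ ]= (X ↾ n) × length τ ℕ.+ j ℕ.≤ c′ ℕ.+ n
      compressed = proj₂ compressor X (branch-free em) j
      short : j ℕ.≤ c′ ℕ.+ c
      short = let n , τ , run , short = compressed in ℕₚ.+-cancelˡ-≤ (length τ) j (c′ ℕ.+ c)
        (ℕₚ.≤-trans short (ℕₚ.≤-trans (ℕₚ.+-monoʳ-≤ c′ (proj₂ random n τ run))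
          (ℕₚ.≤-reflexive (trans (sym (ℕₚ.+-assoc c′ (length τ) c)) (trans (cong (ℕ._+ c) (ℕₚ.+-comm c′ (length τ))) (ℕₚ.+-assoc (length τ) c′ c))))))

open import Axiom.ExcludedMiddle using (ExcludedMiddle)
open import Data.Nat using (ℕ)
open import Data.Product using (_×_; _,_; ∃-syntax)
open import Level using (0ℓ)
open import Relation.Nullary using (¬_)
open import Relation.Unary using (_≐_)
open import Defs

mainTheorem2 :
    ExcludedMiddle 0ℓ →
    (U : Machine) → Universal U →
    (p : ℕ → ℝ) (p>1 : ∀ n → 1ℝ < p n) →
    (fast : FastGrowing p p>1) → Computable (FastGrowing.sum fast) →
    ∃[ g ] (∀ n → 0ℝ ≤ g n) × OrderFunction g × SubIdentical g × Convex g
      × (LUA p ≤ₛ asBaire (COMPLEX U g))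
      × ¬ (COMPLEX U g ≐ MLR U)
mainTheorem2 em U universal p p>1 fast sum-computable =
  G , nonnegative , order , subIdentical , convex , reduction , distinct
  where open Conclusion.Theorem em U universal p p>1 fast sum-computable
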